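{- There exists a triple of positive integers $\mathbf{t}=(d,D,m)$ such that $$R_{3}^{\mathbf{t}}(4,n)>n^{(\log n)^{1/3-o(1)}},$$ where $o(1)$ denotes a quantity tending to $0$ as $n\to\infty$.
   Context: An $r$-uniform hypergraph $H$ is semi-algebraic of complexity $\mathbf{t}=(d,D,m)$ if there is an enumeration $v_1,\dots,v_N$ of its vertices, an assignment $v_i\mapsto p_i\in\mathbb{R}^d$ for $i\in[N]=\{1,\dots,N\}$, $m$ polynomials $f_1,\dots,f_m:(\mathbb{R}^d)^r\to\mathbb{R}$ of (total) degree at most $D$, and a function $\Phi:\{+,-,0\}^m\to\{\text{True},\text{False}\}$ such that for all $1\le i_1<\dots<i_r\le N$, the set $\{v_{i_1},\dots,v_{i_r}\}$ is an edge of $H$ if and only if $\Phi(\operatorname{sign}f_1(p_{i_1},\dots,p_{i_r}),\dots,\operatorname{sign}f_m(p_{i_1},\dots,p_{i_r}))=\text{True}$, where $\operatorname{sign}(x)\in\{+,-,0\}$ is the sign of $x$. The semi-algebraic Ramsey number $R_r^{\mathbf{t}}(s,n)$ is the smallest $N$ such that every $r$-uniform semi-algebraic hypergraph of complexity $\mathbf{t}$ on $N$ vertices contains either a clique of size $s$ (a set of $s$ vertices all of whose $r$-element subsets are edges) or an independent set of size $n$ (a set of $n$ vertices none of whose $r$-element subsets is an edge). -}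

module Defs where

open import Data.Bool.Base using (Bool; T)
open import Data.Fin.Base as Fin using (Fin)
open import Data.Fin.Permutation using (Permutation′; _⟨$⟩ʳ_)
open import Data.Fin.Subset using (Subset; ∣_∣; _⊆_; ⁅_⁆; ⋃)
import Data.Integer.Base as ℤ
open import Data.List.Base as List using (List)
open import Data.List.Relation.Unary.All using (All)
open import Data.Nat.Base as ℕ using (ℕ; zero; suc; _⊔_; _!)
import Data.Nat.Properties as ℕ
open import Data.Product.Base using (_×_; _,_; ∃; ∃-syntax)
open import Data.Rational.Base as ℚ using (ℚ; 0ℚ; 1ℚ; ½)
import Data.Rational.Properties as ℚ
open import Data.Rational.Solver using (module +-*-Solver)
open import Data.Sum.Base using (_⊎_)
open import Data.Vec.Base as Vec using (Vec)
import Data.Vec.Functional as Vector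
open import Function.Base using (_∘_)
open import Function.Bundles using (_⇔_)
open import Relation.Binary.PropositionalEquality
  using (_≡_; refl; sym; trans; cong; cong₂)
open import Relation.Nullary.Negation.Core using (¬_)

-- Real numbers, as Cauchy sequences of rationals.  Equality of reals is
-- the relation _≃_ below, not propositional equality.

dist : ℚ → ℚ → ℚ
dist p q = ℚ.∣ p ℚ.- q ∣

Cauchy : (ℕ → ℚ) → Set
Cauchy x = ∀ ε → 0ℚ ℚ.< ε →
  ∃[ M ] (∀ m n → M ℕ.≤ m → M ℕ.≤ n → dist (x m) (x n) ℚ.< ε)

record ℝ : Set where
  constructor mkℝ
  field
    seq    : ℕ → ℚ
    cauchy : Cauchy seq

open ℝ public

private
  open ℚ.≤-Reasoning
  open +-*-Solver using (solve; _:+_; _:*_; _:-_; :-_; _:=_)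

  EventuallyBounded : (ℕ → ℚ) → Set
  EventuallyBounded x =
    ∃[ B ] ℚ.Positive B × ∃[ M ] (∀ n → M ℕ.≤ n → ℚ.∣ x n ∣ ℚ.≤ B)

  recip : ∀ B → .{{_ : ℚ.Positive B}} → ℚ
  recip B = (ℚ.1/ B) {{ℚ.pos⇒nonZero B}}

  -- Opaque, so that normalising a real does not unfold its modulus.
  abstract
    dist-self : ∀ p → dist p p ≡ 0ℚ
    dist-self p = cong ℚ.∣_∣ (ℚ.+-inverseʳ p)

    halves : ∀ ε → ½ ℚ.* ε ℚ.+ ½ ℚ.* ε ≡ ε
    halves ε = trans (sym (ℚ.*-distribʳ-+ ε ½ ½)) (ℚ.*-identityˡ ε)

    half-pos : ∀ {ε} → 0ℚ ℚ.< ε → 0ℚ ℚ.< ½ ℚ.* ε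
    half-pos {ε} 0<ε = ℚ.positive⁻¹ _ {{ℚ.pos*pos⇒pos ½ ε {{ℚ.positive 0<ε}}}}

    +-cauchy : ∀ x y → Cauchy (seq x) → Cauchy (seq y) →
               Cauchy (λ n → seq x n ℚ.+ seq y n)
    +-cauchy x y cx cy ε 0<ε with cx (½ ℚ.* ε) (half-pos 0<ε) | cy (½ ℚ.* ε) (half-pos 0<ε)
    ... | M , p | M′ , q = M ⊔ M′ , λ m n m≥ n≥ →
      let a = seq x m ; b = seq x n ; c = seq y m ; d = seq y n in
      begin-strict
        dist (a ℚ.+ c) (b ℚ.+ d)
          ≡⟨ cong ℚ.∣_∣ (solve 4 (λ a b c d →
               (a :+ c) :- (b :+ d) := (a :- b) :+ (c :- d)) refl a b c d) ⟩
        ℚ.∣ (a ℚ.- b) ℚ.+ (c ℚ.- d) ∣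
          ≤⟨ ℚ.∣p+q∣≤∣p∣+∣q∣ (a ℚ.- b) (c ℚ.- d) ⟩
        dist a b ℚ.+ dist c d
          <⟨ ℚ.+-mono-< (p m n (ℕ.m⊔n≤o⇒m≤o M M′ m≥) (ℕ.m⊔n≤o⇒m≤o M M′ n≥))
                        (q m n (ℕ.m⊔n≤o⇒n≤o M M′ m≥) (ℕ.m⊔n≤o⇒n≤o M M′ n≥)) ⟩
        ½ ℚ.* ε ℚ.+ ½ ℚ.* ε
          ≡⟨ halves ε ⟩
        ε ∎

    neg-cauchy : ∀ x → Cauchy (seq x) → Cauchy (λ n → ℚ.- seq x n)
    neg-cauchy x cx ε 0<ε with cx ε 0<ε
    ... | M , p = M , λ m n m≥ n≥ →
      let a = seq x m ; b = seq x n in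
      begin-strict
        dist (ℚ.- a) (ℚ.- b)
          ≡⟨ cong ℚ.∣_∣ (solve 2 (λ a b → (:- a) :- (:- b) := :- (a :- b)) refl a b) ⟩
        ℚ.∣ ℚ.- (a ℚ.- b) ∣
          ≡⟨ ℚ.∣-p∣≡∣p∣ (a ℚ.- b) ⟩
        dist a b
          <⟨ p m n m≥ n≥ ⟩
        ε ∎

    bounded : ∀ x → EventuallyBounded (seq x)
    bounded x with cauchy x 1ℚ (ℚ.positive⁻¹ 1ℚ)
    ... | M , p =
      1ℚ ℚ.+ ℚ.∣ seq x M ∣ ,
      ℚ.positive (ℚ.+-mono-<-≤ (ℚ.positive⁻¹ 1ℚ) (ℚ.0≤∣p∣ (seq x M))) ,
      M , λ n n≥ →
      let a = seq x n ; b = seq x M in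
      begin
        ℚ.∣ a ∣
          ≡⟨ cong ℚ.∣_∣ (solve 2 (λ a b → a := (a :- b) :+ b) refl a b) ⟩
        ℚ.∣ (a ℚ.- b) ℚ.+ b ∣
          ≤⟨ ℚ.∣p+q∣≤∣p∣+∣q∣ (a ℚ.- b) b ⟩
        dist a b ℚ.+ ℚ.∣ b ∣
          ≤⟨ ℚ.+-monoˡ-≤ ℚ.∣ b ∣ (ℚ.<⇒≤ (p n M n≥ ℕ.≤-refl)) ⟩
        1ℚ ℚ.+ ℚ.∣ b ∣ ∎

    *-recip : ∀ B → .{{_ : ℚ.Positive B}} → ∀ ε → B ℚ.* (recip B ℚ.* ε) ≡ ε
    *-recip B ε = begin-equality
      B ℚ.* (recip B ℚ.* ε) ≡⟨ sym (ℚ.*-assoc B (recip B) ε) ⟩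
      B ℚ.* recip B ℚ.* ε   ≡⟨ cong (ℚ._* ε) (ℚ.*-inverseʳ B {{ℚ.pos⇒nonZero B}}) ⟩
      1ℚ ℚ.* ε              ≡⟨ ℚ.*-identityˡ ε ⟩
      ε                     ∎

    recip*-pos : ∀ B → .{{_ : ℚ.Positive B}} → ∀ ε → 0ℚ ℚ.< ε → 0ℚ ℚ.< recip B ℚ.* ε
    recip*-pos B ε 0<ε = ℚ.positive⁻¹ _
      {{ℚ.pos*pos⇒pos (recip B) {{ℚ.1/pos⇒pos B}} ε {{ℚ.positive 0<ε}}}}

    scaled : ∀ x B → .{{_ : ℚ.Positive B}} → ∀ ε → 0ℚ ℚ.< ε →
      ∃[ M ] (∀ m n → M ℕ.≤ m → M ℕ.≤ n → B ℚ.* dist (seq x m) (seq x n) ℚ.< ε)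
    scaled x B ε 0<ε =
      let M , p = cauchy x (recip B ℚ.* ε) (recip*-pos B ε 0<ε)
      in M , λ m n m≥ n≥ →
        ℚ.<-≤-trans (ℚ.*-monoʳ-<-pos B (p m n m≥ n≥)) (ℚ.≤-reflexive (*-recip B ε))

    *-difference : ∀ a b c d →
      a ℚ.* c ℚ.- b ℚ.* d ≡ a ℚ.* (c ℚ.- d) ℚ.+ d ℚ.* (a ℚ.- b)
    *-difference = solve 4 (λ a b c d →
      (a :* c) :- (b :* d) := a :* (c :- d) :+ d :* (a :- b)) refl

    *-distance : ∀ a b c d A B ε → ℚ.∣ a ∣ ℚ.≤ A → ℚ.∣ d ∣ ℚ.≤ B →
      A ℚ.* dist c d ℚ.< ½ ℚ.* ε → B ℚ.* dist a b ℚ.< ½ ℚ.* ε →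
      dist (a ℚ.* c) (b ℚ.* d) ℚ.< ε
    *-distance a b c d A B ε a≤A d≤B Acd Bab = begin-strict
      dist (a ℚ.* c) (b ℚ.* d)
        ≡⟨ cong ℚ.∣_∣ (*-difference a b c d) ⟩
      ℚ.∣ a ℚ.* (c ℚ.- d) ℚ.+ d ℚ.* (a ℚ.- b) ∣
        ≤⟨ ℚ.∣p+q∣≤∣p∣+∣q∣ (a ℚ.* (c ℚ.- d)) (d ℚ.* (a ℚ.- b)) ⟩
      ℚ.∣ a ℚ.* (c ℚ.- d) ∣ ℚ.+ ℚ.∣ d ℚ.* (a ℚ.- b) ∣
        ≡⟨ cong₂ ℚ._+_ (ℚ.∣p*q∣≡∣p∣*∣q∣ a (c ℚ.- d)) (ℚ.∣p*q∣≡∣p∣*∣q∣ d (a ℚ.- b)) ⟩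
      ℚ.∣ a ∣ ℚ.* dist c d ℚ.+ ℚ.∣ d ∣ ℚ.* dist a b
        ≤⟨ ℚ.+-mono-≤
             (ℚ.*-monoʳ-≤-nonNeg (dist c d) {{ℚ.nonNegative (ℚ.0≤∣p∣ (c ℚ.- d))}} a≤A)
             (ℚ.*-monoʳ-≤-nonNeg (dist a b) {{ℚ.nonNegative (ℚ.0≤∣p∣ (a ℚ.- b))}} d≤B) ⟩
      A ℚ.* dist c d ℚ.+ B ℚ.* dist a b
        <⟨ ℚ.+-mono-< Acd Bab ⟩
      ½ ℚ.* ε ℚ.+ ½ ℚ.* ε
        ≡⟨ halves ε ⟩
      ε ∎

    *-cauchy : ∀ x y → Cauchy (λ n → seq x n ℚ.* seq y n)
    *-cauchy x y ε 0<ε =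
      let A , A>0 , K , boundx = bounded x
          B , B>0 , L , boundy = bounded y
          M  , p = scaled y A {{A>0}} (½ ℚ.* ε) (half-pos 0<ε)
          M′ , q = scaled x B {{B>0}} (½ ℚ.* ε) (half-pos 0<ε)
      in (K ⊔ L) ⊔ (M ⊔ M′) , λ m n m≥ n≥ →
      let m≥KL = ℕ.m⊔n≤o⇒m≤o (K ⊔ L) (M ⊔ M′) m≥
          n≥KL = ℕ.m⊔n≤o⇒m≤o (K ⊔ L) (M ⊔ M′) n≥
          m≥MM = ℕ.m⊔n≤o⇒n≤o (K ⊔ L) (M ⊔ M′) m≥
          n≥MM = ℕ.m⊔n≤o⇒n≤o (K ⊔ L) (M ⊔ M′) n≥
      in *-distance (seq x m) (seq x n) (seq y m) (seq y n) A B ε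
           (boundx m (ℕ.m⊔n≤o⇒m≤o K L m≥KL))
           (boundy n (ℕ.m⊔n≤o⇒n≤o K L n≥KL))
           (p m n (ℕ.m⊔n≤o⇒m≤o M M′ m≥MM) (ℕ.m⊔n≤o⇒m≤o M M′ n≥MM))
           (q m n (ℕ.m⊔n≤o⇒n≤o M M′ m≥MM) (ℕ.m⊔n≤o⇒n≤o M M′ n≥MM))

fromℚ : ℚ → ℝ
fromℚ q = mkℝ (λ _ → q) λ ε 0<ε → 0 , λ _ _ _ _ → begin-strict
  dist q q ≡⟨ dist-self q ⟩
  0ℚ       <⟨ 0<ε ⟩
  ε        ∎

fromℕ : ℕ → ℝ
fromℕ n = fromℚ (ℤ.+ n ℚ./ 1)

0ℝ 1ℝ ⅓ : ℝ
0ℝ = fromℚ 0ℚ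
1ℝ = fromℚ 1ℚ
⅓  = fromℚ (ℤ.+ 1 ℚ./ 3)

infixl 6 _+_ _-_
infixl 7 _*_
infixr 8 _^_
infix  8 -_
infix  4 _<_ _≃_

_+_ _*_ : ℝ → ℝ → ℝ
x + y = mkℝ (λ n → seq x n ℚ.+ seq y n) (+-cauchy x y (cauchy x) (cauchy y))
x * y = mkℝ (λ n → seq x n ℚ.* seq y n) (*-cauchy x y)

-_ : ℝ → ℝ
- x = mkℝ (λ n → ℚ.- seq x n) (neg-cauchy x (cauchy x))

_-_ : ℝ → ℝ → ℝ
x - y = x + - y

_^_ : ℝ → ℕ → ℝ
x ^ zero  = 1ℝ
x ^ suc k = x * x ^ k

_<_ _≃_ : ℝ → ℝ → Set
x < y = ∃[ ε ] 0ℚ ℚ.< ε × ∃[ M ] (∀ n → M ℕ.≤ n → seq x n ℚ.+ ε ℚ.≤ seq y n)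
x ≃ y = ∀ ε → 0ℚ ℚ.< ε → ∃[ M ] (∀ n → M ℕ.≤ n → dist (seq x n) (seq y n) ℚ.< ε)

ConvergesTo : (ℕ → ℝ) → ℝ → Set
ConvergesTo s x = ∀ ε → 0ℚ ℚ.< ε →
  ∃[ M ] (∀ n → M ℕ.≤ n → x - fromℚ ε < s n × s n < x + fromℚ ε)

-- Exponential, logarithm and real powers, given by their graphs:
-- IsExp x y, IsLog x y and IsPow a b c say that exp x = y, log x = y
-- (natural logarithm) and a ^ b = exp (b log a) = c.

1/_! : ℕ → ℚ
1/ k ! = (ℤ.+ 1 ℚ./ (k !)) {{ℕ._!≢0 k}}

expPartialSum : ℝ → ℕ → ℝ
expPartialSum x zero    = 0ℝ
expPartialSum x (suc k) = expPartialSum x k + fromℚ (1/ k !) * x ^ k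

IsExp : ℝ → ℝ → Set
IsExp x y = ConvergesTo (expPartialSum x) y

IsLog : ℝ → ℝ → Set
IsLog x y = IsExp y x

IsPow : ℝ → ℝ → ℝ → Set
IsPow a b c = ∃[ ℓ ] IsLog a ℓ × IsExp (b * ℓ) c

-- Polynomials on (ℝ^d)^r, as formal sums of monomials; the exponent of
-- the i-th coordinate of the j-th point is exponent j i.

Point : ℕ → Set
Point d = Fin d → ℝ

record Monomial (r d : ℕ) : Set where
  field
    coefficient : ℝ
    exponent    : Fin r → Fin d → ℕ

open Monomial public

Polynomial : ℕ → ℕ → Set
Polynomial r d = List (Monomial r d)

module _ {r d : ℕ} where

  monomialDegree : Monomial r d → ℕ
  monomialDegree μ =
    Vector.foldr ℕ._+_ 0 λ j → Vector.foldr ℕ._+_ 0 λ i → exponent μ j i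

  DegreeAtMost : ℕ → Polynomial r d → Set
  DegreeAtMost D f = All (λ μ → monomialDegree μ ℕ.≤ D) f

  evalMonomial : Monomial r d → (Fin r → Point d) → ℝ
  evalMonomial μ p = coefficient μ *
    Vector.foldr _*_ 1ℝ λ j → Vector.foldr _*_ 1ℝ λ i → p j i ^ exponent μ j i

  eval : Polynomial r d → (Fin r → Point d) → ℝ
  eval f p = List.foldr _+_ 0ℝ (List.map (λ μ → evalMonomial μ p) f)

data Sign : Set where
  pos neg nul : Sign

HasSign : ℝ → Sign → Set
HasSign x pos = 0ℝ < x
HasSign x neg = x < 0ℝ
HasSign x nul = x ≃ 0ℝ

record Hypergraph (r N : ℕ) : Set where
  field
    edge    : Subset N → Bool
    uniform : ∀ e → T (edge e) → ∣ e ∣ ≡ r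

open Hypergraph public

module _ {r N : ℕ} (H : Hypergraph r N) where

  IsClique : Subset N → Set
  IsClique S = ∀ e → e ⊆ S → ∣ e ∣ ≡ r → T (edge H e)

  IsIndependent : Subset N → Set
  IsIndependent S = ∀ e → e ⊆ S → ∣ e ∣ ≡ r → ¬ T (edge H e)

record Complexity : Set where
  constructor ⟨_,_,_⟩
  field
    dimension degree count : ℕ

setOf : ∀ {r N} → (Fin r → Fin N) → Subset N
setOf v = ⋃ (List.tabulate (⁅_⁆ ∘ v))

Increasing : ∀ {r N} → (Fin r → Fin N) → Set
Increasing i = ∀ {a b} → a Fin.< b → i a Fin.< i b

record SemiAlgebraic (t : Complexity) {r N : ℕ} (H : Hypergraph r N) : Set where
  open Complexity t renaming (dimension to d; degree to D; count to m)
  field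
    enumeration : Permutation′ N
    point       : Fin N → Point d
    polynomial  : Fin m → Polynomial r d
    degree≤     : ∀ k → DegreeAtMost D (polynomial k)
    Φ           : Vec Sign m → Bool
    -- σ is unique; it is quantified because sign is not a computable
    -- function on the reals.
    edge⇔Φ      : ∀ (i : Fin r → Fin N) → Increasing i →
      ∃[ σ ] (∀ k → HasSign (eval (polynomial k) (point ∘ i)) (Vec.lookup σ k))
           × (T (edge H (setOf ((enumeration ⟨$⟩ʳ_) ∘ i))) ⇔ T (Φ σ))

RamseyProperty : (r : ℕ) (t : Complexity) (s n N : ℕ) → Set
RamseyProperty r t s n N = (H : Hypergraph r N) → SemiAlgebraic t H →
    (∃[ S ] ∣ S ∣ ≡ s × IsClique H S)
  ⊎ (∃[ S ] ∣ S ∣ ≡ n × IsIndependent H S)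

IsRamseyNumber : (r : ℕ) (t : Complexity) (s n R : ℕ) → Set
IsRamseyNumber r t s n R =
  RamseyProperty r t s n R × (∀ N → RamseyProperty r t s n N → R ℕ.≤ N)

module Submission where

-- Let k = q⁴ and let G be the graph on the flags (point, line) of the grid
-- {0..q-1} × {0..2q²-1} with the lines y = a x + b, where a < q and b < q²;
-- a flag (p , ℓ) is joined to (p′ , ℓ′) when p′ lies on ℓ, to the right of p,
-- and ℓ′ is steeper than ℓ.  Two lines meet at most once, so G is
-- triangle-free, and by the abundance of incidences it has k = q⁴ vertices
-- but only q^O(q³) independent sets.  Step up: the vertices are the binary
-- words of length k, and u < v < w is an edge when δ(u,w) and δ(u,v) are
-- adjacent in G, where δ is the first position in which two words differ.
-- A clique of size 4 would give a triangle of G through the links of its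
-- smallest element; the vertices u of an independent set S are told apart by
-- the independent sets { δ(u,v) : u < v ∈ S }.  So there are 2^(q⁴) vertices
-- while n is about q^(3q³).  The hypergraph is semi-algebraic because a word
-- can be placed at Σᵢ uᵢ B⁻ⁱ (1 , xᵢ , aᵢ , bᵢ): for large B, the difference
-- of two words is almost parallel to the coordinates of the flag at which
-- they split.
--
-- For the estimate of n ^ ((log n) ^ (1/3 - 1/(3t))), the equation
-- E ^ (3t) = L ^ (t-1) for E = L ^ (1/3 - 1/(3t)) eliminates the exponential
-- function up to bounds as crude as 2 ≤ e ≤ 4.

-- The exponent 1/3 is the gap between q⁴ flags and about q³ lines and points: log R is at least q⁴
-- log 2 while log n is about q³ log q, so log R is (log n)^(4/3 - o(1)). The step-up bounds an
-- independent set by the number of independent sets of G, not by their size; this is why G must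
-- have so few of them.
--
-- Two obstacles shape the rest. Adjacency contains an equation, which no perturbation respects. Its
-- coordinates are integers, however, so the equation I = 0 can be replaced by the strict
-- inequalities 1 + 2I > 0 and 1 - 2I > 0, which survive. The displacement of two words is moreover
-- known only up to an unknown power of B, so the polynomials must be homogeneous in each
-- displacement.
--
-- Secondly, the order of the reals is not decidable. So the o(1) term is a unit fraction, which
-- makes the exponent rational and the power an algebraic relation, and every analytic bound is read
-- off rational approximations with a slack that the gaps between integers absorb. The side q runs
-- only through the powers 2^(s²), and n is compared with the two thresholds around it.

import Data.Nat.Properties as ℕ
open import Data.Product.Base using (_×_; _,_; ∃-syntax; proj₁; proj₂)
open import Function.Base using (_∘_; case_of_)
open import Relation.Binary.PropositionalEquality hiding ([_])
open import Relation.Nullary.Decidable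
  using (Dec; yes; no; ⌊_⌋; toWitness; fromWitness; _×-dec_; map′)
open import Relation.Nullary.Negation using (¬_; contradiction)

-- Finite sets as sorted lists, and 3-uniform hypergraphs given by a rule on increasing triples.

module Subsets where

  open import Defs using (Hypergraph; IsClique; IsIndependent; setOf; Increasing; edge)
  open import Data.Bool.Base using (Bool; false; T)
  open import Data.Fin.Base as Fin using (Fin; zero; suc)
  import Data.Fin.Properties as Fin
  open import Data.Fin.Patterns
  open import Data.Fin.Subset
    using (Subset; inside; outside; _∈_; _⊆_; ∣_∣; ⁅_⁆; ⋃)
  open import Data.Fin.Subset.Properties
    using (∉⊥; x∈p∪q⁺; x∈p∪q⁻; x∈⁅x⁆; x∈⁅y⁆⇒x≡y)
  open import Data.List.Base as List using (List; []; _∷_; length)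
  import Data.List.Properties as List
  import Data.List.Membership.Propositional as List
  import Data.List.Membership.Propositional.Properties as List
  open import Data.List.Relation.Unary.All as All using (All; []; _∷_)
  import Data.List.Relation.Unary.All.Properties as All
  open import Data.List.Relation.Unary.AllPairs as AllPairs using (AllPairs; []; _∷_)
  import Data.List.Relation.Unary.AllPairs.Properties as AllPairs
  open import Data.List.Relation.Unary.Any using (here; there)
  open import Data.Nat.Base using (ℕ; zero; suc; _≤_; s≤s; z≤n)
  open import Data.Sum.Base using (inj₁; inj₂)
  open import Data.Vec.Base using ([]; _∷_; here; there)
  open import Relation.Binary.Definitions using (tri<; tri≈; tri>)

  private variable
    N : ℕ

  elements : Subset N → List (Fin N)
  elements []            = []
  elements (inside  ∷ p) = zero ∷ List.map suc (elements p)
  elements (outside ∷ p) = List.map suc (elements p)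

  Sorted : List (Fin N) → Set
  Sorted = AllPairs Fin._<_

  length-elements : (p : Subset N) → length (elements p) ≡ ∣ p ∣
  length-elements []            = refl
  length-elements (inside  ∷ p) =
    cong suc (trans (List.length-map suc (elements p)) (length-elements p))
  length-elements (outside ∷ p) =
    trans (List.length-map suc (elements p)) (length-elements p)

  elements-sorted : (p : Subset N) → Sorted (elements p)
  elements-sorted []            = []
  elements-sorted (inside  ∷ p) =
    All.map⁺ (All.universal (λ _ → s≤s z≤n) (elements p)) ∷
    AllPairs.map⁺ (AllPairs.map s≤s (elements-sorted p))
  elements-sorted (outside ∷ p) = AllPairs.map⁺ (AllPairs.map s≤s (elements-sorted p))

  ∈-elements⁺ : ∀ {x} (p : Subset N) → x ∈ p → x List.∈ elements p
  ∈-elements⁺ (inside  ∷ p) here        = here refl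
  ∈-elements⁺ (inside  ∷ p) (there x∈p) = there (List.∈-map⁺ suc (∈-elements⁺ p x∈p))
  ∈-elements⁺ (outside ∷ p) (there x∈p) = List.∈-map⁺ suc (∈-elements⁺ p x∈p)

  ∈-elements⁻ : ∀ {x} (p : Subset N) → x List.∈ elements p → x ∈ p
  ∈-elements⁻ (inside  ∷ p) (here refl) = here
  ∈-elements⁻ (inside  ∷ p) (there x∈)  with _ , y∈ , refl ← List.∈-map⁻ suc x∈ =
    there (∈-elements⁻ p y∈)
  ∈-elements⁻ (outside ∷ p) x∈          with _ , y∈ , refl ← List.∈-map⁻ suc x∈ =
    there (∈-elements⁻ p y∈)

  -- If the heads differed, each would occur in the tail of the other list and so lie above the
  -- other head.
  sorted-extensional : ∀ {xs ys : List (Fin N)} → Sorted xs → Sorted ys →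
    (∀ {x} → x List.∈ xs → x List.∈ ys) → (∀ {x} → x List.∈ ys → x List.∈ xs) → xs ≡ ys
  sorted-extensional {xs = []}     {[]}     _ _ _ _ = refl
  sorted-extensional {xs = []}     {y ∷ ys} _ _ _ g = case g (here refl) of λ ()
  sorted-extensional {xs = x ∷ xs} {[]}     _ _ f _ = case f (here refl) of λ ()
  sorted-extensional {xs = x ∷ xs} {y ∷ ys} (x< ∷ sx) (y< ∷ sy) f g with heads
    where
    heads : x ≡ y
    heads with f (here refl) | g (here refl)
    ... | here x≡y | _         = x≡y
    ... | there _  | here y≡x  = sym y≡x
    ... | there x∈ | there y∈  = contradiction (All.lookup x< y∈) (Fin.<-asym (All.lookup y< x∈))
  ... | refl = cong (x ∷_) (sorted-extensional sx sy
    (λ z∈ → tail x< z∈ (f (there z∈))) (λ z∈ → tail y< z∈ (g (there z∈))))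
    where
    tail : ∀ {zs ws z} → All (x Fin.<_) zs → z List.∈ zs → z List.∈ x ∷ ws → z List.∈ ws
    tail x<zs z∈ (here refl) = contradiction (All.lookup x<zs z∈) (Fin.<-irrefl refl)
    tail _    _  (there z∈′) = z∈′

  ∈-⋃⁅⁆⁺ : ∀ {x} {xs : List (Fin N)} → x List.∈ xs → x ∈ ⋃ (List.map ⁅_⁆ xs)
  ∈-⋃⁅⁆⁺ (here refl) = x∈p∪q⁺ (inj₁ (x∈⁅x⁆ _))
  ∈-⋃⁅⁆⁺ (there x∈)  = x∈p∪q⁺ (inj₂ (∈-⋃⁅⁆⁺ x∈))

  ∈-⋃⁅⁆⁻ : ∀ {x} (xs : List (Fin N)) → x ∈ ⋃ (List.map ⁅_⁆ xs) → x List.∈ xs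
  ∈-⋃⁅⁆⁻ []       x∈ = contradiction x∈ ∉⊥
  ∈-⋃⁅⁆⁻ (y ∷ ys) x∈ with x∈p∪q⁻ ⁅ y ⁆ (⋃ (List.map ⁅_⁆ ys)) x∈
  ... | inj₁ x∈⁅y⁆ = here (x∈⁅y⁆⇒x≡y y x∈⁅y⁆)
  ... | inj₂ x∈ys  = there (∈-⋃⁅⁆⁻ ys x∈ys)

  elements-⋃⁅⁆ : {xs : List (Fin N)} → Sorted xs → elements (⋃ (List.map ⁅_⁆ xs)) ≡ xs
  elements-⋃⁅⁆ {xs = xs} s = sorted-extensional (elements-sorted p) s
    (∈-⋃⁅⁆⁻ xs ∘ ∈-elements⁻ p) (∈-elements⁺ p ∘ ∈-⋃⁅⁆⁺)
    where p = ⋃ (List.map ⁅_⁆ xs)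

  -- Asks for distinct values on increasing pairs only: the codes of two vertices are compared by
  -- looking from the smaller one to the larger.
  injective⇒∣p∣≤ : ∀ {C} (p : Subset N) (f : Fin N → Fin C) →
    (∀ {u v} → u ∈ p → v ∈ p → u Fin.< v → f u ≢ f v) → ∣ p ∣ ≤ C
  injective⇒∣p∣≤ {N = N} {C} p f f-inj = subst (_≤ C) (length-elements p) (Fin.injective⇒≤ inj)
    where
    xs = elements p

    lookup-mono : ∀ {xs : List (Fin N)} → Sorted xs → ∀ {i j} → i Fin.< j →
      List.lookup xs i Fin.< List.lookup xs j
    lookup-mono {x ∷ xs} (x< ∷ _) {zero}  {suc j} _         = All.lookup x< (List.∈-lookup j)
    lookup-mono {x ∷ xs} (_ ∷ s)  {suc i} {suc j} (s≤s i<j) = lookup-mono s i<j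

    apart : ∀ {i j} → i Fin.< j → f (List.lookup xs i) ≢ f (List.lookup xs j)
    apart {i} {j} i<j = f-inj (∈-elements⁻ p (List.∈-lookup i)) (∈-elements⁻ p (List.∈-lookup j))
      (lookup-mono (elements-sorted p) i<j)

    inj : ∀ {i j} → f (List.lookup xs i) ≡ f (List.lookup xs j) → i ≡ j
    inj {i} {j} eq with Fin.<-cmp i j
    ... | tri< i<j _ _ = contradiction eq (apart i<j)
    ... | tri≈ _ i≡j _ = i≡j
    ... | tri> _ _ j<i = contradiction (sym eq) (apart j<i)

  module _ (φ : Fin N → Fin N → Fin N → Bool) where

    onTriple : List (Fin N) → Bool
    onTriple (u ∷ v ∷ w ∷ []) = φ u v w
    onTriple _                = false

    onTriple⇒length : ∀ xs → T (onTriple xs) → length xs ≡ 3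
    onTriple⇒length (_ ∷ _ ∷ _ ∷ []) _ = refl

    -- An edge is an unordered set whereas the rule `φ` depends on the order; sorting the elements
    -- restores it.
    tripleHypergraph : Hypergraph 3 N
    tripleHypergraph = record
      { edge    = onTriple ∘ elements
      ; uniform = λ e e∈H → trans (sym (length-elements e)) (onTriple⇒length (elements e) e∈H)
      }

    edge-triple : ∀ {u v w} → u Fin.< v → v Fin.< w →
      edge tripleHypergraph (⋃ (List.map ⁅_⁆ (u ∷ v ∷ w ∷ []))) ≡ φ u v w
    edge-triple u<v v<w = cong onTriple (elements-⋃⁅⁆
      ((u<v ∷ Fin.<-trans u<v v<w ∷ []) ∷ (v<w ∷ []) ∷ [] ∷ []))

    edge-setOf : (i : Fin 3 → Fin N) → Increasing i →
      edge tripleHypergraph (setOf i) ≡ φ (i 0F) (i 1F) (i 2F)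
    edge-setOf i i-inc = edge-triple (i-inc (s≤s z≤n)) (i-inc (s≤s (s≤s z≤n)))

    private
      triple⊆ : ∀ {S : Subset N} {u v w} → u ∈ S → v ∈ S → w ∈ S →
        ⋃ (List.map ⁅_⁆ (u ∷ v ∷ w ∷ [])) ⊆ S
      triple⊆ {u = u} {v} {w} u∈ v∈ w∈ x∈ with ∈-⋃⁅⁆⁻ (u ∷ v ∷ w ∷ []) x∈
      ... | here refl                 = u∈
      ... | there (here refl)         = v∈
      ... | there (there (here refl)) = w∈

      ∣triple∣ : ∀ {u v w : Fin N} → u Fin.< v → v Fin.< w →
        ∣ ⋃ (List.map ⁅_⁆ (u ∷ v ∷ w ∷ [])) ∣ ≡ 3
      ∣triple∣ {u} {v} {w} u<v v<w = trans (sym (length-elements (⋃ (List.map ⁅_⁆ (u ∷ v ∷ w ∷ [])))))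
        (cong length (elements-⋃⁅⁆ ((u<v ∷ Fin.<-trans u<v v<w ∷ []) ∷ (v<w ∷ []) ∷ [] ∷ [])))

    clique⇒φ : ∀ {S} → IsClique tripleHypergraph S → ∀ {u v w} →
      u ∈ S → v ∈ S → w ∈ S → u Fin.< v → v Fin.< w → T (φ u v w)
    clique⇒φ clique u∈ v∈ w∈ u<v v<w = subst T (edge-triple u<v v<w)
      (clique _ (triple⊆ u∈ v∈ w∈) (∣triple∣ u<v v<w))

    independent⇒¬φ : ∀ {S} → IsIndependent tripleHypergraph S → ∀ {u v w} →
      u ∈ S → v ∈ S → w ∈ S → u Fin.< v → v Fin.< w → ¬ T (φ u v w)
    independent⇒¬φ independent u∈ v∈ w∈ u<v v<w uvw = independent _ (triple⊆ u∈ v∈ w∈)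
      (∣triple∣ u<v v<w) (subst T (sym (edge-triple u<v v<w)) uvw)

  fourElements : (p : Subset N) → ∣ p ∣ ≡ 4 →
    ∃[ a ] ∃[ b ] ∃[ c ] ∃[ d ]
      (a ∈ p × b ∈ p × c ∈ p × d ∈ p) × (a Fin.< b × b Fin.< c × c Fin.< d)
  fourElements p ∣p∣≡4
    with elements p | elements-sorted p | (λ x → ∈-elements⁻ {x = x} p)
       | trans (length-elements p) ∣p∣≡4
  ... | a ∷ b ∷ c ∷ d ∷ [] | (a<b ∷ _) ∷ (b<c ∷ _) ∷ (c<d ∷ _) ∷ _ | ∈p | refl =
    a , b , c , d ,
    (∈p a (here refl) , ∈p b (there (here refl)) , ∈p c (there (there (here refl))) ,
     ∈p d (there (there (there (here refl))))) ,
    (a<b , b<c , c<d)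

-- Binary words and the position at which two of them split.

module StepUp where

  open import Defs using (Hypergraph; IsClique; IsIndependent)
  open Subsets
  open import Level using (0ℓ)
  open import Data.Bool.Base using (Bool; true; false)
  open import Data.Fin.Base as Fin
    using (Fin; zero; suc; toℕ; combine; quotient; remainder; funToFin; finToFun)
  import Data.Fin.Properties as Fin
  open import Data.Fin.Subset using (Subset; _∈_; ∣_∣)
  open import Data.Fin.Subset.Properties using (_∈?_)
  open import Data.Nat.Base using (ℕ; zero; suc; _+_; _*_; _∸_; _^_; _≤_; _<_; s≤s; z≤n)
  open import Data.Nat.Tactic.RingSolver using (solve-∀)
  open import Data.Vec.Base using (Vec; []; _∷_)
  open import Relation.Binary.Definitions using (tri<; tri≈; tri>)
  open import Relation.Unary using (Pred; Decidable)

  -- Holds the first difference together with the order of the two words: the smaller word has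
  -- `false` there.
  data Split : ∀ {k} → Vec Bool k → Vec Bool k → Fin k → Set where
    here  : ∀ {k} {u v : Vec Bool k} → Split (false ∷ u) (true ∷ v) zero
    there : ∀ {k b i} {u v : Vec Bool k} → Split u v i → Split (b ∷ u) (b ∷ v) (suc i)

  split-unique : ∀ {k i j} {u v : Vec Bool k} → Split u v i → Split u v j → i ≡ j
  split-unique here      here      = refl
  split-unique (there p) (there q) = cong suc (split-unique p q)

  -- The middle word would have both `true` and `false` at position `i`.
  split-once : ∀ {k i} {u v w : Vec Bool k} → Split u v i → ¬ Split v w i
  split-once (there p) (there q) = split-once p q

  split-asym : ∀ {k i j} {u v : Vec Bool k} → Split u v i → ¬ Split v u j
  split-asym (there p) (there q) = split-asym p q

  -- Before `j` the words `u` and `v` agree, so `v` inherits from `u` the digit `false` at `i`. This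
  -- turns the order of positions into the reverse order of vertices.
  split-order : ∀ {k i j} {u v w : Vec Bool k} →
    i Fin.< j → Split u w i → Split u v j → Split v w i
  split-order i<j       here      (there q) = here
  split-order (s≤s i<j) (there p) (there q) = there (split-order i<j p q)

  split? : ∀ {k} (u v : Vec Bool k) i → Dec (Split u v i)
  split? (false ∷ u) (true  ∷ v) zero    = yes here
  split? (false ∷ u) (false ∷ v) zero    = no λ ()
  split? (true  ∷ u) (b     ∷ v) zero    = no λ ()
  split? (false ∷ u) (true  ∷ v) (suc i) = no λ ()
  split? (true  ∷ u) (false ∷ v) (suc i) = no λ ()
  split? (false ∷ u) (false ∷ v) (suc i) = map′ there (λ { (there p) → p }) (split? u v i)
  split? (true  ∷ u) (true  ∷ v) (suc i) = map′ there (λ { (there p) → p }) (split? u v i)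

  -- The most significant digit comes first, so the numerical order is the lexicographic one.
  binary : ∀ k → ℕ → Vec Bool k
  binary zero    m = []
  binary (suc k) m with m ℕ.<? 2 ^ k
  ... | yes _ = false ∷ binary k m
  ... | no  _ = true  ∷ binary k (m ∸ 2 ^ k)

  binary-split : ∀ k {m n} → m < n → n < 2 ^ k → ∃[ i ] Split (binary k m) (binary k n) i
  binary-split zero    m<n (s≤s n≤0) = contradiction (ℕ.<-≤-trans m<n n≤0) ℕ.n≮0
  binary-split (suc k) {m} {n} m<n n<2^ with m ℕ.<? 2 ^ k | n ℕ.<? 2 ^ k
  ... | yes _   | yes n<  = let i , s = binary-split k m<n n< in suc i , there s
  ... | yes _   | no _    = zero , here
  ... | no m≮   | yes n<  = contradiction (ℕ.<-trans m<n n<) m≮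
  ... | no m≮   | no _    = let i , s = binary-split k (ℕ.∸-monoˡ-< m<n 2^k≤m) n∸< in suc i , there s
    where
    2^k≤m : 2 ^ k ≤ m
    2^k≤m = ℕ.≮⇒≥ m≮
    n∸< : n ∸ 2 ^ k < 2 ^ k
    n∸< = ℕ.<-≤-trans (ℕ.∸-monoˡ-< n<2^ (ℕ.≤-trans 2^k≤m (ℕ.<⇒≤ m<n)))
      (ℕ.≤-reflexive (trans (ℕ.m+n∸m≡n (2 ^ k) _) (ℕ.+-identityʳ _)))

  -- The value `zero` means that there is no witness; with it the outcome is one letter of an
  -- alphabet of size `suc m`, which suits a code.
  first : ∀ {m} {P : Pred (Fin m) 0ℓ} → Decidable P → Fin (suc m)
  first {zero}  P? = zero
  first {suc m} P? with P? zero | first (P? ∘ suc)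
  ... | yes _ | _     = suc zero
  ... | no  _ | zero  = zero
  ... | no  _ | suc i = suc (suc i)

  first-sound : ∀ {m} {P : Pred (Fin m) 0ℓ} (P? : Decidable P) {i} → first P? ≡ suc i → P i
  first-sound {suc m} P? eq with P? zero | first (P? ∘ suc) in eq′
  first-sound {suc m} P? refl | yes p | _     = p
  first-sound {suc m} P? refl | no  _ | suc i = first-sound (P? ∘ suc) eq′

  first-least : ∀ {m} {P : Pred (Fin m) 0ℓ} (P? : Decidable P) {i} →
    P i → (∀ {j} → j Fin.< i → ¬ P j) → first P? ≡ suc i
  first-least P? {zero} p least with P? zero | first (P? ∘ suc)
  ... | yes _ | _ = refl
  ... | no ¬p | _ = contradiction p ¬p
  first-least P? {suc i} p least with P? zero | first (P? ∘ suc) | first-least (P? ∘ suc) p (least ∘ s≤s)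
  ... | yes p₀ | _ | _    = contradiction p₀ (least (s≤s z≤n))
  ... | no _   | _ | refl = refl

  -- The flag graph: triangle-free, with few independent sets.

  -- The two sides differ by (n - m)(p - o), which appears as `suc d * suc e`.
  rectangle : ∀ {m n o p} → m < n → o < p → m * p + n * o < m * o + n * p
  rectangle {m} {n} {o} {p} m<n o<p
    with d , refl ← ℕ.m≤n⇒∃[o]m+o≡n m<n | e , refl ← ℕ.m≤n⇒∃[o]m+o≡n o<p =
    subst (m * (suc o + e) + (suc m + d) * o <_) (expand m d o e) (ℕ.m<m+n _ (s≤s z≤n))
    where
    expand : ∀ m d o e →
      (m * (suc o + e) + (suc m + d) * o) + suc d * suc e ≡ m * o + (suc m + d) * (suc o + e)
    expand = solve-∀

  -- The flag (x , a , b) is the point (x , a x + b) on the line of slope a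
  -- and intercept b.

  module Flags (q : ℕ) where

    size : ℕ
    size = q * (q * (q * q))

    -- The abscissa is the leading coordinate, so that a flag further to the left is an earlier,
    -- more significant position of a word. The step-up depends on this.
    flag : Fin q → Fin q → Fin (q * q) → Fin size
    flag x a b = combine x (combine a b)

    xOf aOf : Fin size → Fin q
    xOf i = quotient (q * (q * q)) i
    aOf i = quotient (q * q) (remainder {q} (q * (q * q)) i)

    bOf : Fin size → Fin (q * q)
    bOf i = remainder {q} (q * q) (remainder {q} (q * (q * q)) i)

    flag-coordinates : ∀ i → flag (xOf i) (aOf i) (bOf i) ≡ i
    flag-coordinates i = trans
      (cong (combine (xOf i)) (Fin.combine-remQuot {q} (q * q) (remainder {q} (q * (q * q)) i)))
      (Fin.combine-remQuot {q} (q * (q * q)) i)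

    x a b : Fin size → ℕ
    x = toℕ ∘ xOf
    a = toℕ ∘ aOf
    b = toℕ ∘ bOf

    Adjacent : Fin size → Fin size → Set
    Adjacent i j = x i < x j × a i < a j × a i * x j + b i ≡ a j * x j + b j

    adjacent? : ∀ i j → Dec (Adjacent i j)
    adjacent? i j =
      x i ℕ.<? x j ×-dec a i ℕ.<? a j ×-dec a i * x j + b i ℕ.≟ a j * x j + b j

    -- Two lines of different slopes meet in at most one point.

    triangle-free : ∀ {i j l} → Adjacent i j → Adjacent j l → ¬ Adjacent i l
    triangle-free {i} {j} {l} (_ , ai<aj , ij) (xj<xl , _ , jl) (_ , _ , il) =
      -- The lines of `i` and `j` agree both at `x j` and at `x l`; adding the two equations
      -- crosswise cancels the intercepts and contradicts `rectangle`.
      ℕ.<⇒≢ (rectangle ai<aj xj<xl) (ℕ.+-cancelʳ-≡ (b i + b j) _ _ (begin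
        (a i * x l + a j * x j) + (b i + b j)   ≡⟨ regroup (a i * x l) (a j * x j) (b i) (b j) ⟩
        (a i * x l + b i) + (a j * x j + b j)   ≡⟨ cong₂ _+_ (trans il (sym jl)) (sym ij) ⟩
        (a j * x l + b j) + (a i * x j + b i)   ≡⟨ ℕ.+-comm (a j * x l + b j) _ ⟩
        (a i * x j + b i) + (a j * x l + b j)   ≡⟨ regroup (a i * x j) (a j * x l) (b i) (b j) ⟨
        (a i * x j + a j * x l) + (b i + b j)   ∎))
      where
      open ≡-Reasoning
      regroup : ∀ m n o p → (m + n) + (o + p) ≡ (m + o) + (n + p)
      regroup = solve-∀

    Independent : Pred (Fin size) 0ℓ → Set
    Independent D = ∀ {i j} → D i → D j → ¬ Adjacent i j

    coordinates-x : ∀ s t r → xOf (flag s t r) ≡ s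
    coordinates-x s t r = cong proj₁ (Fin.remQuot-combine s (combine t r))

    coordinates-line : ∀ s t r → remainder {q} (q * (q * q)) (flag s t r) ≡ combine t r
    coordinates-line s t r = cong proj₂ (Fin.remQuot-combine s (combine t r))

    coordinates-a : ∀ s t r → aOf (flag s t r) ≡ t
    coordinates-a s t r = trans (cong (quotient (q * q)) (coordinates-line s t r))
      (cong proj₁ (Fin.remQuot-combine t r))

    coordinates-b : ∀ s t r → bOf (flag s t r) ≡ r
    coordinates-b s t r = trans (cong (remainder {q} (q * q)) (coordinates-line s t r))
      (cong proj₂ (Fin.remQuot-combine t r))

    adjacent : ∀ {s s′ t t′ r r′} → s Fin.< s′ → t Fin.< t′ →
      toℕ t * toℕ s′ + toℕ r ≡ toℕ t′ * toℕ s′ + toℕ r′ → Adjacent (flag s t r) (flag s′ t′ r′)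
    adjacent {s} {s′} {t} {t′} {r} {r′} s<s′ t<t′ meet
      rewrite coordinates-x s t r | coordinates-x s′ t′ r′ | coordinates-a s t r
            | coordinates-a s′ t′ r′ | coordinates-b s t r | coordinates-b s′ t′ r′
      = s<s′ , t<t′ , meet

    -- An independent set is determined by the first flag on every line and,
    -- for every point, the line of a flag at that point which is not the
    -- first flag on its line: there is at most one such line, because if
    -- there were two, then the first flag on one of them would be adjacent
    -- to the flag formed by the point and the other.

    lines points : ℕ
    lines  = q * (q * q)
    points = q * (q * q + q * q)

    module _ {D : Pred (Fin size) 0ℓ} (D? : Decidable D) where

      NotFirst : Fin q → Fin (q * q + q * q) → Fin q → Set
      NotFirst s y t = ∃[ r ] toℕ t * toℕ s + toℕ r ≡ toℕ y × D (flag s t r) ×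
        ∃[ s₀ ] s₀ Fin.< s × D (flag s₀ t r)

      notFirst? : ∀ s y → Decidable (NotFirst s y)
      notFirst? s y t = Fin.any? λ r → (toℕ t * toℕ s + toℕ r ℕ.≟ toℕ y) ×-dec D? (flag s t r) ×-dec
        Fin.any? λ s₀ → (s₀ Fin.<? s) ×-dec D? (flag s₀ t r)

      firstOnLine : Fin lines → Fin (suc q)
      firstOnLine l = first (λ s → D? (combine s l))

      lineAt : Fin points → Fin (suc q)
      lineAt p = first (notFirst? (quotient (q * q + q * q) p) (remainder {q} (q * q + q * q) p))

      code : Fin (suc q ^ lines * suc q ^ points)
      code = combine (funToFin firstOnLine) (funToFin lineAt)

      notFirst-unique : Independent D → ∀ {s y t t′} → NotFirst s y t → NotFirst s y t′ → t ≡ t′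
      notFirst-unique indep {s} {y} {t} {t′}
        (r , ≡y , Dsr , s₀ , s₀<s , D₀) (r′ , ≡y′ , Dsr′ , s₁ , s₁<s , D₁) with Fin.<-cmp t t′
      ... | tri≈ _ t≡t′ _ = t≡t′
      ... | tri< t<t′ _ _ = contradiction (adjacent s₀<s t<t′ (trans ≡y (sym ≡y′))) (indep D₀ Dsr′)
      ... | tri> _ _ t′<t = contradiction (adjacent s₁<s t′<t (trans ≡y′ (sym ≡y))) (indep D₁ Dsr)

      lineAt-combine : ∀ s y → lineAt (combine s y) ≡ first (notFirst? s y)
      lineAt-combine s y =
        cong (λ (s , y) → first (notFirst? s y)) (Fin.remQuot-combine s y)

      lineAt-NotFirst : Independent D → ∀ {s y t} → NotFirst s y t → lineAt (combine s y) ≡ suc t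
      lineAt-NotFirst indep {s} {y} nf = trans (lineAt-combine s y)
        (first-least (notFirst? s y) nf λ j<t nf′ →
          Fin.<-irrefl (notFirst-unique indep nf′ nf) j<t)

      NotFirst-lineAt : ∀ {s y t} → lineAt (combine s y) ≡ suc t → NotFirst s y t
      NotFirst-lineAt {s} {y} eq = first-sound (notFirst? s y) (trans (sym (lineAt-combine s y)) eq)

    funToFin-injective : ∀ {m n} (f g : Fin m → Fin n) → funToFin f ≡ funToFin g → ∀ i → f i ≡ g i
    funToFin-injective f g eq i = trans (sym (Fin.finToFun-funToFin f i))
      (trans (cong (λ c → finToFun c i) eq) (Fin.finToFun-funToFin g i))

    code⇒⊆ : ∀ {D E : Pred (Fin size) 0ℓ} (D? : Decidable D) (E? : Decidable E) → Independent D →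
      code D? ≡ code E? → ∀ {i} → D i → E i
    code⇒⊆ {D} {E} D? E? indep same {i} Di =
      subst E (flag-coordinates i) (transfer (subst D (sym (flag-coordinates i)) Di))
      where
      same-first : ∀ l → firstOnLine D? l ≡ firstOnLine E? l
      same-first = funToFin-injective _ _ (Fin.combine-injectiveˡ
        (funToFin (firstOnLine D?)) _ (funToFin (firstOnLine E?)) _ same)

      same-line : ∀ p → lineAt D? p ≡ lineAt E? p
      same-line = funToFin-injective _ _ (Fin.combine-injectiveʳ
        (funToFin (firstOnLine D?)) _ (funToFin (firstOnLine E?)) _ same)

      transfer : ∀ {s t r} → D (flag s t r) → E (flag s t r)
      -- A flag that comes first on its line is read off `firstOnLine`, any other off `lineAt`. The
      -- latter stores only a slope, but slope and point determine the intercept.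
      transfer {s} {t} {r} Dstr with Fin.any? (λ s₀ → (s₀ Fin.<? s) ×-dec D? (flag s₀ t r))
      ... | no first-flag = first-sound (λ s → E? (flag s t r)) (trans (sym (same-first (combine t r)))
        (first-least (λ s → D? (flag s t r)) Dstr λ j<s Dj → first-flag (_ , j<s , Dj)))
      ... | yes earlier = onPoint (NotFirst-lineAt E? (trans (sym (same-line (combine s y)))
        (lineAt-NotFirst D? indep (r , sym (Fin.toℕ-fromℕ< y<) , Dstr , earlier))))
        where
        y< : toℕ t * toℕ s + toℕ r < q * q + q * q
        y< = ℕ.+-mono-≤-< (ℕ.*-mono-≤ (ℕ.<⇒≤ (Fin.toℕ<n t)) (ℕ.<⇒≤ (Fin.toℕ<n s))) (Fin.toℕ<n r)
        y : Fin (q * q + q * q)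
        y = Fin.fromℕ< y<
        onPoint : NotFirst E? s y t → E (flag s t r)
        onPoint (r′ , ≡y , Estr′ , _) = subst (λ r → E (flag s t r))
          (Fin.toℕ-injective (ℕ.+-cancelˡ-≡ (toℕ t * toℕ s) _ _ (trans ≡y (Fin.toℕ-fromℕ< y<)))) Estr′

  -- The hypergraph on binary words: its cliques and independent sets.

  module Construction (q R : ℕ) (R≤ : R ≤ 2 ^ Flags.size q) where

    open Flags q

    word : Fin R → Vec Bool size
    word v = binary size (toℕ v)

    split : ∀ {u v} → u Fin.< v → ∃[ i ] Split (word u) (word v) i
    split u<v = binary-split size u<v (ℕ.<-≤-trans (Fin.toℕ<n _) R≤)

    Linked : (u v w : Fin R) → Set
    Linked u v w = ∃[ i ] ∃[ j ] Split (word u) (word w) i × Split (word u) (word v) j × Adjacent i j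

    linked? : ∀ u v w → Dec (Linked u v w)
    linked? u v w = Fin.any? λ i → Fin.any? λ j →
      split? (word u) (word w) i ×-dec split? (word u) (word v) j ×-dec adjacent? i j

    hypergraph : Hypergraph 3 R
    hypergraph = tripleHypergraph (λ u v w → ⌊ linked? u v w ⌋)

    no-clique : ∀ S → ∣ S ∣ ≡ 4 → ¬ IsClique hypergraph S
    no-clique S ∣S∣≡4 clique with fourElements S ∣S∣≡4
    ... | u , v , w , z , (u∈ , v∈ , w∈ , z∈) , (u<v , v<w , w<z)
      with toWitness {a? = linked? u v w} (clique⇒φ _ clique u∈ v∈ w∈ u<v v<w)
         | toWitness {a? = linked? u v z} (clique⇒φ _ clique u∈ v∈ z∈ u<v (Fin.<-trans v<w w<z))
         | toWitness {a? = linked? u w z} (clique⇒φ _ clique u∈ w∈ z∈ (Fin.<-trans u<v v<w) w<z)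
    ... | i , j , uw , uv , ij | i′ , j′ , uz , uv′ , ij′ | i″ , j″ , uz″ , uw″ , ij″
      with refl ← split-unique uv uv′ | refl ← split-unique uw uw″ | refl ← split-unique uz uz″ =
      triangle-free ij″ ij ij′

    module _ (S : Subset R) (independent : IsIndependent hypergraph S) where

      Splits : Fin R → Pred (Fin size) 0ℓ
      Splits u i = ∃[ v ] u Fin.< v × v ∈ S × Split (word u) (word v) i

      splits? : ∀ u → Decidable (Splits u)
      splits? u i = Fin.any? λ v → (u Fin.<? v) ×-dec (v ∈? S) ×-dec split? (word u) (word v) i

      -- Adjacent splits `i`, `j` of `u` form an edge only if their witnesses satisfy `v < w`. The
      -- abscissa being the leading coordinate, adjacency gives `i < j`; thus `w` leaves `u` at the
      -- more significant digit and is the larger one.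
      splits-independent : ∀ {u} → u ∈ S → Independent (Splits u)
      splits-independent {u} u∈ {i} {j} (w , u<w , w∈ , uw) (v , u<v , v∈ , uv) ij =
        independent⇒¬φ _ independent u∈ v∈ w∈ u<v v<w
          (fromWitness {a? = linked? u v w} (i , j , uw , uv , ij))
        where
        i<j : i Fin.< j
        i<j = subst₂ Fin._<_ (flag-coordinates i) (flag-coordinates j)
          (Fin.combine-monoˡ-< _ _ (proj₁ ij))
        v<w : v Fin.< w
        v<w with Fin.<-cmp v w
        ... | tri< v<w _ _  = v<w
        ... | tri≈ _ refl _ = contradiction i<j (Fin.<-irrefl (split-unique uw uv))
        ... | tri> _ _ w<v  = contradiction (proj₂ (split w<v)) (split-asym (split-order i<j uw uv))

      -- If `u < v` had equal codes, the position where they split would also be a split of `v`; but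
      -- `v` has `true` there, and a split of `v` needs `false`.
      independent-size : ∣ S ∣ ≤ suc q ^ lines * suc q ^ points
      independent-size = injective⇒∣p∣≤ S (λ u → code (splits? u)) λ {u} {v} u∈ v∈ u<v same →
        let i , uv = split u<v
            _ , _ , _ , vw = code⇒⊆ (splits? u) (splits? v) (splits-independent u∈) same
                               (v , u<v , v∈ , uv)
        in split-once uv vw

-- Arithmetic of formal polynomials: degrees and values.

module Polynomials where

  open import Defs
  open import Data.Fin.Base using (Fin; zero; suc)
  open import Data.Fin.Patterns
  open import Data.Integer.Base as ℤ using (ℤ)
  import Data.Integer.Properties as ℤ
  open import Data.List.Base as List using (List; []; _∷_; _++_)
  open import Data.List.Relation.Unary.All as All using (All; []; _∷_)
  import Data.List.Relation.Unary.All.Properties as All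
  open import Data.Nat.Base as ℕ using (ℕ; zero; suc)
  open import Data.Rational.Base as ℚ using (ℚ; 1ℚ; toℚᵘ)
  import Data.Rational.Properties as ℚ
  open import Data.Rational.Unnormalised.Base as ℚᵘ using (ℚᵘ; mkℚᵘ; *≡*; *≤*; *<*)
  import Data.Rational.Unnormalised.Properties as ℚᵘ
  import Data.Vec.Functional as Vector
  open import Data.Nat.Tactic.RingSolver as ℕRing using ()
  open import Data.Rational.Solver using (module +-*-Solver)

  ι : ℤ → ℚ
  ι z = z ℚ./ 1

  toℚᵘ-ι : ∀ z → toℚᵘ (ι z) ℚᵘ.≃ mkℚᵘ z 0
  toℚᵘ-ι z = ℚ.toℚᵘ-fromℚᵘ (mkℚᵘ z 0)

  abstract
    ι-+ : ∀ y z → ι (y ℤ.+ z) ≡ ι y ℚ.+ ι z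
    ι-+ y z = ℚ.toℚᵘ-injective (begin-equality
      toℚᵘ (ι (y ℤ.+ z))               ≃⟨ toℚᵘ-ι (y ℤ.+ z) ⟩
      mkℚᵘ (y ℤ.+ z) 0                 ≃⟨ *≡* (cong (ℤ._* ℤ.1ℤ)
                                          (sym (cong₂ ℤ._+_ (ℤ.*-identityʳ y) (ℤ.*-identityʳ z)))) ⟩
      mkℚᵘ y 0 ℚᵘ.+ mkℚᵘ z 0           ≃⟨ ℚᵘ.+-cong (toℚᵘ-ι y) (toℚᵘ-ι z) ⟨
      toℚᵘ (ι y) ℚᵘ.+ toℚᵘ (ι z)       ≃⟨ ℚ.toℚᵘ-homo-+ (ι y) (ι z) ⟨
      toℚᵘ (ι y ℚ.+ ι z)               ∎)
      where open ℚᵘ.≤-Reasoning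

    ι-* : ∀ y z → ι (y ℤ.* z) ≡ ι y ℚ.* ι z
    ι-* y z = ℚ.toℚᵘ-injective (begin-equality
      toℚᵘ (ι (y ℤ.* z))               ≃⟨ toℚᵘ-ι (y ℤ.* z) ⟩
      mkℚᵘ y 0 ℚᵘ.* mkℚᵘ z 0           ≃⟨ ℚᵘ.*-cong (toℚᵘ-ι y) (toℚᵘ-ι z) ⟨
      toℚᵘ (ι y) ℚᵘ.* toℚᵘ (ι z)       ≃⟨ ℚ.toℚᵘ-homo-* (ι y) (ι z) ⟨
      toℚᵘ (ι y ℚ.* ι z)               ∎)
      where open ℚᵘ.≤-Reasoning

    ι-neg : ∀ z → ι (ℤ.- z) ≡ ℚ.- ι z
    ι-neg z = ℚ.toℚᵘ-injective (begin-equality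
      toℚᵘ (ι (ℤ.- z))     ≃⟨ toℚᵘ-ι (ℤ.- z) ⟩
      ℚᵘ.- mkℚᵘ z 0        ≃⟨ ℚᵘ.-‿cong (toℚᵘ-ι z) ⟨
      ℚᵘ.- toℚᵘ (ι z)      ≃⟨ ℚ.toℚᵘ-homo‿- (ι z) ⟨
      toℚᵘ (ℚ.- ι z)       ∎)
      where open ℚᵘ.≤-Reasoning

    ι-- : ∀ y z → ι (y ℤ.- z) ≡ ι y ℚ.- ι z
    ι-- y z = trans (ι-+ y (ℤ.- z)) (cong (ι y ℚ.+_) (ι-neg z))

    ι-mono-≤ : ∀ {y z} → y ℤ.≤ z → ι y ℚ.≤ ι z
    ι-mono-≤ {y} {z} y≤z = ℚ.toℚᵘ-cancel-≤ (begin
      toℚᵘ (ι y)   ≃⟨ toℚᵘ-ι y ⟩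
      mkℚᵘ y 0     ≤⟨ *≤* (ℤ.*-monoʳ-≤-nonNeg ℤ.1ℤ y≤z) ⟩
      mkℚᵘ z 0     ≃⟨ toℚᵘ-ι z ⟨
      toℚᵘ (ι z)   ∎)
      where open ℚᵘ.≤-Reasoning

    ι-mono-< : ∀ {y z} → y ℤ.< z → ι y ℚ.< ι z
    ι-mono-< {y} {z} y<z = ℚ.toℚᵘ-cancel-< (begin-strict
      toℚᵘ (ι y)   ≃⟨ toℚᵘ-ι y ⟩
      mkℚᵘ y 0     <⟨ *<* (ℤ.*-monoʳ-<-pos ℤ.1ℤ y<z) ⟩
      mkℚᵘ z 0     ≃⟨ toℚᵘ-ι z ⟨
      toℚᵘ (ι z)   ∎)
      where open ℚᵘ.≤-Reasoning

  ∏ : ∀ {m} → (Fin m → ℝ) → ℝ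
  ∏ = Vector.foldr _*_ 1ℝ

  ∑ : ∀ {m} → (Fin m → ℕ) → ℕ
  ∑ = Vector.foldr ℕ._+_ 0

  *-interchange : ∀ p q r s → (p ℚ.* q) ℚ.* (r ℚ.* s) ≡ (p ℚ.* r) ℚ.* (q ℚ.* s)
  *-interchange = solve 4 (λ p q r s → (p :* q) :* (r :* s) := (p :* r) :* (q :* s)) refl
    where open +-*-Solver

  -- Here and below, identities of values concern the `n`-th approximations, where they are
  -- propositional equalities of rationals.
  ∏-* : ∀ {m n} (f g h : Fin m → ℝ) → (∀ i → seq (h i) n ≡ seq (f i) n ℚ.* seq (g i) n) →
    seq (∏ h) n ≡ seq (∏ f) n ℚ.* seq (∏ g) n
  ∏-* {zero}  f g h eq = refl
  ∏-* {suc m} f g h eq = trans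
    (cong₂ ℚ._*_ (eq zero) (∏-* (f ∘ suc) (g ∘ suc) (h ∘ suc) (eq ∘ suc)))
    (*-interchange (seq (f zero) _) (seq (g zero) _) _ _)

  ∏-one : ∀ {m n} (f : Fin m → ℝ) → (∀ i → seq (f i) n ≡ 1ℚ) → seq (∏ f) n ≡ 1ℚ
  ∏-one {zero}  f eq = refl
  ∏-one {suc m} f eq = cong₂ ℚ._*_ (eq zero) (∏-one (f ∘ suc) (eq ∘ suc))

  ∑-+ : ∀ {m} (f g h : Fin m → ℕ) → (∀ i → h i ≡ f i ℕ.+ g i) → ∑ h ≡ ∑ f ℕ.+ ∑ g
  ∑-+ {zero}  f g h eq = refl
  ∑-+ {suc m} f g h eq = trans
    (cong₂ ℕ._+_ (eq zero) (∑-+ (f ∘ suc) (g ∘ suc) (h ∘ suc) (eq ∘ suc)))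
    (interchange (f zero) (g zero) (∑ (f ∘ suc)) (∑ (g ∘ suc)))
    where
    interchange : ∀ o p q r → (o ℕ.+ p) ℕ.+ (q ℕ.+ r) ≡ (o ℕ.+ q) ℕ.+ (p ℕ.+ r)
    interchange = ℕRing.solve-∀

  ∑-zero : ∀ {m} (f : Fin m → ℕ) → (∀ i → f i ≡ 0) → ∑ f ≡ 0
  ∑-zero {zero}  f eq = refl
  ∑-zero {suc m} f eq = cong₂ ℕ._+_ (eq zero) (∑-zero (f ∘ suc) (eq ∘ suc))

  ^-+ : ∀ x a b n → seq (x ^ (a ℕ.+ b)) n ≡ seq (x ^ a) n ℚ.* seq (x ^ b) n
  ^-+ x zero    b n = sym (ℚ.*-identityˡ _)
  ^-+ x (suc a) b n = trans (cong (seq x n ℚ.*_) (^-+ x a b n))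
    (sym (ℚ.*-assoc (seq x n) (seq (x ^ a) n) (seq (x ^ b) n)))

  indicator : ∀ {m} → Fin m → Fin m → ℕ
  indicator zero    zero    = 1
  indicator zero    (suc _) = 0
  indicator (suc _) zero    = 0
  indicator (suc i) (suc j) = indicator i j

  ∏-indicator : ∀ {m n} (x : Fin m → ℝ) i → seq (∏ λ j → x j ^ indicator i j) n ≡ seq (x i) n
  ∏-indicator {suc m} {n} x zero = trans
    (cong₂ ℚ._*_ (ℚ.*-identityʳ (seq (x zero) n)) (∏-one {m} (λ _ → 1ℝ) (λ _ → refl)))
    (ℚ.*-identityʳ (seq (x zero) n))
  ∏-indicator x (suc i) = trans (ℚ.*-identityˡ _) (∏-indicator (x ∘ suc) i)

  ∑-indicator : ∀ {m} (i : Fin m) → ∑ (indicator i) ≡ 1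
  ∑-indicator {suc m} zero = cong suc (∑-zero {m} (λ _ → 0) (λ _ → refl))
  ∑-indicator (suc i) = ∑-indicator i

  unit : ∀ {r d} → Fin r → Fin d → Fin r → Fin d → ℕ
  unit zero    i zero    = indicator i
  unit zero    i (suc _) = λ _ → 0
  unit (suc _) i zero    = λ _ → 0
  unit (suc j) i (suc k) = unit j i k

  ∏-unit : ∀ {r d n} (p : Fin r → Point d) j i →
    seq (∏ λ k → ∏ λ l → p k l ^ unit j i k l) n ≡ seq (p j i) n
  ∏-unit {n = n} p zero i = trans
    (cong₂ ℚ._*_ (∏-indicator (p zero) i)
      (∏-one (λ k → ∏ λ l → p (suc k) l ^ 0) λ k → ∏-one (λ l → p (suc k) l ^ 0) λ _ → refl))
    (ℚ.*-identityʳ (seq (p zero i) n))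
  ∏-unit p (suc j) i = trans
    (cong₂ ℚ._*_ (∏-one (λ l → p zero l ^ 0) λ _ → refl) (∏-unit (p ∘ suc) j i))
    (ℚ.*-identityˡ _)

  ∑-unit : ∀ {r d} (j : Fin r) (i : Fin d) → ∑ (λ k → ∑ (unit j i k)) ≡ 1
  ∑-unit {suc r} {d} zero    i = cong₂ ℕ._+_ (∑-indicator i)
    (∑-zero {r} (λ _ → ∑ {d} (λ _ → 0)) λ _ → ∑-zero {d} (λ _ → 0) λ _ → refl)
  ∑-unit {suc r} {d} (suc j) i = cong₂ ℕ._+_ (∑-zero {d} (λ _ → 0) λ _ → refl) (∑-unit j i)

  module _ {r d : ℕ} where

    var : Fin r → Fin d → Polynomial r d
    var j i = record { coefficient = 1ℝ ; exponent = unit j i } ∷ []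

    negateMonomial : Monomial r d → Monomial r d
    negateMonomial μ = record μ { coefficient = - coefficient μ }

    negate : Polynomial r d → Polynomial r d
    negate = List.map negateMonomial

    _⊙_ : Monomial r d → Monomial r d → Monomial r d
    μ ⊙ ν = record
      { coefficient = coefficient μ * coefficient ν
      ; exponent    = λ j i → exponent μ j i ℕ.+ exponent ν j i
      }

    multiply : Polynomial r d → Polynomial r d → Polynomial r d
    multiply []      g = []
    multiply (μ ∷ f) g = List.map (μ ⊙_) g ++ multiply f g

    variable-degree : ∀ j i → DegreeAtMost 1 (var j i)
    variable-degree j i = ℕ.≤-reflexive (∑-unit j i) ∷ []

    negate-degree : ∀ {D} f → DegreeAtMost D f → DegreeAtMost D (negate f)
    negate-degree f f≤ = All.map⁺ f≤

    multiply-degree : ∀ {D E} f g → DegreeAtMost D f → DegreeAtMost E g →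
      DegreeAtMost (D ℕ.+ E) (multiply f g)
    multiply-degree []      g []        g≤ = []
    multiply-degree (μ ∷ f) g (μ≤ ∷ f≤) g≤ = All.++⁺
      (All.map⁺ (All.map (λ {ν} ν≤ → ℕ.≤-trans (ℕ.≤-reflexive (⊙-degree ν)) (ℕ.+-mono-≤ μ≤ ν≤)) g≤))
      (multiply-degree f g f≤ g≤)
      where
      ⊙-degree : ∀ ν → monomialDegree (μ ⊙ ν) ≡ monomialDegree μ ℕ.+ monomialDegree ν
      ⊙-degree ν = ∑-+ (∑ ∘ exponent μ) (∑ ∘ exponent ν) (∑ ∘ exponent (μ ⊙ ν)) λ j →
        ∑-+ (exponent μ j) (exponent ν j) (exponent (μ ⊙ ν) j) λ i → refl

    module _ (p : Fin r → Point d) (n : ℕ) where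

      value : Polynomial r d → ℚ
      value f = seq (eval f p) n

      eval-variable : ∀ j i → value (var j i) ≡ seq (p j i) n
      eval-variable j i = trans (ℚ.+-identityʳ _) (trans (ℚ.*-identityˡ _) (∏-unit p j i))

      eval-++ : ∀ f g → value (f ++ g) ≡ value f ℚ.+ value g
      eval-++ []      g = sym (ℚ.+-identityˡ (value g))
      eval-++ (μ ∷ f) g = trans (cong (seq (evalMonomial μ p) n ℚ.+_) (eval-++ f g))
        (sym (ℚ.+-assoc (seq (evalMonomial μ p) n) (value f) (value g)))

      eval-negate : ∀ f → value (negate f) ≡ ℚ.- value f
      eval-negate []      = refl
      eval-negate (μ ∷ f) = trans
        (cong₂ ℚ._+_ (sym (ℚ.neg-distribˡ-* (seq (coefficient μ) n) _)) (eval-negate f))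
        (sym (ℚ.neg-distrib-+ (seq (evalMonomial μ p) n) (value f)))

      eval-⊙ : ∀ μ ν →
        seq (evalMonomial (μ ⊙ ν) p) n ≡ seq (evalMonomial μ p) n ℚ.* seq (evalMonomial ν p) n
      eval-⊙ μ ν = trans
        (cong (seq (coefficient μ) n ℚ.* seq (coefficient ν) n ℚ.*_)
          (∏-* _ _ _ λ j → ∏-* _ _ _ λ i → ^-+ (p j i) (exponent μ j i) (exponent ν j i) n))
        (*-interchange (seq (coefficient μ) n) (seq (coefficient ν) n) _ _)

      eval-scale : ∀ μ g → value (List.map (μ ⊙_) g) ≡ seq (evalMonomial μ p) n ℚ.* value g
      eval-scale μ []      = sym (ℚ.*-zeroʳ (seq (evalMonomial μ p) n))
      eval-scale μ (ν ∷ g) = trans (cong₂ ℚ._+_ (eval-⊙ μ ν) (eval-scale μ g))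
        (sym (ℚ.*-distribˡ-+ (seq (evalMonomial μ p) n) (seq (evalMonomial ν p) n) (value g)))

      eval-multiply : ∀ f g → value (multiply f g) ≡ value f ℚ.* value g
      eval-multiply []      g = sym (ℚ.*-zeroˡ (value g))
      eval-multiply (μ ∷ f) g = trans (eval-++ (List.map (μ ⊙_) g) (multiply f g))
        (trans (cong₂ ℚ._+_ (eval-scale μ g) (eval-multiply f g))
          (sym (ℚ.*-distribʳ-+ (value g) (seq (evalMonomial μ p) n) (value f))))

-- Bihomogeneous expressions, whose signs at integer points survive a perturbation.

module Perturbation where

  open import Defs hiding (_+_; _*_; _-_; -_; _<_; _^_)
  open Polynomials
  open import Data.Fin.Base using (Fin; zero; suc)
  open import Data.Fin.Patterns
  open import Data.Integer.Base as ℤ using (ℤ; +_; -[1+_]; 0ℤ; ∣_∣; _+_; _*_; _-_; -_; _<_)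
  import Data.Integer.Properties as ℤ
  open import Data.Integer.Tactic.RingSolver using (solve-∀)
  open import Data.List.Base using (_++_)
  import Data.List.Relation.Unary.All as All
  import Data.List.Relation.Unary.All.Properties as All
  open import Data.Nat.Base as ℕ using (ℕ; zero; suc)
  open import Data.Nat.Tactic.RingSolver as ℕRing using ()
  open import Data.Rational.Base as ℚ using (ℚ)
  import Data.Rational.Properties as ℚ

  -- Expressions in two quadruples of variables, bihomogeneous of bidegree
  -- (g , h); hence scaling the quadruples does not change the sign.

  infixl 6 _⊕_ _⊖_
  infixl 7 _⊗_

  data Expr : ℕ → ℕ → Set where
    Γ   : Fin 4 → Expr 1 0
    Δ   : Fin 4 → Expr 0 1
    _⊕_ : ∀ {g h} → Expr g h → Expr g h → Expr g h
    _⊖_ : ∀ {g h} → Expr g h → Expr g h → Expr g h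
    _⊗_ : ∀ {g h g′ h′} → Expr g h → Expr g′ h′ → Expr (g ℕ.+ g′) (h ℕ.+ h′)

  ⟦_⟧ : ∀ {g h} → Expr g h → (Fin 4 → ℤ) → (Fin 4 → ℤ) → ℤ
  ⟦ Γ c ⟧   γ δ = γ c
  ⟦ Δ c ⟧   γ δ = δ c
  ⟦ e ⊕ f ⟧ γ δ = ⟦ e ⟧ γ δ + ⟦ f ⟧ γ δ
  ⟦ e ⊖ f ⟧ γ δ = ⟦ e ⟧ γ δ - ⟦ f ⟧ γ δ
  ⟦ e ⊗ f ⟧ γ δ = ⟦ e ⟧ γ δ * ⟦ f ⟧ γ δ

  -- The points `0F`, `1F`, `2F` stand for `u < v < w`: `Γ` becomes the displacement from `u` to
  -- `w`, which approximates the flag at their split, and `Δ` the one from `u` to `v`.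
  compile : ∀ {g h} → Expr g h → Polynomial 3 4
  compile (Γ c)   = var 2F c ++ negate (var 0F c)
  compile (Δ c)   = var 1F c ++ negate (var 0F c)
  compile (e ⊕ f) = compile e ++ compile f
  compile (e ⊖ f) = compile e ++ negate (compile f)
  compile (e ⊗ f) = multiply (compile e) (compile f)

  compile-degree : ∀ {g h} (e : Expr g h) → DegreeAtMost (g ℕ.+ h) (compile e)
  compile-degree (Γ c)   = All.++⁺ (variable-degree {3} 2F c) (negate-degree _ (variable-degree {3} 0F c))
  compile-degree (Δ c)   = All.++⁺ (variable-degree {3} 1F c) (negate-degree _ (variable-degree {3} 0F c))
  compile-degree (e ⊕ f) = All.++⁺ (compile-degree e) (compile-degree f)
  compile-degree (e ⊖ f) = All.++⁺ (compile-degree e) (negate-degree _ (compile-degree f))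
  compile-degree (_⊗_ {g} {h} {g′} {h′} e f) =
    subst (λ D → DegreeAtMost D (compile (e ⊗ f))) (interchange g h g′ h′)
      (multiply-degree (compile e) (compile f) (compile-degree e) (compile-degree f))
    where
    interchange : ∀ m n o p → (m ℕ.+ n) ℕ.+ (o ℕ.+ p) ≡ (m ℕ.+ o) ℕ.+ (n ℕ.+ p)
    interchange = ℕRing.solve-∀

  module _ (z : Fin 3 → Fin 4 → ℤ) (n : ℕ) where

    private
      p : Fin 3 → Point 4
      p j c = fromℚ (ι (z j c))

      difference : ∀ j k c →
        value p n (var j c ++ negate (var k c)) ≡ ι (z j c - z k c)
      difference j k c = begin
        value p n (var j c ++ negate (var k c))
          ≡⟨ eval-++ p n (var j c) (negate (var k c)) ⟩
        value p n (var j c) ℚ.+ value p n (negate (var k c))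
          ≡⟨ cong₂ ℚ._+_ (eval-variable p n j c)
               (trans (eval-negate p n (var k c)) (cong ℚ.-_ (eval-variable p n k c))) ⟩
        ι (z j c) ℚ.- ι (z k c)
          ≡⟨ ι-- (z j c) (z k c) ⟨
        ι (z j c - z k c) ∎
        where open ≡-Reasoning

      γ δ : Fin 4 → ℤ
      γ c = z 2F c - z 0F c
      δ c = z 1F c - z 0F c

    compile-correct : ∀ {g h} (e : Expr g h) → value p n (compile e) ≡ ι (⟦ e ⟧ γ δ)
    compile-correct (Γ c)   = difference 2F 0F c
    compile-correct (Δ c)   = difference 1F 0F c
    compile-correct (e ⊕ f) = trans (eval-++ p n (compile e) (compile f))
      (trans (cong₂ ℚ._+_ (compile-correct e) (compile-correct f)) (sym (ι-+ (⟦ e ⟧ γ δ) (⟦ f ⟧ γ δ))))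
    compile-correct (e ⊖ f) = trans (eval-++ p n (compile e) (negate (compile f)))
      (trans (cong₂ ℚ._+_ (compile-correct e)
        (trans (eval-negate p n (compile f)) (cong ℚ.-_ (compile-correct f)))) (sym (ι-- (⟦ e ⟧ γ δ) (⟦ f ⟧ γ δ))))
    compile-correct (e ⊗ f) = trans (eval-multiply p n (compile e) (compile f))
      (trans (cong₂ ℚ._*_ (compile-correct e) (compile-correct f)) (sym (ι-* (⟦ e ⟧ γ δ) (⟦ f ⟧ γ δ))))

  -- After division by the scale, `error` bounds the deviation in units of 1/K when every variable
  -- deviates by at most one unit and has an exact value of size at most `Q`. The factor
  -- `error Q f + magnitude Q f` bounds the perturbed value of `f`.
  magnitude error : ∀ {g h} → ℕ → Expr g h → ℕ
  magnitude Q (Γ c)   = Q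
  magnitude Q (Δ c)   = Q
  magnitude Q (e ⊕ f) = magnitude Q e ℕ.+ magnitude Q f
  magnitude Q (e ⊖ f) = magnitude Q e ℕ.+ magnitude Q f
  magnitude Q (e ⊗ f) = magnitude Q e ℕ.* magnitude Q f
  error Q (Γ c)   = 1
  error Q (Δ c)   = 1
  error Q (e ⊕ f) = error Q e ℕ.+ error Q f
  error Q (e ⊖ f) = error Q e ℕ.+ error Q f
  error Q (e ⊗ f) =
    error Q e ℕ.* (error Q f ℕ.+ magnitude Q f) ℕ.+ magnitude Q e ℕ.* error Q f

  -- z lies within s e / K of s a.
  Close : (K s e : ℕ) (z a : ℤ) → Set
  Close K s e z a = ∣ z - + s * a ∣ ℕ.* K ℕ.≤ s ℕ.* e

  module _ {K : ℕ} .{{_ : ℕ.NonZero K}} where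

    open ℕ.≤-Reasoning

    private
      interchange : ∀ i j k l → i ℕ.* j ℕ.* (k ℕ.* l) ≡ i ℕ.* k ℕ.* (j ℕ.* l)
      interchange = ℕRing.solve-∀

      triangle : ∀ {s e e′} i j → ∣ i ∣ ℕ.* K ℕ.≤ s ℕ.* e → ∣ j ∣ ℕ.* K ℕ.≤ s ℕ.* e′ →
        ∣ i + j ∣ ℕ.* K ℕ.≤ s ℕ.* (e ℕ.+ e′)
      triangle {s} {e} {e′} i j p q = begin
        ∣ i + j ∣ ℕ.* K                 ≤⟨ ℕ.*-monoˡ-≤ K (ℤ.∣i+j∣≤∣i∣+∣j∣ i j) ⟩
        (∣ i ∣ ℕ.+ ∣ j ∣) ℕ.* K         ≡⟨ ℕ.*-distribʳ-+ K ∣ i ∣ ∣ j ∣ ⟩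
        ∣ i ∣ ℕ.* K ℕ.+ ∣ j ∣ ℕ.* K     ≤⟨ ℕ.+-mono-≤ p q ⟩
        s ℕ.* e ℕ.+ s ℕ.* e′            ≡⟨ ℕ.*-distribˡ-+ s e e′ ⟨
        s ℕ.* (e ℕ.+ e′)                ∎

    Close-+ : ∀ {s e e′ z z′ a a′} → Close K s e z a → Close K s e′ z′ a′ →
      Close K s (e ℕ.+ e′) (z + z′) (a + a′)
    Close-+ {s} {e} {e′} {z} {z′} {a} {a′} p q =
      subst (λ i → ∣ i ∣ ℕ.* K ℕ.≤ s ℕ.* (e ℕ.+ e′)) (rearrange z z′ a a′ (+ s))
        (triangle {s} (z - + s * a) (z′ - + s * a′) p q)
      where
      rearrange : ∀ z z′ a a′ s → (z - s * a) + (z′ - s * a′) ≡ (z + z′) - s * (a + a′)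
      rearrange = solve-∀

    Close-neg : ∀ {s e z a} → Close K s e z a → Close K s e (- z) (- a)
    Close-neg {s} {e} {z} {a} p = subst (λ i → i ℕ.* K ℕ.≤ s ℕ.* e)
      (trans (sym (ℤ.∣-i∣≡∣i∣ (z - + s * a))) (cong ∣_∣ (rearrange z a (+ s)))) p
      where
      rearrange : ∀ z a s → - (z - s * a) ≡ - z - s * - a
      rearrange = solve-∀

    -- The product rule: z z′ - s s′ a a′ = (z - s a) z′ + s a (z′ - s′ a′), where |z′| is at most
    -- s′ (e′ + m′) since K is at least 1.
    Close-* : ∀ {s s′ e e′ m m′ z z′ a a′} → Close K s e z a → Close K s′ e′ z′ a′ →
      ∣ a ∣ ℕ.≤ m → ∣ a′ ∣ ℕ.≤ m′ →
      Close K (s ℕ.* s′) (e ℕ.* (e′ ℕ.+ m′) ℕ.+ m ℕ.* e′) (z * z′) (a * a′)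
    Close-* {s} {s′} {e} {e′} {m} {m′} {z} {z′} {a} {a′} p q a≤ a′≤ =
      subst (λ i → ∣ i ∣ ℕ.* K ℕ.≤ s ℕ.* s′ ℕ.* (e ℕ.* (e′ ℕ.+ m′) ℕ.+ m ℕ.* e′))
        (trans (rearrange z z′ a a′ (+ s) (+ s′))
          (cong (λ t → z * z′ - t * (a * a′)) (sym (ℤ.pos-* s s′))))
        (triangle {s ℕ.* s′} ((z - + s * a) * z′) (+ s * a * (z′ - + s′ * a′)) left right)
      where
      rearrange : ∀ z z′ a a′ s s′ →
        (z - s * a) * z′ + s * a * (z′ - s′ * a′) ≡ z * z′ - s * s′ * (a * a′)
      rearrange = solve-∀

      z′≤ : ∣ z′ ∣ ℕ.≤ s′ ℕ.* (e′ ℕ.+ m′)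
      z′≤ = begin
        ∣ z′ ∣                                        ≡⟨ cong ∣_∣ (split z′ (+ s′ * a′)) ⟩
        ∣ (z′ - + s′ * a′) + + s′ * a′ ∣              ≤⟨ ℤ.∣i+j∣≤∣i∣+∣j∣ (z′ - + s′ * a′) (+ s′ * a′) ⟩
        ∣ z′ - + s′ * a′ ∣ ℕ.+ ∣ + s′ * a′ ∣          ≤⟨ ℕ.+-mono-≤ (ℕ.m≤m*n _ K) (ℕ.≤-reflexive (ℤ.abs-* (+ s′) a′)) ⟩
        ∣ z′ - + s′ * a′ ∣ ℕ.* K ℕ.+ s′ ℕ.* ∣ a′ ∣    ≤⟨ ℕ.+-mono-≤ q (ℕ.*-monoʳ-≤ s′ a′≤) ⟩
        s′ ℕ.* e′ ℕ.+ s′ ℕ.* m′                       ≡⟨ ℕ.*-distribˡ-+ s′ e′ m′ ⟨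
        s′ ℕ.* (e′ ℕ.+ m′)                            ∎
        where
        split : ∀ i j → i ≡ (i - j) + j
        split = solve-∀

      left : ∣ (z - + s * a) * z′ ∣ ℕ.* K ℕ.≤ s ℕ.* s′ ℕ.* (e ℕ.* (e′ ℕ.+ m′))
      left = begin
        ∣ (z - + s * a) * z′ ∣ ℕ.* K                ≡⟨ cong (ℕ._* K) (ℤ.abs-* (z - + s * a) z′) ⟩
        ∣ z - + s * a ∣ ℕ.* ∣ z′ ∣ ℕ.* K            ≡⟨ swap ∣ z - + s * a ∣ ∣ z′ ∣ K ⟩
        ∣ z - + s * a ∣ ℕ.* K ℕ.* ∣ z′ ∣            ≤⟨ ℕ.*-mono-≤ p z′≤ ⟩
        s ℕ.* e ℕ.* (s′ ℕ.* (e′ ℕ.+ m′))            ≡⟨ interchange s e s′ (e′ ℕ.+ m′) ⟩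
        s ℕ.* s′ ℕ.* (e ℕ.* (e′ ℕ.+ m′))            ∎
        where
        swap : ∀ i j k → i ℕ.* j ℕ.* k ≡ i ℕ.* k ℕ.* j
        swap = ℕRing.solve-∀

      right : ∣ + s * a * (z′ - + s′ * a′) ∣ ℕ.* K ℕ.≤ s ℕ.* s′ ℕ.* (m ℕ.* e′)
      right = begin
        ∣ + s * a * (z′ - + s′ * a′) ∣ ℕ.* K              ≡⟨ cong (ℕ._* K) (ℤ.abs-* (+ s * a) (z′ - + s′ * a′)) ⟩
        ∣ + s * a ∣ ℕ.* ∣ z′ - + s′ * a′ ∣ ℕ.* K          ≡⟨ cong (λ i → i ℕ.* ∣ z′ - + s′ * a′ ∣ ℕ.* K) (ℤ.abs-* (+ s) a) ⟩
        s ℕ.* ∣ a ∣ ℕ.* ∣ z′ - + s′ * a′ ∣ ℕ.* K          ≡⟨ ℕ.*-assoc (s ℕ.* ∣ a ∣) _ K ⟩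
        s ℕ.* ∣ a ∣ ℕ.* (∣ z′ - + s′ * a′ ∣ ℕ.* K)        ≤⟨ ℕ.*-mono-≤ (ℕ.*-monoʳ-≤ s a≤) q ⟩
        s ℕ.* m ℕ.* (s′ ℕ.* e′)                           ≡⟨ interchange s m s′ e′ ⟩
        s ℕ.* s′ ℕ.* (m ℕ.* e′)                           ∎

    module _ {Q γ δ : ℕ} {G D p r : Fin 4 → ℤ}
      (p≤ : ∀ c → ∣ p c ∣ ℕ.≤ Q) (r≤ : ∀ c → ∣ r c ∣ ℕ.≤ Q)
      (G≈ : ∀ c → Close K γ 1 (G c) (p c)) (D≈ : ∀ c → Close K δ 1 (D c) (r c)) where

      magnitude-correct : ∀ {g h} (e : Expr g h) → ∣ ⟦ e ⟧ p r ∣ ℕ.≤ magnitude Q e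
      magnitude-correct (Γ c)   = p≤ c
      magnitude-correct (Δ c)   = r≤ c
      magnitude-correct (e ⊕ f) = ℕ.≤-trans (ℤ.∣i+j∣≤∣i∣+∣j∣ (⟦ e ⟧ p r) (⟦ f ⟧ p r))
        (ℕ.+-mono-≤ (magnitude-correct e) (magnitude-correct f))
      magnitude-correct (e ⊖ f) = ℕ.≤-trans (ℤ.∣i-j∣≤∣i∣+∣j∣ (⟦ e ⟧ p r) (⟦ f ⟧ p r))
        (ℕ.+-mono-≤ (magnitude-correct e) (magnitude-correct f))
      magnitude-correct (e ⊗ f) = ℕ.≤-trans (ℕ.≤-reflexive (ℤ.abs-* (⟦ e ⟧ p r) (⟦ f ⟧ p r)))
        (ℕ.*-mono-≤ (magnitude-correct e) (magnitude-correct f))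

      error-correct : ∀ {g h} (e : Expr g h) →
        Close K (γ ℕ.^ g ℕ.* δ ℕ.^ h) (error Q e) (⟦ e ⟧ G D) (⟦ e ⟧ p r)
      error-correct (Γ c) = subst (λ s → Close K s 1 (G c) (p c)) (scale γ) (G≈ c)
        where
        scale : ∀ s → s ≡ s ℕ.* 1 ℕ.* 1
        scale = ℕRing.solve-∀
      error-correct (Δ c) = subst (λ s → Close K s 1 (D c) (r c)) (scale δ) (D≈ c)
        where
        scale : ∀ s → s ≡ 1 ℕ.* (s ℕ.* 1)
        scale = ℕRing.solve-∀
      error-correct {g} {h} (e ⊕ f) = Close-+ {γ ℕ.^ g ℕ.* δ ℕ.^ h} {error Q e}
        {z = ⟦ e ⟧ G D} {a = ⟦ e ⟧ p r} (error-correct e) (error-correct f)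
      error-correct {g} {h} (e ⊖ f) = Close-+ {γ ℕ.^ g ℕ.* δ ℕ.^ h} {error Q e}
        {z = ⟦ e ⟧ G D} {a = ⟦ e ⟧ p r} (error-correct e)
        (Close-neg {γ ℕ.^ g ℕ.* δ ℕ.^ h} {z = ⟦ f ⟧ G D} {⟦ f ⟧ p r} (error-correct f))
      error-correct (_⊗_ {g} {h} {g′} {h′} e f) =
        subst (λ s → Close K s (error Q (e ⊗ f)) (⟦ e ⊗ f ⟧ G D) (⟦ e ⊗ f ⟧ p r)) scale
          (Close-* {γ ℕ.^ g ℕ.* δ ℕ.^ h} {γ ℕ.^ g′ ℕ.* δ ℕ.^ h′}
            {z = ⟦ e ⟧ G D} {⟦ f ⟧ G D} {⟦ e ⟧ p r} {⟦ f ⟧ p r}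
            (error-correct e) (error-correct f) (magnitude-correct e) (magnitude-correct f))
        where
        scale : γ ℕ.^ g ℕ.* δ ℕ.^ h ℕ.* (γ ℕ.^ g′ ℕ.* δ ℕ.^ h′) ≡ γ ℕ.^ (g ℕ.+ g′) ℕ.* δ ℕ.^ (h ℕ.+ h′)
        scale = trans (interchange (γ ℕ.^ g) _ _ _)
          (sym (cong₂ ℕ._*_ (ℕ.^-distribˡ-+-* γ g g′) (ℕ.^-distribˡ-+-* δ h h′)))

    Close⇒< : ∀ {s e z a} .{{_ : ℕ.NonZero s}} → e ℕ.< K → Close K s e z a → ∣ z - + s * a ∣ ℕ.< s
    Close⇒< {s} {e} {z} {a} e<K p = ℕ.*-cancelʳ-< _ _ _ (ℕ.≤-<-trans p (ℕ.*-monoʳ-< s e<K))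

    -- A positive integer `a` is at least 1, so s a is at least `s`, whereas the deviation s e / K
    -- is smaller than `s`.
    Close-positive : ∀ {s e z a} .{{_ : ℕ.NonZero s}} → e ℕ.< K → Close K s e z a → 0ℤ < a → 0ℤ < z
    Close-positive {s} {e} {z} {+ suc n} e<K p 0<a =
      subst (0ℤ <_) (split z (+ s * + suc n)) (positive (z - + s * + suc n) (Close⇒< {s} {e} {z} {+ suc n} e<K p))
      where
      split : ∀ i j → j + (i - j) ≡ i
      split = solve-∀
      positive : ∀ d → ∣ d ∣ ℕ.< s → 0ℤ < + s * + suc n + d
      positive d d<s rewrite sym (ℤ.pos-* s (suc n)) with d
      ... | + m      = ℤ.+<+ (ℕ.<-≤-trans (ℕ.≤-<-trans ℕ.z≤n d<s) (ℕ.≤-trans (ℕ.m≤m*n s (suc n)) (ℕ.m≤m+n _ m)))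
      ... | -[1+ m ] = subst (0ℤ <_) (sym (ℤ.⊖-≥ (ℕ.<⇒≤ m<))) (ℤ.+<+ (ℕ.m<n⇒0<n∸m m<))
        where
        m< : suc m ℕ.< s ℕ.* suc n
        m< = ℕ.<-≤-trans d<s (ℕ.m≤m*n s (suc n))
    Close-positive {a = + zero} _ _ (ℤ.+<+ ())

    Close-negative : ∀ {s e z a} .{{_ : ℕ.NonZero s}} → e ℕ.< K → Close K s e z a → a < 0ℤ → z < 0ℤ
    Close-negative {s} {e} {z} {a} e<K p a<0 = ℤ.neg-cancel-<
      (Close-positive {s} {e} {z = - z} { - a} e<K (Close-neg {s} {e} {z} {a} p) (ℤ.neg-mono-< a<0))

-- The placement of words in dimension 4, and the four polynomials that detect edges.

module Embedding where

  open import Defs hiding (_+_; _*_; _-_; -_; _<_; _^_)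
  open Subsets
  open StepUp
  open Polynomials
  open Perturbation
  open import Data.Bool.Base using (Bool; true; false; T; _∧_)
  import Data.Bool.Properties as Bool
  open import Data.Fin.Base as Fin using (Fin; zero; suc)
  import Data.Fin.Permutation as Permutation
  open import Data.Fin.Patterns
  import Data.Fin.Properties as Fin
  open import Data.Integer.Base as ℤ using (ℤ; +_; -[1+_]; 0ℤ; 1ℤ; ∣_∣; _+_; _*_; _-_; -_; _<_)
  import Data.Integer.Properties as ℤ
  open import Data.Integer.Tactic.RingSolver using (solve-∀)
  import Data.List.Relation.Unary.All as All
  open import Data.Nat.Base as ℕ using (ℕ; zero; suc)
  open import Data.Nat.Tactic.RingSolver as ℕRing using ()
  open import Data.Rational.Base as ℚ using (ℚ; 0ℚ)
  import Data.Rational.Properties as ℚ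
  open import Data.Sum.Base using (inj₁; inj₂)
  open import Data.Vec.Base as Vec using (Vec; []; _∷_)
  import Data.Vec.Properties as Vec
  open import Function.Bundles using (_⇔_; mk⇔; Equivalence)

  digit : Bool → ℕ
  digit false = 0
  digit true  = 1

  place : ∀ {k} → Fin k → ℕ
  place {suc k} zero    = k
  place {suc k} (suc i) = place i

  -- The word read in base B, with the digit 1 at position i replaced by w i.
  number : ℕ → ∀ {k} → (Fin k → ℕ) → Vec Bool k → ℕ
  number B         w []      = 0
  number B {suc k} w (x ∷ u) = digit x ℕ.* (w zero ℕ.* B ℕ.^ k) ℕ.+ number B (w ∘ suc) u

  module _ (K Q : ℕ) where

    private
      B : ℕ
      B = suc (K ℕ.* Q)

    -- A geometric sum; the base K Q + 1 is chosen so that K Q B^k + B^k is exactly the next power.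
    number-bound : ∀ {k} (w : Fin k → ℕ) → (∀ i → w i ℕ.≤ Q) → ∀ u → number B w u ℕ.* K ℕ.≤ B ℕ.^ k
    number-bound         w w≤ []      = ℕ.z≤n
    number-bound {suc k} w w≤ (x ∷ u) = begin
      (digit x ℕ.* (w zero ℕ.* P) ℕ.+ number B (w ∘ suc) u) ℕ.* K
        ≡⟨ ℕ.*-distribʳ-+ K (digit x ℕ.* (w zero ℕ.* P)) _ ⟩
      digit x ℕ.* (w zero ℕ.* P) ℕ.* K ℕ.+ number B (w ∘ suc) u ℕ.* K
        ≤⟨ ℕ.+-mono-≤ (ℕ.*-monoˡ-≤ K (ℕ.*-mono-≤ (digit≤ x) (ℕ.*-monoˡ-≤ P (w≤ zero))))
             (number-bound (w ∘ suc) (w≤ ∘ suc) u) ⟩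
      1 ℕ.* (Q ℕ.* P) ℕ.* K ℕ.+ P
        ≡⟨ rearrange Q P K ⟩
      B ℕ.* P ∎
      where
      open ℕ.≤-Reasoning
      P = B ℕ.^ k
      digit≤ : ∀ x → digit x ℕ.≤ 1
      digit≤ false = ℕ.z≤n
      digit≤ true  = ℕ.s≤s ℕ.z≤n
      rearrange : ∀ Q P K → 1 ℕ.* (Q ℕ.* P) ℕ.* K ℕ.+ P ≡ suc (K ℕ.* Q) ℕ.* P
      rearrange = ℕRing.solve-∀

    -- The digits before the split cancel, the split contributes `w i` times its power of `B`, and
    -- the two remainders are nonnegative and at most 1/K of that power; their difference is bounded
    -- by their maximum, whence the error 1.
    number-split : ∀ {k i} {u v : Vec Bool k} (w : Fin k → ℕ) → (∀ i → w i ℕ.≤ Q) → Split u v i →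
      Close K (B ℕ.^ place i) 1 (+ number B w v - + number B w u) (+ w i)
    number-split {suc k} {u = false ∷ u} {true ∷ v} w w≤ here = begin
      ∣ + (1 ℕ.* (w zero ℕ.* P) ℕ.+ n) - + m - + P * + w zero ∣ ℕ.* K
        ≡⟨ cong (λ z → ∣ z ∣ ℕ.* K) cancel ⟩
      ∣ n ℤ.⊖ m ∣ ℕ.* K       ≤⟨ ℕ.*-monoˡ-≤ K (ℤ.∣m⊝n∣≤m⊔n n m) ⟩
      (n ℕ.⊔ m) ℕ.* K         ≡⟨ ℕ.*-distribʳ-⊔ K n m ⟩
      n ℕ.* K ℕ.⊔ m ℕ.* K     ≤⟨ ℕ.⊔-lub (number-bound (w ∘ suc) (w≤ ∘ suc) v)
                                           (number-bound (w ∘ suc) (w≤ ∘ suc) u) ⟩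
      P                       ≡⟨ ℕ.*-identityʳ P ⟨
      P ℕ.* 1                 ∎
      where
      open ℕ.≤-Reasoning
      P = B ℕ.^ k
      n = number B (w ∘ suc) v
      m = number B (w ∘ suc) u
      rearrange : ∀ p y n m → (1ℤ * (y * p) + n) - m - p * y ≡ n - m
      rearrange = solve-∀
      cancel : + (1 ℕ.* (w zero ℕ.* P) ℕ.+ n) - + m - + P * + w zero ≡ n ℤ.⊖ m
      cancel = trans
        (cong (λ z → z + + n - + m - + P * + w zero)
          (trans (ℤ.pos-* 1 (w zero ℕ.* P)) (cong (1ℤ *_) (ℤ.pos-* (w zero) P))))
        (trans (rearrange (+ P) (+ w zero) (+ n) (+ m)) (ℤ.m-n≡m⊖n n m))
    number-split {suc k} {suc i} {b ∷ u} {b ∷ v} w w≤ (there s) =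
      subst (λ z → Close K (B ℕ.^ place i) 1 z (+ w (suc i)))
        (cancel (+ (digit b ℕ.* (w zero ℕ.* B ℕ.^ k))) (+ number B (w ∘ suc) v) (+ number B (w ∘ suc) u))
        (number-split (w ∘ suc) (w≤ ∘ suc) s)
      where
      cancel : ∀ h n m → n - m ≡ (h + n) - (h + m)
      cancel = solve-∀

  -- Evaluated at the coordinates (1 , x , a , b) of two flags, less 1F
  -- and less 2F are 2 (x′ - x) - 1 and 2 (a′ - a) - 1, above and below are
  -- 1 ± 2 (a x′ + b - a′ x′ - b′); these odd numbers keep their signs when
  -- the coordinates are perturbed.

  less : Fin 4 → Expr 1 1
  less c = (e ⊕ e) ⊖ (Γ 0F ⊗ Δ 0F)
    where e = (Γ 0F ⊗ Δ c) ⊖ (Γ c ⊗ Δ 0F)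

  one incidence above below : Expr 1 2
  one       = Γ 0F ⊗ Δ 0F ⊗ Δ 0F
  incidence = ((Γ 2F ⊗ Δ 0F) ⊖ (Γ 0F ⊗ Δ 2F)) ⊗ Δ 1F ⊕ ((Γ 3F ⊗ Δ 0F) ⊖ (Γ 0F ⊗ Δ 3F)) ⊗ Δ 0F
  above     = one ⊕ (incidence ⊕ incidence)
  below     = one ⊖ (incidence ⊕ incidence)

  -- Hides the bidegree, so that tests of different bidegrees form one family.
  record Test : Set where
    constructor test
    field
      {g h} : ℕ
      expr  : Expr g h

  open Test

  tests : Fin 4 → Test
  tests 0F = test (less 1F)
  tests 1F = test (less 2F)
  tests 2F = test above
  tests 3F = test below

  signOf : ℤ → Sign
  signOf (+ zero)    = nul
  signOf (+ suc _)   = pos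
  signOf (-[1+ _ ])  = neg

  hasSign : ∀ (X : ℝ) z → (∀ n → seq X n ≡ ι z) → HasSign X (signOf z)
  hasSign X (+ zero)  X≡ = λ ε 0<ε → 0 , λ n _ →
    subst (ℚ._< ε) (sym (cong (λ q → dist q 0ℚ) (X≡ n))) 0<ε
  hasSign X (+ suc m) X≡ = ι (+ suc m) , ι-mono-< {0ℤ} {+ suc m} (ℤ.+<+ (ℕ.s≤s ℕ.z≤n)) , 0 , λ n _ →
    ℚ.≤-reflexive (trans (ℚ.+-identityˡ _) (sym (X≡ n)))
  hasSign X -[1+ m ]  X≡ = ι (+ suc m) , ι-mono-< {0ℤ} {+ suc m} (ℤ.+<+ (ℕ.s≤s ℕ.z≤n)) , 0 , λ n _ →
    ℚ.≤-reflexive (trans (cong (ℚ._+ ι (+ suc m)) (X≡ n)) (ℚ.+-inverseˡ (ι (+ suc m))))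

  isPos : Sign → Bool
  isPos pos = true
  isPos _   = false

  isPos⁺ : ∀ {z} → 0ℤ < z → T (isPos (signOf z))
  isPos⁺ {+ suc _} _ = _
  isPos⁺ {+ zero} (ℤ.+<+ ())

  isPos⁻ : ∀ {z} → T (isPos (signOf z)) → 0ℤ < z
  isPos⁻ {+ suc _} _ = ℤ.+<+ (ℕ.s≤s ℕ.z≤n)

  allPos : ∀ {m} → Vec Sign m → Bool
  allPos []      = true
  allPos (s ∷ σ) = isPos s ∧ allPos σ

  allPos⇔ : ∀ {m} (z : Fin m → ℤ) → T (allPos (Vec.tabulate (signOf ∘ z))) ⇔ (∀ k → 0ℤ < z k)
  allPos⇔ {zero}  z = mk⇔ (λ _ ()) _
  allPos⇔ {suc m} z = mk⇔
    (λ t → λ { zero    → isPos⁻ {z zero} (proj₁ (Equivalence.to Bool.T-∧ t))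
             ; (suc k) → Equivalence.to (allPos⇔ (z ∘ suc))
                 (proj₂ (Equivalence.to (Bool.T-∧ {isPos (signOf (z zero))}) t)) k })
    (λ z>0 → Equivalence.from Bool.T-∧
      (isPos⁺ (z>0 zero) , Equivalence.from (allPos⇔ (z ∘ suc)) (z>0 ∘ suc)))

  odd-positive : ∀ {m} → 1ℤ ℤ.≤ m → 0ℤ < (m + m) - 1ℤ
  odd-positive {+ suc m} _ = subst (0ℤ <_) (rearrange (+ m)) (ℤ.+<+ (ℕ.s≤s ℕ.z≤n))
    where
    rearrange : ∀ m → 1ℤ + (m + m) ≡ ((1ℤ + m) + (1ℤ + m)) - 1ℤ
    rearrange = solve-∀
  odd-positive {+ zero} (ℤ.+≤+ ())

  odd-negative : ∀ {m} → m ℤ.≤ 0ℤ → (m + m) - 1ℤ < 0ℤ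
  odd-negative m≤0 = ℤ.+-mono-≤-< (ℤ.+-mono-≤ m≤0 m≤0) ℤ.-<+

  pos-*+ : ∀ m n o → + m * + n + + o ≡ + (m ℕ.* n ℕ.+ o)
  pos-*+ m n o = cong (_+ + o) (sym (ℤ.pos-* m n))

  module SemiAlgebraicity (q R : ℕ) (R≤ : R ℕ.≤ 2 ℕ.^ Flags.size q) where

    open Flags q
    open Construction q R R≤

    -- `K` exceeds the error of all four tests: `error` ignores which coordinate is taken and treats
    -- `⊕` and `⊖` alike, so `less 2F` has the error of `less 1F`, and `below` that of `above`.
    Q K B : ℕ
    Q = suc (q ℕ.+ q ℕ.* q)
    K = suc (error Q (less 1F) ℕ.+ error Q above)
    B = suc (K ℕ.* Q)

    -- The constant coordinate records the scale of a displacement; it serves to homogenise the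
    -- tests.
    coordinate : Fin 4 → Fin size → ℕ
    coordinate 0F _ = 1
    coordinate 1F   = x
    coordinate 2F   = a
    coordinate 3F   = b

    coordinate≤ : ∀ c i → coordinate c i ℕ.≤ Q
    coordinate≤ 0F i = ℕ.s≤s ℕ.z≤n
    coordinate≤ 1F i = ℕ.≤-trans (ℕ.<⇒≤ (Fin.toℕ<n (xOf i))) (ℕ.m≤n⇒m≤1+n (ℕ.m≤m+n q _))
    coordinate≤ 2F i = ℕ.≤-trans (ℕ.<⇒≤ (Fin.toℕ<n (aOf i))) (ℕ.m≤n⇒m≤1+n (ℕ.m≤m+n q _))
    coordinate≤ 3F i = ℕ.≤-trans (ℕ.<⇒≤ (Fin.toℕ<n (bOf i))) (ℕ.m≤n⇒m≤1+n (ℕ.m≤n+m _ q))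

    location : Fin R → Fin 4 → ℤ
    location v c = + number B (coordinate c) (word v)

    module _ (i j : Fin size) where

      p r : Fin 4 → ℤ
      p c = + coordinate c i
      r c = + coordinate c j

      X A I : ℤ
      X = + x j - + x i
      A = + a j - + a i
      I = (+ a i * + x j + + b i) - (+ a j * + x j + + b j)

      less-value : ∀ y z → ((1ℤ * z - y * 1ℤ) + (1ℤ * z - y * 1ℤ)) - 1ℤ * 1ℤ ≡ ((z - y) + (z - y)) - 1ℤ
      less-value = solve-∀

      above-value : ⟦ above ⟧ p r ≡ - (((- I) + (- I)) - 1ℤ)
      above-value = identity (+ a i) (+ b i) (+ x j) (+ a j) (+ b j)
        where
        identity : ∀ a b x a′ b′ →
          1ℤ * 1ℤ * 1ℤ + (((a * 1ℤ - 1ℤ * a′) * x + (b * 1ℤ - 1ℤ * b′) * 1ℤ)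
            + ((a * 1ℤ - 1ℤ * a′) * x + (b * 1ℤ - 1ℤ * b′) * 1ℤ))
          ≡ - ((- ((a * x + b) - (a′ * x + b′)) + - ((a * x + b) - (a′ * x + b′))) - 1ℤ)
        identity = solve-∀

      below-value : ⟦ below ⟧ p r ≡ - ((I + I) - 1ℤ)
      below-value = identity (+ a i) (+ b i) (+ x j) (+ a j) (+ b j)
        where
        identity : ∀ a b x a′ b′ →
          1ℤ * 1ℤ * 1ℤ - (((a * 1ℤ - 1ℤ * a′) * x + (b * 1ℤ - 1ℤ * b′) * 1ℤ)
            + ((a * 1ℤ - 1ℤ * a′) * x + (b * 1ℤ - 1ℤ * b′) * 1ℤ))
          ≡ - ((((a * x + b) - (a′ * x + b′)) + ((a * x + b) - (a′ * x + b′))) - 1ℤ)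
        identity = solve-∀

      positive⁺ : Adjacent i j → ∀ k → 0ℤ < ⟦ expr (tests k) ⟧ p r
      positive⁺ (xi<xj , ai<aj , meet) = λ where
          0F → subst (0ℤ <_) (sym (less-value (+ x i) (+ x j))) (odd-positive (1≤ xi<xj))
          1F → subst (0ℤ <_) (sym (less-value (+ a i) (+ a j))) (odd-positive (1≤ ai<aj))
          2F → subst (0ℤ <_) (sym above-value) (ℤ.neg-mono-< (odd-negative (ℤ.≤-reflexive (cong -_ I≡0))))
          3F → subst (0ℤ <_) (sym below-value) (ℤ.neg-mono-< (odd-negative (ℤ.≤-reflexive I≡0)))
        where
        1≤ : ∀ {m n} → m ℕ.< n → 1ℤ ℤ.≤ + n - + m
        1≤ {m} {n} m<n = subst (ℤ._≤ + n - + m) (cancel (+ m)) (ℤ.+-monoˡ-≤ (- + m) (ℤ.+≤+ m<n))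
          where
          cancel : ∀ m → (1ℤ + m) - m ≡ 1ℤ
          cancel = solve-∀
        I≡0 : I ≡ 0ℤ
        I≡0 = ℤ.i≡j⇒i-j≡0
          (trans (pos-*+ (a i) (x j) (b i)) (trans (cong +_ meet) (sym (pos-*+ (a j) (x j) (b j)))))

      -- A positive perturbed value excludes only a negative exact value. This suffices because the
      -- exact values are odd: each failing condition makes some test strictly negative.
      positive⁻ : (∀ k → ¬ ⟦ expr (tests k) ⟧ p r < 0ℤ) → Adjacent i j
      positive⁻ ¬neg = xi<xj , ai<aj , meet
        where
        less⁻ : ∀ {m n} → ¬ (1ℤ * + n - + m * 1ℤ + (1ℤ * + n - + m * 1ℤ)) - 1ℤ * 1ℤ < 0ℤ → m ℕ.< n
        less⁻ {m} {n} ¬<0 = ℕ.≰⇒> λ n≤m → ¬<0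
          (subst (_< 0ℤ) (sym (less-value (+ m) (+ n))) (odd-negative (ℤ.i≤j⇒i-j≤0 (ℤ.+≤+ n≤m))))
        xi<xj : x i ℕ.< x j
        xi<xj = less⁻ (¬neg 0F)
        ai<aj : a i ℕ.< a j
        ai<aj = less⁻ (¬neg 1F)
        ≤0 : ∀ {z} → ¬ - ((z + z) - 1ℤ) < 0ℤ → z ℤ.≤ 0ℤ
        ≤0 ¬<0 = ℤ.≮⇒≥ λ 0<z → ¬<0 (ℤ.neg-mono-< (odd-positive (ℤ.i<j⇒suc[i]≤j 0<z)))
        I≤0 : I ℤ.≤ 0ℤ
        I≤0 = ≤0 (¬neg 3F ∘ subst (_< 0ℤ) (sym below-value))
        0≤I : 0ℤ ℤ.≤ I
        0≤I = ℤ.neg-cancel-≤ (≤0 (¬neg 2F ∘ subst (_< 0ℤ) (sym above-value)))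
        meet : a i ℕ.* x j ℕ.+ b i ≡ a j ℕ.* x j ℕ.+ b j
        meet = ℤ.+-injective (trans (sym (pos-*+ (a i) (x j) (b i)))
          (trans (ℤ.i-j≡0⇒i≡j (+ a i * + x j + + b i) (+ a j * + x j + + b j) (ℤ.≤-antisym I≤0 0≤I))
            (pos-*+ (a j) (x j) (b j))))

    module _ {u v w : Fin R} {i j : Fin size}
      (uw : Split (word u) (word w) i) (uv : Split (word u) (word v) j) where

      z : Fin 4 → ℤ
      z k = ⟦ expr (tests k) ⟧ (λ c → location w c - location u c) (λ c → location v c - location u c)

      close : ∀ k → Close K ((B ℕ.^ place i) ℕ.^ g (tests k) ℕ.* (B ℕ.^ place j) ℕ.^ h (tests k))
        (error Q (expr (tests k))) (z k) (⟦ expr (tests k) ⟧ (p i j) (r i j))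
      close k = error-correct {Q = Q} {B ℕ.^ place i} {B ℕ.^ place j}
        (λ c → coordinate≤ c i) (λ c → coordinate≤ c j)
        (λ c → number-split K Q (coordinate c) (coordinate≤ c) uw)
        (λ c → number-split K Q (coordinate c) (coordinate≤ c) uv) (expr (tests k))

      error< : ∀ k → error Q (expr (tests k)) ℕ.< K
      error< 0F = ℕ.s≤s (ℕ.m≤m+n (error Q (less 1F)) (error Q above))
      error< 1F = ℕ.s≤s (ℕ.m≤m+n (error Q (less 1F)) (error Q above))
      error< 2F = ℕ.s≤s (ℕ.m≤n+m (error Q above) (error Q (less 1F)))
      error< 3F = ℕ.s≤s (ℕ.m≤n+m (error Q above) (error Q (less 1F)))

      scale≢0 : ∀ k → ℕ.NonZero ((B ℕ.^ place i) ℕ.^ g (tests k) ℕ.* (B ℕ.^ place j) ℕ.^ h (tests k))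
      scale≢0 k = ℕ.m*n≢0 _ _ {{ℕ.m^n≢0 _ (g (tests k)) {{ℕ.m^n≢0 B (place i)}}}}
        {{ℕ.m^n≢0 _ (h (tests k)) {{ℕ.m^n≢0 B (place j)}}}}

      adjacent⇔ : Adjacent i j ⇔ (∀ k → 0ℤ < z k)
      adjacent⇔ = mk⇔
        (λ ij k → Close-positive {K} {_} {error Q (expr (tests k))} {{scale≢0 k}} (error< k) (close k)
          (positive⁺ i j ij k))
        (λ z>0 → positive⁻ i j λ k a<0 → ℤ.<-asym (z>0 k)
          (Close-negative {K} {_} {error Q (expr (tests k))} {{scale≢0 k}} (error< k) (close k) a<0))

      linked⇔ : Linked u v w ⇔ Adjacent i j
      linked⇔ = mk⇔
        (λ (_ , _ , uw′ , uv′ , ij) → subst₂ Adjacent (split-unique uw′ uw) (split-unique uv′ uv) ij)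
        (λ ij → i , j , uw , uv , ij)

    semiAlgebraic : SemiAlgebraic ⟨ 4 , 3 , 4 ⟩ hypergraph
    semiAlgebraic = record
      { enumeration = Permutation.id
      ; point       = λ v c → fromℚ (ι (location v c))
      ; polynomial  = compile ∘ expr ∘ tests
      ; degree≤     = degree≤
      ; Φ           = allPos
      ; edge⇔Φ      = edge⇔
      }
      where
      degree≤ : ∀ k → DegreeAtMost 3 (compile (expr (tests k)))
      degree≤ 0F = All.map (λ d → ℕ.≤-trans d (ℕ.n≤1+n 2)) (compile-degree (less 1F))
      degree≤ 1F = All.map (λ d → ℕ.≤-trans d (ℕ.n≤1+n 2)) (compile-degree (less 2F))
      degree≤ 2F = compile-degree above
      degree≤ 3F = compile-degree below

      edge⇔ : ∀ (s : Fin 3 → Fin R) → Increasing s →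
        ∃[ σ ] (∀ k → HasSign (eval (compile (expr (tests k))) (λ n c → fromℚ (ι (location (s n) c))))
                  (Vec.lookup σ k))
             × (T (edge hypergraph (setOf s)) ⇔ T (allPos σ))
      edge⇔ s s-inc = Vec.tabulate (signOf ∘ z uw uv) , signs , mk⇔
        (λ e → Equivalence.from (allPos⇔ (z uw uv)) (Equivalence.to (adjacent⇔ uw uv)
          (Equivalence.to (linked⇔ uw uv) (toWitness (subst T edge≡ e)))))
        (λ t → subst T (sym edge≡) (fromWitness (Equivalence.from (linked⇔ uw uv)
          (Equivalence.from (adjacent⇔ uw uv) (Equivalence.to (allPos⇔ (z uw uv)) t)))))
        where
        uw = proj₂ (split {s 0F} {s 2F} (s-inc (ℕ.s≤s ℕ.z≤n)))
        uv = proj₂ (split {s 0F} {s 1F} (s-inc (ℕ.s≤s ℕ.z≤n)))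
        edge≡ : edge hypergraph (setOf s) ≡ ⌊ linked? (s 0F) (s 1F) (s 2F) ⌋
        edge≡ = edge-setOf _ s s-inc
        signs : ∀ k → HasSign (eval (compile (expr (tests k))) (λ n c → fromℚ (ι (location (s n) c))))
          (Vec.lookup (Vec.tabulate (signOf ∘ z uw uv)) k)
        signs k = subst (HasSign _) (sym (Vec.lookup∘tabulate (signOf ∘ z uw uv) k))
          (hasSign _ (z uw uv k) λ n → compile-correct (location ∘ s) n (expr (tests k)))

    ramsey-fails : ∀ {n} → suc q ℕ.^ lines ℕ.* suc q ℕ.^ points ℕ.< n →
      ¬ RamseyProperty 3 ⟨ 4 , 3 , 4 ⟩ 4 n R
    ramsey-fails n> ramsey with ramsey hypergraph semiAlgebraic
    ... | inj₁ (S , ∣S∣≡4 , clique)      = no-clique S ∣S∣≡4 clique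
    ... | inj₂ (S , ∣S∣≡n , independent) =
      ℕ.<⇒≱ n> (subst (ℕ._≤ _) ∣S∣≡n (independent-size S independent))

-- Order and arithmetic of rationals.

module ExponentialTerms where

  open import Defs using (1/_!)
  open Polynomials using (ι; ι-+; ι-*; ι-mono-≤; ι-mono-<; toℚᵘ-ι)
  open import Data.Integer.Base as ℤ using (ℤ)
  import Data.Integer.Properties as ℤ
  open import Data.Nat.Base as ℕ using (ℕ; zero; suc; _!)
  open import Data.Rational.Base as ℚ
    using (ℚ; 0ℚ; 1ℚ; _+_; _*_; _-_; -_; _≤_; _<_; ∣_∣; toℚᵘ)
  open import Data.Rational.Properties hiding (_≟_)
  open import Data.Rational.Solver using (module +-*-Solver)
  open import Data.Rational.Unnormalised.Base as ℚᵘ using (mkℚᵘ; *≡*; *≤*)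
  import Data.Rational.Unnormalised.Properties as ℚᵘ
  open import Data.Sum.Base using (inj₁; inj₂)
  open +-*-Solver using (solve; _:+_; _:*_; _:-_; :-_; _:=_; con)

  -- Opaque, so that n can be inferred from ν n.
  abstract
    ν : ℕ → ℚ
    ν n = ι (ℤ.+ n)

    ν≡ : ∀ n → ν n ≡ ℤ.+ n ℚ./ 1
    ν≡ n = refl

    ν-0 : ν 0 ≡ 0ℚ
    ν-0 = refl

    ν-1 : ν 1 ≡ 1ℚ
    ν-1 = refl

    ν-+ : ∀ m n → ν (m ℕ.+ n) ≡ ν m + ν n
    ν-+ m n = ι-+ (ℤ.+ m) (ℤ.+ n)

    ν-* : ∀ m n → ν (m ℕ.* n) ≡ ν m * ν n
    ν-* m n = trans (cong ι (ℤ.pos-* m n)) (ι-* (ℤ.+ m) (ℤ.+ n))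

    ν-suc : ∀ n → ν (suc n) ≡ 1ℚ + ν n
    ν-suc n = ν-+ 1 n

    ν-mono-≤ : ∀ {m n} → m ℕ.≤ n → ν m ≤ ν n
    ν-mono-≤ {m} {n} m≤n = ι-mono-≤ {ℤ.+ m} {ℤ.+ n} (ℤ.+≤+ m≤n)

    0≤ν : ∀ n → 0ℚ ≤ ν n
    0≤ν n = ν-mono-≤ {0} {n} ℕ.z≤n

    0<ν : ∀ n → 0ℚ < ν (suc n)
    0<ν n = ι-mono-< {ℤ.+ 0} {ℤ.+ suc n} (ℤ.+<+ (ℕ.s≤s ℕ.z≤n))

    *-monoˡ : ∀ {p q} r → 0ℚ ≤ r → p ≤ q → r * p ≤ r * q
    *-monoˡ r 0≤r = *-monoˡ-≤-nonNeg r {{ℚ.nonNegative 0≤r}}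

    *-monoʳ : ∀ {p q} r → 0ℚ ≤ r → p ≤ q → p * r ≤ q * r
    *-monoʳ r 0≤r = *-monoʳ-≤-nonNeg r {{ℚ.nonNegative 0≤r}}

    0≤* : ∀ {p q} → 0ℚ ≤ p → 0ℚ ≤ q → 0ℚ ≤ p * q
    0≤* {p} {q} 0≤p 0≤q = ≤-trans (≤-reflexive (sym (*-zeroʳ p))) (*-monoˡ p 0≤p 0≤q)

    0≤+ : ∀ {p q} → 0ℚ ≤ p → 0ℚ ≤ q → 0ℚ ≤ p + q
    0≤+ 0≤p 0≤q = +-mono-≤ 0≤p 0≤q

    *-mono : ∀ {p q r s} → 0ℚ ≤ p → 0ℚ ≤ s → p ≤ q → r ≤ s → p * r ≤ q * s
    *-mono {p} {q} {r} {s} 0≤p 0≤s p≤q r≤s = ≤-trans (*-monoˡ p 0≤p r≤s) (*-monoʳ s 0≤s p≤q)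

    0≤1ℚ : 0ℚ ≤ 1ℚ
    0≤1ℚ = 0≤ν 1

    p≤∣p∣ : ∀ p → p ≤ ∣ p ∣
    p≤∣p∣ p with ≤-total 0ℚ p
    ... | inj₁ 0≤p = ≤-reflexive (sym (0≤p⇒∣p∣≡p 0≤p))
    ... | inj₂ p≤0 = ≤-trans p≤0 (0≤∣p∣ p)

    -p≤∣p∣ : ∀ p → - p ≤ ∣ p ∣
    -p≤∣p∣ p = ≤-trans (p≤∣p∣ (- p)) (≤-reflexive (∣-p∣≡∣p∣ p))

    ∣p∣≤ : ∀ {p q} → p ≤ q → - p ≤ q → ∣ p ∣ ≤ q
    ∣p∣≤ {p} p≤q -p≤q with ∣p∣≡p∨∣p∣≡-p p
    ... | inj₁ eq = ≤-trans (≤-reflexive eq) p≤q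
    ... | inj₂ eq = ≤-trans (≤-reflexive eq) -p≤q

    ∣p-q∣≤⇒p≤q+ : ∀ {p q r} → ∣ p - q ∣ ≤ r → p ≤ q + r
    ∣p-q∣≤⇒p≤q+ {p} {q} {r} h = ≤-trans
      (≤-reflexive (solve 2 (λ p q → p := q :+ (p :- q)) refl p q))
      (+-monoʳ-≤ q (≤-trans (p≤∣p∣ (p - q)) h))

    ∣p-q∣-sym : ∀ p q → ∣ p - q ∣ ≡ ∣ q - p ∣
    ∣p-q∣-sym p q = trans (sym (∣-p∣≡∣p∣ (p - q)))
      (cong ∣_∣ (solve 2 (λ p q → :- (p :- q) := q :- p) refl p q))

    ∣p-q∣≤⇒q≤p+ : ∀ {p q r} → ∣ p - q ∣ ≤ r → q ≤ p + r
    ∣p-q∣≤⇒q≤p+ {p} {q} h = ∣p-q∣≤⇒p≤q+ (≤-trans (≤-reflexive (∣p-q∣-sym q p)) h)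

    p≤q+r⇒p-q≤r : ∀ {p q r} → p ≤ q + r → p - q ≤ r
    p≤q+r⇒p-q≤r {p} {q} {r} h = ≤-trans (+-monoˡ-≤ (- q) h)
      (≤-reflexive (solve 2 (λ q r → (q :+ r) :- q := r) refl q r))

    0≤q-p⇒p≤q : ∀ {p q} → 0ℚ ≤ q - p → p ≤ q
    0≤q-p⇒p≤q {p} {q} h = ≤-trans (≤-reflexive (sym (+-identityʳ p)))
      (≤-trans (+-monoʳ-≤ p h) (≤-reflexive (solve 2 (λ p q → p :+ (q :- p) := q) refl p q)))

    p≤q⇒0≤q-p : ∀ {p q} → p ≤ q → 0ℚ ≤ q - p
    p≤q⇒0≤q-p {p} {q} h = ≤-trans (≤-reflexive (sym (+-inverseʳ p))) (+-monoˡ-≤ (- p) h)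

    ∣-∣-triangle : ∀ p q r → ∣ p - r ∣ ≤ ∣ p - q ∣ + ∣ q - r ∣
    ∣-∣-triangle p q r = ≤-trans
      (≤-reflexive (cong ∣_∣ (solve 3 (λ p q r → p :- r := (p :- q) :+ (q :- r)) refl p q r)))
      (∣p+q∣≤∣p∣+∣q∣ (p - q) (q - r))

    reciprocal : ∀ d .{{_ : ℕ.NonZero d}} → (ℤ.+ 1 ℚ./ d) * ν d ≡ 1ℚ
    reciprocal d@(suc d-1) = toℚᵘ-injective (begin-equality
      toℚᵘ ((ℤ.+ 1 ℚ./ d) * ν d)               ≃⟨ toℚᵘ-homo-* (ℤ.+ 1 ℚ./ d) (ν d) ⟩
      toℚᵘ (ℤ.+ 1 ℚ./ d) ℚᵘ.* toℚᵘ (ν d)       ≃⟨ ℚᵘ.*-cong (toℚᵘ-fromℚᵘ (mkℚᵘ (ℤ.+ 1) d-1)) (toℚᵘ-ι (ℤ.+ d)) ⟩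
      mkℚᵘ (ℤ.+ 1) d-1 ℚᵘ.* mkℚᵘ (ℤ.+ d) 0       ≃⟨ *≡* (cong ℤ.+_ (identity d)) ⟩
      toℚᵘ 1ℚ                                ∎)
      where
      open ℚᵘ.≤-Reasoning
      identity : ∀ d → (1 ℕ.* d) ℕ.* 1 ≡ 1 ℕ.* (d ℕ.* 1)
      identity d = ℕ.*-assoc 1 d 1

    reciprocal-nonNeg : ∀ d .{{_ : ℕ.NonZero d}} → 0ℚ ≤ ℤ.+ 1 ℚ./ d
    reciprocal-nonNeg d = <⇒≤ (positive⁻¹ (ℤ.+ 1 ℚ./ d) {{normalize-pos 1 d}})

    ν-cancelˡ : ∀ n {p q} → ν (suc n) * p ≡ ν (suc n) * q → p ≡ q
    ν-cancelˡ n {p} {q} eq = trans (unfold p) (trans (cong (ℤ.+ 1 ℚ./ suc n *_) eq) (sym (unfold q)))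
      where
      unfold : ∀ p → p ≡ ℤ.+ 1 ℚ./ suc n * (ν (suc n) * p)
      unfold p = trans (sym (*-identityˡ p))
        (trans (cong (_* p) (sym (reciprocal (suc n)))) (*-assoc (ℤ.+ 1 ℚ./ suc n) (ν (suc n)) p))

    ν-cancelˡ-≤ : ∀ n {p q} → ν (suc n) * p ≤ ν (suc n) * q → p ≤ q
    ν-cancelˡ-≤ n = *-cancelˡ-≤-pos (ν (suc n)) {{ℚ.positive (0<ν n)}}

    p≤ν : ∀ p → ∃[ n ] p ≤ ν n
    p≤ν p = ℤ.∣ ℚ.↥ p ∣ , toℚᵘ-cancel-≤ (begin
      toℚᵘ p                    ≤⟨ *≤* (bound p) ⟩
      mkℚᵘ (ℤ.+ ℤ.∣ ℚ.↥ p ∣) 0    ≃⟨ toℚᵘ-ι (ℤ.+ ℤ.∣ ℚ.↥ p ∣) ⟨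
      toℚᵘ (ν ℤ.∣ ℚ.↥ p ∣)      ∎)
      where
      open ℚᵘ.≤-Reasoning
      bound : ∀ p → ℚᵘ.↥ (toℚᵘ p) ℤ.* ℤ.+ 1 ℤ.≤ ℤ.+ ℤ.∣ ℚ.↥ p ∣ ℤ.* ℚᵘ.↧ (toℚᵘ p)
      bound (ℚ.mkℚ (ℤ.+ n) d-1 _) = subst₂ ℤ._≤_ (ℤ.pos-* n 1) (ℤ.pos-* n (suc d-1))
        (ℤ.+≤+ (ℕ.*-monoʳ-≤ n (ℕ.s≤s ℕ.z≤n)))
      bound (ℚ.mkℚ ℤ.-[1+ n ] d-1 _) = ℤ.-≤+

    archimedean : ∀ p ε → 0ℚ < ε → ∃[ n ] p ≤ ε * ν n
    archimedean p ε 0<ε = let n , p/ε≤ = p≤ν (p * ε⁻¹) in n , (begin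
      p               ≡⟨ *-identityʳ p ⟨
      p * 1ℚ          ≡⟨ cong (p *_) (*-inverseˡ ε {{pos⇒nonZero ε {{ℚ.positive 0<ε}}}}) ⟨
      p * (ε⁻¹ * ε)   ≡⟨ *-assoc p ε⁻¹ ε ⟨
      p * ε⁻¹ * ε     ≤⟨ *-monoʳ ε (<⇒≤ 0<ε) p/ε≤ ⟩
      ν n * ε         ≡⟨ *-comm (ν n) ε ⟩
      ε * ν n         ∎)
      where
      open ≤-Reasoning
      ε⁻¹ : ℚ
      ε⁻¹ = (ℚ.1/ ε) {{pos⇒nonZero ε {{ℚ.positive 0<ε}}}}

  infixr 8 _↑_
  _↑_ : ℚ → ℕ → ℚ
  p ↑ zero  = 1ℚ
  p ↑ suc n = p * p ↑ n

  0≤↑ : ∀ {p} n → 0ℚ ≤ p → 0ℚ ≤ p ↑ n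
  0≤↑ zero    0≤p = 0≤1ℚ
  0≤↑ (suc n) 0≤p = 0≤* 0≤p (0≤↑ n 0≤p)

  ↑-mono : ∀ {p q} n → 0ℚ ≤ p → p ≤ q → p ↑ n ≤ q ↑ n
  ↑-mono zero    0≤p p≤q = ≤-refl
  ↑-mono (suc n) 0≤p p≤q = *-mono 0≤p (0≤↑ n (≤-trans 0≤p p≤q)) p≤q (↑-mono n 0≤p p≤q)

  ∣↑∣ : ∀ p n → ∣ p ↑ n ∣ ≡ ∣ p ∣ ↑ n
  ∣↑∣ p zero    = refl
  ∣↑∣ p (suc n) = trans (∣p*q∣≡∣p∣*∣q∣ p (p ↑ n)) (cong (∣ p ∣ *_) (∣↑∣ p n))

  ν-↑ : ∀ m n → ν (m ℕ.^ n) ≡ ν m ↑ n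
  ν-↑ m zero    = ν-1
  ν-↑ m (suc n) = trans (ν-* m (m ℕ.^ n)) (cong (ν m *_) (ν-↑ m n))

  -- Finite sums, Cauchy products and the terms of the exponential series.

  Seq : Set
  Seq = ℕ → ℚ

  sumTo : Seq → ℕ → ℚ
  sumTo f zero    = 0ℚ
  sumTo f (suc k) = f 0 + sumTo (f ∘ suc) k

  sumTo-snoc : ∀ f k → sumTo f (suc k) ≡ sumTo f k + f k
  sumTo-snoc f zero    = +-comm (f 0) 0ℚ
  sumTo-snoc f (suc k) = trans (cong (f 0 +_) (sumTo-snoc (f ∘ suc) k))
    (sym (+-assoc (f 0) (sumTo (f ∘ suc) k) (f (suc k))))

  ∣sumTo∣ : ∀ {f F} → (∀ i → ∣ f i ∣ ≤ F i) → ∀ k → ∣ sumTo f k ∣ ≤ sumTo F k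
  ∣sumTo∣ f≤F zero    = ≤-refl
  ∣sumTo∣ {f} f≤F (suc k) = ≤-trans (∣p+q∣≤∣p∣+∣q∣ (f 0) (sumTo (f ∘ suc) k))
    (+-mono-≤ (f≤F 0) (∣sumTo∣ (f≤F ∘ suc) k))

  ∣sumTo-sumTo∣ : ∀ {f F} → (∀ i → ∣ f i ∣ ≤ F i) → ∀ {k m} → k ℕ.≤ m →
    ∣ sumTo f m - sumTo f k ∣ ≤ sumTo F m - sumTo F k
  ∣sumTo-sumTo∣ {f} {F} f≤F {zero} {m} _ = subst₂ (λ p q → ∣ p ∣ ≤ q)
    (sym (+-identityʳ (sumTo f m))) (sym (+-identityʳ (sumTo F m))) (∣sumTo∣ f≤F m)
  ∣sumTo-sumTo∣ {f} {F} f≤F {suc k} {suc m} (ℕ.s≤s k≤m) = subst₂ (λ p q → ∣ p ∣ ≤ q)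
    (cancel (f 0) _ _) (cancel (F 0) _ _) (∣sumTo-sumTo∣ (f≤F ∘ suc) k≤m)
    where
    cancel : ∀ p q r → q - r ≡ (p + q) - (p + r)
    cancel = solve 3 (λ p q r → q :- r := (p :+ q) :- (p :+ r)) refl

  NonNeg : Seq → Set
  NonNeg F = ∀ i → 0ℚ ≤ F i

  sumTo-mono : ∀ {F} → NonNeg F → ∀ {k m} → k ℕ.≤ m → sumTo F k ≤ sumTo F m
  sumTo-mono {F} 0≤F k≤m = 0≤q-p⇒p≤q (≤-trans (0≤∣p∣ _)
    (∣sumTo-sumTo∣ {F} {F} (λ i → ≤-reflexive (0≤p⇒∣p∣≡p (0≤F i))) k≤m))

  sumTo-nonNeg : ∀ {F} → NonNeg F → ∀ k → 0ℚ ≤ sumTo F k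
  sumTo-nonNeg 0≤F k = sumTo-mono 0≤F (ℕ.z≤n {k})

  conv : Seq → Seq → Seq
  conv f g zero    = f 0 * g 0
  conv f g (suc t) = f 0 * g (suc t) + conv (f ∘ suc) g t

  -- The sum of f i * g j over i + j < k.
  triangleSum : Seq → Seq → ℕ → ℚ
  triangleSum f g zero    = 0ℚ
  triangleSum f g (suc k) = f 0 * sumTo g (suc k) + triangleSum (f ∘ suc) g k

  triangleSum-snoc : ∀ f g k → triangleSum f g (suc k) ≡ triangleSum f g k + conv f g k
  triangleSum-snoc f g zero = solve 2 (λ p q → p :* (q :+ con 0ℚ) :+ con 0ℚ := con 0ℚ :+ p :* q) refl (f 0) (g 0)
  triangleSum-snoc f g (suc k) = begin
    f 0 * sumTo g (suc (suc k)) + triangleSum (f ∘ suc) g (suc k)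
      ≡⟨ cong₂ (λ p q → f 0 * p + q) (sumTo-snoc g (suc k)) (triangleSum-snoc (f ∘ suc) g k) ⟩
    f 0 * (sumTo g (suc k) + g (suc k)) + (triangleSum (f ∘ suc) g k + conv (f ∘ suc) g k)
      ≡⟨ solve 5 (λ a b c d e → a :* (b :+ c) :+ (d :+ e) := (a :* b :+ d) :+ (a :* c :+ e)) refl
           (f 0) (sumTo g (suc k)) (g (suc k)) (triangleSum (f ∘ suc) g k) (conv (f ∘ suc) g k) ⟩
    triangleSum f g (suc k) + conv f g (suc k) ∎
    where open ≡-Reasoning

  triangleSum-conv : ∀ f g k → triangleSum f g k ≡ sumTo (conv f g) k
  triangleSum-conv f g zero    = refl
  triangleSum-conv f g (suc k) = trans (triangleSum-snoc f g k)
    (trans (cong (_+ conv f g k) (triangleSum-conv f g k)) (sym (sumTo-snoc (conv f g) k)))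

  -- The products f i * g j left over, those with i < k, j < m and i + j at least k, are dominated
  -- one by one.
  ∣rectangle-triangle∣ : ∀ {f g F G} → (∀ i → ∣ f i ∣ ≤ F i) → (∀ i → ∣ g i ∣ ≤ G i) →
    ∀ {k m} → k ℕ.≤ m →
    ∣ sumTo f k * sumTo g m - triangleSum f g k ∣ ≤ sumTo F k * sumTo G m - triangleSum F G k
  ∣rectangle-triangle∣ {f} {g} {F} {G} f≤F g≤G {zero} {m} _ = ≤-reflexive
    (trans (cong ∣_∣ (vanish (sumTo g m))) (sym (vanish (sumTo G m))))
    where
    vanish : ∀ p → 0ℚ * p - 0ℚ ≡ 0ℚ
    vanish = solve 1 (λ p → con 0ℚ :* p :- con 0ℚ := con 0ℚ) refl
  ∣rectangle-triangle∣ {f} {g} {F} {G} f≤F g≤G {suc k} {m} k<m = begin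
    ∣ (f 0 + f′) * gm - (f 0 * gk + tf) ∣
      ≡⟨ cong ∣_∣ (rearrange (f 0) f′ gm gk tf) ⟩
    ∣ f 0 * (gm - gk) + (f′ * gm - tf) ∣
      ≤⟨ ∣p+q∣≤∣p∣+∣q∣ (f 0 * (gm - gk)) (f′ * gm - tf) ⟩
    ∣ f 0 * (gm - gk) ∣ + ∣ f′ * gm - tf ∣
      ≡⟨ cong (_+ ∣ f′ * gm - tf ∣) (∣p*q∣≡∣p∣*∣q∣ (f 0) (gm - gk)) ⟩
    ∣ f 0 ∣ * ∣ gm - gk ∣ + ∣ f′ * gm - tf ∣
      ≤⟨ +-mono-≤ (*-mono (0≤∣p∣ (f 0)) (≤-trans (0≤∣p∣ (gm - gk)) tail) (f≤F 0) tail)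
           (∣rectangle-triangle∣ (f≤F ∘ suc) g≤G (ℕ.<⇒≤ k<m)) ⟩
    F 0 * (Gm - Gk) + (F′ * Gm - tF)
      ≡⟨ rearrange (F 0) F′ Gm Gk tF ⟨
    (F 0 + F′) * Gm - (F 0 * Gk + tF) ∎
    where
    open ≤-Reasoning
    f′ = sumTo (f ∘ suc) k
    F′ = sumTo (F ∘ suc) k
    gm = sumTo g m
    Gm = sumTo G m
    gk = sumTo g (suc k)
    Gk = sumTo G (suc k)
    tf = triangleSum (f ∘ suc) g k
    tF = triangleSum (F ∘ suc) G k
    rearrange : ∀ a b c d e → (a + b) * c - (a * d + e) ≡ a * (c - d) + (b * c - e)
    rearrange = solve 5 (λ a b c d e →
      (a :+ b) :* c :- (a :* d :+ e) := a :* (c :- d) :+ (b :* c :- e)) refl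
    tail : ∣ gm - gk ∣ ≤ Gm - Gk
    tail = ∣sumTo-sumTo∣ g≤G k<m

  -- From i < k and j < m follows i + j < k + m.
  rectangle≤triangle : ∀ {F G} → NonNeg F → NonNeg G → ∀ k m →
    sumTo F k * sumTo G m ≤ triangleSum F G (k ℕ.+ m)
  rectangle≤triangle {F} {G} 0≤F 0≤G zero m =
    ≤-trans (≤-reflexive (*-zeroˡ (sumTo G m))) (triangle-nonNeg 0≤F m)
    where
    triangle-nonNeg : ∀ {F} → NonNeg F → ∀ k → 0ℚ ≤ triangleSum F G k
    triangle-nonNeg 0≤F zero    = ≤-refl
    triangle-nonNeg 0≤F (suc k) =
      0≤+ (0≤* (0≤F 0) (sumTo-nonNeg 0≤G (suc k))) (triangle-nonNeg (0≤F ∘ suc) k)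
  rectangle≤triangle {F} {G} 0≤F 0≤G (suc k) m = ≤-trans
    (≤-reflexive (*-distribʳ-+ (sumTo G m) (F 0) (sumTo (F ∘ suc) k)))
    (+-mono-≤ (*-monoˡ (F 0) (0≤F 0) (sumTo-mono 0≤G (ℕ.m≤n+m m (suc k))))
      (rectangle≤triangle (0≤F ∘ suc) 0≤G k m))

  conv-cong : ∀ {f f′ g g′} → (∀ i → f i ≡ f′ i) → (∀ i → g i ≡ g′ i) → ∀ t → conv f g t ≡ conv f′ g′ t
  conv-cong f≡ g≡ zero    = cong₂ _*_ (f≡ 0) (g≡ 0)
  conv-cong f≡ g≡ (suc t) = cong₂ _+_ (cong₂ _*_ (f≡ 0) (g≡ (suc t))) (conv-cong (f≡ ∘ suc) g≡ t)

  conv-scaleˡ : ∀ c f g t → conv (λ i → c * f i) g t ≡ c * conv f g t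
  conv-scaleˡ c f g zero    = *-assoc c (f 0) (g 0)
  conv-scaleˡ c f g (suc t) = trans
    (cong₂ _+_ (*-assoc c (f 0) (g (suc t))) (conv-scaleˡ c (f ∘ suc) g t))
    (sym (*-distribˡ-+ c _ _))

  conv-scaleʳ : ∀ c f g t → conv f (λ i → c * g i) t ≡ c * conv f g t
  conv-scaleʳ c f g zero    = solve 3 (λ a b c → a :* (b :* c) := b :* (a :* c)) refl (f 0) c (g 0)
  conv-scaleʳ c f g (suc t) = trans
    (cong₂ _+_ (solve 3 (λ a b c → a :* (b :* c) := b :* (a :* c)) refl (f 0) c (g (suc t)))
      (conv-scaleʳ c (f ∘ suc) g t))
    (sym (*-distribˡ-+ c _ _))

  conv-dropʳ : ∀ f h t → h 0 ≡ 0ℚ → conv f h (suc t) ≡ conv f (h ∘ suc) t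
  conv-dropʳ f h zero    h0 = trans (cong (λ p → f 0 * h 1 + f 1 * p) h0)
    (solve 2 (λ p q → p :+ q :* con 0ℚ := p) refl (f 0 * h 1) (f 1))
  conv-dropʳ f h (suc t) h0 = cong (f 0 * h (suc (suc t)) +_) (conv-dropʳ (f ∘ suc) h t h0)

  -- A Leibniz rule: on the products with i + j = t the weight σ + t is (σ + i) + j. The shift `σ`
  -- absorbs the index lost when the recursion passes to `f ∘ suc`.
  conv-weight : ∀ σ f g t →
    (σ + ν t) * conv f g t ≡ conv (λ i → (σ + ν i) * f i) g t + conv f (λ j → ν j * g j) t
  conv-weight σ f g zero rewrite ν-0 = solve 3
    (λ s f g → (s :+ con 0ℚ) :* (f :* g) := (s :+ con 0ℚ) :* f :* g :+ f :* (con 0ℚ :* g)) refl σ (f 0) (g 0)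
  conv-weight σ f g (suc t) = begin
    (σ + ν (suc t)) * (f 0 * g (suc t) + c)
      ≡⟨ cong (λ n → (σ + n) * (f 0 * g (suc t) + c)) (ν-suc t) ⟩
    (σ + (1ℚ + ν t)) * (f 0 * g (suc t) + c)
      ≡⟨ solve 5 (λ s n f g c → (s :+ (con 1ℚ :+ n)) :* (f :* g :+ c) :=
           (s :+ con 0ℚ) :* f :* g :+ f :* ((con 1ℚ :+ n) :* g) :+ ((s :+ con 1ℚ) :+ n) :* c)
           refl σ (ν t) (f 0) (g (suc t)) c ⟩
    (σ + 0ℚ) * f 0 * g (suc t) + f 0 * ((1ℚ + ν t) * g (suc t)) + ((σ + 1ℚ) + ν t) * c
      ≡⟨ cong₂ (λ n d → (σ + 0ℚ) * f 0 * g (suc t) + f 0 * (n * g (suc t)) + d) (sym (ν-suc t))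
           (trans (conv-weight (σ + 1ℚ) (f ∘ suc) g t)
             (cong (_+ r) (conv-cong (λ i → cong (_* f (suc i)) (shift i)) (λ _ → refl) t))) ⟩
    (σ + 0ℚ) * f 0 * g (suc t) + f 0 * (ν (suc t) * g (suc t)) + (l + r)
      ≡⟨ solve 4 (λ a b c d → a :+ b :+ (c :+ d) := (a :+ c) :+ (b :+ d)) refl
           ((σ + 0ℚ) * f 0 * g (suc t)) (f 0 * (ν (suc t) * g (suc t))) l r ⟩
    ((σ + 0ℚ) * f 0 * g (suc t) + l) + (f 0 * (ν (suc t) * g (suc t)) + r)
      ≡⟨ cong (λ n → ((σ + n) * f 0 * g (suc t) + l) + (f 0 * (ν (suc t) * g (suc t)) + r)) ν-0 ⟨
    ((σ + ν 0) * f 0 * g (suc t) + l) + (f 0 * (ν (suc t) * g (suc t)) + r) ∎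
    where
    open ≡-Reasoning
    c = conv (f ∘ suc) g t
    l = conv (λ i → (σ + ν (suc i)) * f (suc i)) g t
    r = conv (f ∘ suc) (λ j → ν j * g j) t
    shift : ∀ i → (σ + 1ℚ) + ν i ≡ σ + ν (suc i)
    shift i = trans (+-assoc σ 1ℚ (ν i)) (cong (λ n → σ + n) (sym (ν-suc i)))

  term : ℚ → Seq
  term x k = 1/ k ! * x ↑ k

  1/!-suc : ∀ k → ν (suc k) * (1/ suc k !) ≡ 1/ k !
  1/!-suc k = begin
    ν (suc k) * (1/ suc k !)
      ≡⟨ *-identityʳ _ ⟨
    ν (suc k) * (1/ suc k !) * 1ℚ
      ≡⟨ cong (ν (suc k) * (1/ suc k !) *_) (reciprocal (k !) {{ℕ._!≢0 k}}) ⟨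
    ν (suc k) * (1/ suc k !) * ((1/ k !) * ν (k !))
      ≡⟨ solve 4 (λ a b c d → a :* b :* (c :* d) := b :* (a :* d) :* c) refl
           (ν (suc k)) (1/ suc k !) (1/ k !) (ν (k !)) ⟩
    (1/ suc k !) * (ν (suc k) * ν (k !)) * (1/ k !)
      ≡⟨ cong (λ n → (1/ suc k !) * n * (1/ k !)) (ν-* (suc k) (k !)) ⟨
    (1/ suc k !) * ν (suc k !) * (1/ k !)
      ≡⟨ cong (_* (1/ k !)) (reciprocal (suc k !) {{ℕ._!≢0 (suc k)}}) ⟩
    1ℚ * (1/ k !)
      ≡⟨ *-identityˡ (1/ k !) ⟩
    1/ k ! ∎
    where open ≡-Reasoning

  term-suc : ∀ x k → ν (suc k) * term x (suc k) ≡ x * term x k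
  term-suc x k = trans
    (solve 4 (λ n r x p → n :* (r :* (x :* p)) := x :* ((n :* r) :* p)) refl (ν (suc k)) (1/ suc k !) x (x ↑ k))
    (cong (λ r → x * (r * x ↑ k)) (1/!-suc k))

  -- The binomial theorem without binomial coefficients: by `conv-weight` and `term-suc` both sides
  -- satisfy (t + 1) c (t + 1) = (a + b) c t.
  conv-term : ∀ a b t → conv (term a) (term b) t ≡ term (a + b) t
  conv-term a b zero    = refl
  conv-term a b (suc t) = ν-cancelˡ t (begin
    ν (suc t) * conv (term a) (term b) (suc t)
      ≡⟨ cong (_* conv (term a) (term b) (suc t)) (sym (+-identityˡ (ν (suc t)))) ⟩
    (0ℚ + ν (suc t)) * conv (term a) (term b) (suc t)
      ≡⟨ conv-weight 0ℚ (term a) (term b) (suc t) ⟩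
    (0ℚ + ν 0) * term a 0 * term b (suc t) + conv (λ i → (0ℚ + ν (suc i)) * term a (suc i)) (term b) t
      + conv (term a) (λ j → ν j * term b j) (suc t)
      ≡⟨ cong₂ _+_
           (trans (trans (cong (λ n → (0ℚ + n) * term a 0 * term b (suc t) + l) ν-0)
               (solve 3 (λ p q r → con 0ℚ :* p :* q :+ r := r) refl (term a 0) (term b (suc t)) l))
             (trans (conv-cong
                 (λ i → trans (cong (_* term a (suc i)) (+-identityˡ (ν (suc i)))) (term-suc a i)) (λ _ → refl) t)
               (conv-scaleˡ a (term a) (term b) t)))
           (trans (conv-dropʳ (term a) (λ j → ν j * term b j) t
               (trans (cong (_* term b 0) ν-0) (*-zeroˡ (term b 0))))
             (trans (conv-cong {term a} (λ _ → refl) (term-suc b) t) (conv-scaleʳ b (term a) (term b) t))) ⟩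
    a * conv (term a) (term b) t + b * conv (term a) (term b) t
      ≡⟨ *-distribʳ-+ (conv (term a) (term b) t) a b ⟨
    (a + b) * conv (term a) (term b) t
      ≡⟨ cong ((a + b) *_) (conv-term a b t) ⟩
    (a + b) * term (a + b) t
      ≡⟨ term-suc (a + b) t ⟨
    ν (suc t) * term (a + b) (suc t) ∎)
    where
    open ≡-Reasoning
    l = conv (λ i → (0ℚ + ν (suc i)) * term a (suc i)) (term b) t

-- Tails of the exponential series.

module ExponentialSequences where

  open import Defs using (1/_!; seq; cauchy; IsExp; expPartialSum)
  import Defs
  open ExponentialTerms
  open import Data.Integer.Base as ℤ using (ℤ)
  open import Data.Nat.Base as ℕ using (ℕ; zero; suc; _!; _⊔_)
  open import Data.Rational.Base as ℚ
    using (ℚ; 0ℚ; 1ℚ; ½; _+_; _*_; _-_; -_; _≤_; _<_; ∣_∣)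
  open import Data.Rational.Properties hiding (_≟_)
  open import Data.Rational.Solver using (module +-*-Solver)
  open import Data.Sum.Base using (inj₁; inj₂)
  open +-*-Solver using (solve; _:+_; _:*_; _:-_; :-_; _:=_; con)

  halves : ∀ ε → ½ * ε + ½ * ε ≡ ε
  halves ε = trans (sym (*-distribʳ-+ ε ½ ½)) (*-identityˡ ε)

  half-positive : ∀ {ε} → 0ℚ < ε → 0ℚ < ½ * ε
  half-positive {ε} 0<ε = positive⁻¹ _ {{pos*pos⇒pos ½ ε {{ℚ.positive 0<ε}}}}

  fraction : ∀ ε N → 0ℚ < ε → ∃[ η ] 0ℚ < η × η * ν (suc N) ≡ ε
  fraction ε N 0<ε = ε * r ,
    positive⁻¹ _ {{pos*pos⇒pos ε {{ℚ.positive 0<ε}} r {{normalize-pos 1 (suc N)}}}} ,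
    trans (*-assoc ε r (ν (suc N))) (trans (cong (ε *_) (reciprocal (suc N))) (*-identityʳ ε))
    where r = ℤ.+ 1 ℚ./ suc N

  0≤square : ∀ p → 0ℚ ≤ p * p
  0≤square p with ≤-total 0ℚ p
  ... | inj₁ 0≤p = 0≤* 0≤p 0≤p
  ... | inj₂ p≤0 = ≤-trans (0≤* (neg-antimono-≤ p≤0) (neg-antimono-≤ p≤0))
    (≤-reflexive (solve 1 (λ p → (:- p) :* (:- p) := p :* p) refl p))

  0≤1/! : ∀ k → 0ℚ ≤ 1/ k !
  0≤1/! k = reciprocal-nonNeg (k !) {{ℕ._!≢0 k}}

  ∣term∣ : ∀ {x y} → ∣ x ∣ ≤ y → ∀ k → ∣ term x k ∣ ≤ term y k
  ∣term∣ {x} {y} x≤y k = begin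
    ∣ 1/ k ! * x ↑ k ∣         ≡⟨ ∣p*q∣≡∣p∣*∣q∣ (1/ k !) (x ↑ k) ⟩
    ∣ 1/ k ! ∣ * ∣ x ↑ k ∣     ≡⟨ cong₂ _*_ (0≤p⇒∣p∣≡p (0≤1/! k)) (∣↑∣ x k) ⟩
    1/ k ! * ∣ x ∣ ↑ k         ≤⟨ *-monoˡ (1/ k !) (0≤1/! k) (↑-mono k (0≤∣p∣ x) x≤y) ⟩
    1/ k ! * y ↑ k             ∎
    where open ≤-Reasoning

  term-nonNeg : ∀ {x} → 0ℚ ≤ x → NonNeg (term x)
  term-nonNeg 0≤x k = 0≤* (0≤1/! k) (0≤↑ k 0≤x)

  expSum : ℚ → ℕ → ℚ
  expSum x = sumTo (term x)

  expSum-+ : ∀ a b k → triangleSum (term a) (term b) k ≡ expSum (a + b) k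
  expSum-+ a b k = trans (triangleSum-conv (term a) (term b) k) (sumTo-cong (conv-term a b) k)
    where
    sumTo-cong : ∀ {f g : Seq} → (∀ i → f i ≡ g i) → ∀ k → sumTo f k ≡ sumTo g k
    sumTo-cong f≡g zero    = refl
    sumTo-cong f≡g (suc k) = cong₂ _+_ (f≡g 0) (sumTo-cong (f≡g ∘ suc) k)

  -- The square of side `k` contains the triangle of side `k` and lies in that of side 2 k, so the
  -- error is at most a stretch of the dominating series.
  ∣expSum-+∣ : ∀ {a b A B} → ∣ a ∣ ≤ A → ∣ b ∣ ≤ B → ∀ k →
    ∣ expSum a k * expSum b k - expSum (a + b) k ∣ ≤ expSum (A + B) (k ℕ.+ k) - expSum (A + B) k
  ∣expSum-+∣ {a} {b} {A} {B} a≤A b≤B k = begin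
    ∣ expSum a k * expSum b k - expSum (a + b) k ∣
      ≡⟨ cong (λ s → ∣ expSum a k * expSum b k - s ∣) (sym (expSum-+ a b k)) ⟩
    ∣ expSum a k * expSum b k - triangleSum (term a) (term b) k ∣
      ≤⟨ ∣rectangle-triangle∣ {G = term B} (∣term∣ a≤A) (∣term∣ b≤B) (ℕ.≤-refl {k}) ⟩
    expSum A k * expSum B k - triangleSum (term A) (term B) k
      ≤⟨ +-monoˡ-≤ (- triangleSum (term A) (term B) k)
           (rectangle≤triangle (term-nonNeg (≤-trans (0≤∣p∣ a) a≤A)) (term-nonNeg (≤-trans (0≤∣p∣ b) b≤B)) k k) ⟩
    triangleSum (term A) (term B) (k ℕ.+ k) - triangleSum (term A) (term B) k
      ≡⟨ cong₂ _-_ (expSum-+ A B (k ℕ.+ k)) (expSum-+ A B k) ⟩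
    expSum (A + B) (k ℕ.+ k) - expSum (A + B) k ∎
    where open ≤-Reasoning

  module Tail (N : ℕ) where

    B : ℚ
    B = ν (suc N)

    K₀ : ℕ
    K₀ = suc N ℕ.+ suc N

    0≤term : NonNeg (term B)
    0≤term = term-nonNeg (0≤ν (suc N))

    halving : ∀ {k} → K₀ ℕ.≤ k → term B (suc k) + term B (suc k) ≤ term B k
    halving {k} K₀≤k = ν-cancelˡ-≤ N (begin
      B * (t + t)          ≡⟨ solve 2 (λ b t → b :* (t :+ t) := (b :+ b) :* t) refl B t ⟩
      (B + B) * t          ≡⟨ cong (_* t) (ν-+ (suc N) (suc N)) ⟨
      ν K₀ * t             ≤⟨ *-monoʳ t (0≤term (suc k)) (ν-mono-≤ (ℕ.≤-trans K₀≤k (ℕ.n≤1+n k))) ⟩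
      ν (suc k) * t        ≡⟨ term-suc B k ⟩
      B * term B k         ∎)
      where
      open ≤-Reasoning
      t = term B (suc k)

    term-decreasing : ∀ {k} → K₀ ℕ.≤ k → term B (suc k) ≤ term B k
    term-decreasing {k} K₀≤k = ≤-trans (≤-trans (≤-reflexive (sym (+-identityˡ _)))
      (+-monoˡ-≤ (term B (suc k)) (0≤term (suc k)))) (halving K₀≤k)

    -- The partial sum plus twice the next term never increases: by `halving`, two new terms fit
    -- into one old one.
    bound : ∀ {k m} → K₀ ℕ.≤ k → k ℕ.≤ m →
      expSum B m + (term B m + term B m) ≤ expSum B k + (term B k + term B k)
    bound {k} {m} K₀≤k k≤m with ℕ.≤⇒≤′ k≤m
    ... | ℕ.≤′-refl = ≤-refl
    ... | ℕ.≤′-step {m} k≤′m = begin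
      expSum B (suc m) + (t′ + t′)   ≡⟨ cong (_+ (t′ + t′)) (sumTo-snoc (term B) m) ⟩
      expSum B m + t + (t′ + t′)     ≤⟨ +-monoʳ-≤ (expSum B m + t) (halving (ℕ.≤-trans K₀≤k (ℕ.≤′⇒≤ k≤′m))) ⟩
      expSum B m + t + t             ≡⟨ +-assoc (expSum B m) t t ⟩
      expSum B m + (t + t)           ≤⟨ bound K₀≤k (ℕ.≤′⇒≤ k≤′m) ⟩
      expSum B k + (term B k + term B k) ∎
      where
      open ≤-Reasoning
      t = term B m
      t′ = term B (suc m)

    expSum≤ : ∀ {k m} → K₀ ℕ.≤ k → k ℕ.≤ m → expSum B m ≤ expSum B k + (term B k + term B k)
    expSum≤ {k} {m} K₀≤k k≤m = ≤-trans
      (≤-trans (≤-reflexive (sym (+-identityʳ _))) (+-monoʳ-≤ (expSum B m) (0≤+ (0≤term m) (0≤term m))))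
      (bound K₀≤k k≤m)

    term≤ : ∀ {k} → K₀ ℕ.≤ k → term B k ≤ term B K₀
    term≤ {k} K₀≤k with ℕ.≤⇒≤′ K₀≤k
    ... | ℕ.≤′-refl = ≤-refl
    ... | ℕ.≤′-step K₀≤′k = ≤-trans (term-decreasing (ℕ.≤′⇒≤ K₀≤′k)) (term≤ (ℕ.≤′⇒≤ K₀≤′k))

    term-small : ∀ ε → 0ℚ < ε → ∃[ M ] K₀ ℕ.≤ M × (∀ k → M ℕ.≤ k → term B k ≤ ε)
    term-small ε 0<ε = suc (K₀ ⊔ M) , ℕ.m≤n⇒m≤1+n (ℕ.m≤m⊔n K₀ M) , λ { (suc k) (ℕ.s≤s M≤k) → small k M≤k }
      where
      open ≤-Reasoning
      M = proj₁ (archimedean (B * term B K₀) ε 0<ε)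
      small : ∀ k → K₀ ⊔ M ℕ.≤ k → term B (suc k) ≤ ε
      small k M≤k = ν-cancelˡ-≤ k (begin
        ν (suc k) * term B (suc k)   ≡⟨ term-suc B k ⟩
        B * term B k                 ≤⟨ *-monoˡ B (0≤ν (suc N)) (term≤ (ℕ.m⊔n≤o⇒m≤o K₀ M M≤k)) ⟩
        B * term B K₀                ≤⟨ proj₂ (archimedean (B * term B K₀) ε 0<ε) ⟩
        ε * ν M                      ≤⟨ *-monoˡ ε (<⇒≤ 0<ε) (ν-mono-≤ (ℕ.m≤n⇒m≤1+n (ℕ.m⊔n≤o⇒n≤o K₀ M M≤k))) ⟩
        ε * ν (suc k)                ≡⟨ *-comm ε (ν (suc k)) ⟩
        ν (suc k) * ε                ∎)

    tail-small : ∀ ε → 0ℚ < ε → ∃[ M ] (∀ k m → M ℕ.≤ k → k ℕ.≤ m → expSum B m - expSum B k ≤ ε)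
    tail-small ε 0<ε = let M , K₀≤M , small = term-small (½ * ε) (half-positive 0<ε) in
      M , λ k m M≤k k≤m → p≤q+r⇒p-q≤r
      (≤-trans (expSum≤ (ℕ.≤-trans K₀≤M M≤k) k≤m) (+-monoʳ-≤ (expSum B k)
        (≤-trans (+-mono-≤ (small k M≤k) (small k M≤k)) (≤-reflexive (halves ε)))))

  -- Asymptotic comparison of rational sequences, and the laws of the exponential function.

  Eventually : (ℕ → Set) → Set
  Eventually P = ∃[ M ] (∀ n → M ℕ.≤ n → P n)

  eventually₂ : ∀ {P Q R : ℕ → Set} → (∀ n → P n → Q n → R n) →
    Eventually P → Eventually Q → Eventually R
  eventually₂ f (M , p) (M′ , q) = M ⊔ M′ , λ n M≤n →
    f n (p n (ℕ.m⊔n≤o⇒m≤o M M′ M≤n)) (q n (ℕ.m⊔n≤o⇒n≤o M M′ M≤n))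

  eventually : ∀ {P Q : ℕ → Set} → (∀ n → P n → Q n) → Eventually P → Eventually Q
  eventually f (M , p) = M , λ n M≤n → f n (p n M≤n)

  from : ∀ M → Eventually (M ℕ.≤_)
  from M = M , λ _ M≤n → M≤n

  -- The bound is a positive integer, in the form that `fraction` divides by and `Tail` works with.
  Bounded : Seq → Set
  Bounded f = ∃[ N ] Eventually (λ n → ∣ f n ∣ ≤ ν (suc N))

  infix 4 _≈_ _≲_

  record _≈_ (f g : Seq) : Set where
    field within : ∀ ε → 0ℚ < ε → Eventually (λ n → ∣ f n - g n ∣ ≤ ε)

  record _≲_ (f g : Seq) : Set where
    field below : ∀ ε → 0ℚ < ε → Eventually (λ n → f n ≤ g n + ε)

  open _≈_
  open _≲_

  bounded : ∀ {f} p → Eventually (λ n → ∣ f n ∣ ≤ p) → Bounded f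
  bounded p f≤p with p≤ν p
  ... | N , p≤N = N , eventually (λ n h → ≤-trans h (≤-trans p≤N (ν-mono-≤ (ℕ.n≤1+n N)))) f≤p

  bounded-const : ∀ p → Bounded (λ _ → p)
  bounded-const p = bounded ∣ p ∣ (0 , λ _ _ → ≤-refl)

  bounded-+ : ∀ {f g} → Bounded f → Bounded g → Bounded (λ n → f n + g n)
  bounded-+ {f} {g} (M , f≤) (N , g≤) = bounded (ν (suc M) + ν (suc N)) (eventually₂
    (λ n p q → ≤-trans (∣p+q∣≤∣p∣+∣q∣ (f n) (g n)) (+-mono-≤ p q)) f≤ g≤)

  bounded-neg : ∀ {f} → Bounded f → Bounded (λ n → - f n)
  bounded-neg {f} (N , f≤) = N , eventually (λ n → ≤-trans (≤-reflexive (∣-p∣≡∣p∣ (f n)))) f≤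

  bounded-* : ∀ {f g} → Bounded f → Bounded g → Bounded (λ n → f n * g n)
  bounded-* {f} {g} (M , f≤) (N , g≤) = bounded (ν (suc M) * ν (suc N)) (eventually₂
    (λ n p q → ≤-trans (≤-reflexive (∣p*q∣≡∣p∣*∣q∣ (f n) (g n)))
      (*-mono (0≤∣p∣ (f n)) (0≤ν (suc N)) p q)) f≤ g≤)

  bounded-↑ : ∀ {f} m → Bounded f → Bounded (λ n → f n ↑ m)
  bounded-↑ zero    f≤ = bounded-const 1ℚ
  bounded-↑ (suc m) f≤ = bounded-* f≤ (bounded-↑ m f≤)

  ≡⇒≈ : ∀ {f g} → Eventually (λ n → f n ≡ g n) → f ≈ g
  ≡⇒≈ {f} {g} f≡g .within ε 0<ε = eventually (λ n eq → ≤-trans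
    (≤-reflexive (trans (cong (λ p → ∣ p - g n ∣) eq) (cong ∣_∣ (+-inverseʳ (g n))))) (<⇒≤ 0<ε)) f≡g

  ≈-sym : ∀ {f g} → f ≈ g → g ≈ f
  ≈-sym {f} {g} f≈g .within ε 0<ε =
    eventually (λ n → ≤-trans (≤-reflexive (∣p-q∣-sym (g n) (f n)))) (within f≈g ε 0<ε)

  ≈-trans : ∀ {f g h} → f ≈ g → g ≈ h → f ≈ h
  ≈-trans {f} {g} {h} f≈g g≈h .within ε 0<ε = eventually₂
    (λ n p q → ≤-trans (∣-∣-triangle (f n) (g n) (h n)) (≤-trans (+-mono-≤ p q) (≤-reflexive (halves ε))))
    (within f≈g _ (half-positive 0<ε)) (within g≈h _ (half-positive 0<ε))

  ≈-* : ∀ {f f′ g g′} → Bounded f′ → Bounded g → f ≈ f′ → g ≈ g′ →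
    (λ n → f n * g n) ≈ (λ n → f′ n * g′ n)
  ≈-* {f} {f′} {g} {g′} (M , f′≤) (N , g≤) f≈ g≈ .within ε 0<ε
    = let η , 0<η , η*≡ε = fraction ε (N ℕ.+ suc M) 0<ε in
    eventually₂ (λ n (p , q) (r , s) → close n η η*≡ε p q r s)
    (eventually₂ (λ n → _,_) f′≤ g≤) (eventually₂ (λ n → _,_) (within f≈ η 0<η) (within g≈ η 0<η))
    where
    open ≤-Reasoning
    close : ∀ n η → η * ν (suc (N ℕ.+ suc M)) ≡ ε → ∣ f′ n ∣ ≤ ν (suc M) → ∣ g n ∣ ≤ ν (suc N) →
      ∣ f n - f′ n ∣ ≤ η → ∣ g n - g′ n ∣ ≤ η →
      ∣ f n * g n - f′ n * g′ n ∣ ≤ ε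
    close n η η*≡ε f′≤ g≤ f≈ g≈ = begin
      ∣ f n * g n - f′ n * g′ n ∣
        ≡⟨ cong ∣_∣ (solve 4 (λ f f′ g g′ → f :* g :- f′ :* g′ := (f :- f′) :* g :+ (g :- g′) :* f′)
             refl (f n) (f′ n) (g n) (g′ n)) ⟩
      ∣ (f n - f′ n) * g n + (g n - g′ n) * f′ n ∣
        ≤⟨ ∣p+q∣≤∣p∣+∣q∣ ((f n - f′ n) * g n) ((g n - g′ n) * f′ n) ⟩
      ∣ (f n - f′ n) * g n ∣ + ∣ (g n - g′ n) * f′ n ∣
        ≡⟨ cong₂ _+_ (∣p*q∣≡∣p∣*∣q∣ (f n - f′ n) (g n)) (∣p*q∣≡∣p∣*∣q∣ (g n - g′ n) (f′ n)) ⟩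
      ∣ f n - f′ n ∣ * ∣ g n ∣ + ∣ g n - g′ n ∣ * ∣ f′ n ∣
        ≤⟨ +-mono-≤ (*-mono (0≤∣p∣ (f n - f′ n)) (0≤ν (suc N)) f≈ g≤)
                    (*-mono (0≤∣p∣ (g n - g′ n)) (0≤ν (suc M)) g≈ f′≤) ⟩
      η * ν (suc N) + η * ν (suc M)
        ≡⟨ *-distribˡ-+ η (ν (suc N)) (ν (suc M)) ⟨
      η * (ν (suc N) + ν (suc M))
        ≡⟨ cong (η *_) (ν-+ (suc N) (suc M)) ⟨
      η * ν (suc (N ℕ.+ suc M))
        ≡⟨ η*≡ε ⟩
      ε ∎

  ≈-↑ : ∀ {f g} m → Bounded f → Bounded g → f ≈ g → (λ n → f n ↑ m) ≈ (λ n → g n ↑ m)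
  ≈-↑ zero    f≤ g≤ f≈g = ≡⇒≈ (0 , λ _ _ → refl)
  ≈-↑ (suc m) f≤ g≤ f≈g = ≈-* g≤ (bounded-↑ m f≤) f≈g (≈-↑ m f≤ g≤ f≈g)

  ≈⇒≲ : ∀ {f g} → f ≈ g → f ≲ g
  ≈⇒≲ f≈g .below ε 0<ε = eventually (λ n → ∣p-q∣≤⇒p≤q+) (within f≈g ε 0<ε)

  ≤⇒≲ : ∀ {f g} → Eventually (λ n → f n ≤ g n) → f ≲ g
  ≤⇒≲ {f} {g} f≤g .below ε 0<ε = eventually (λ n f≤g → ≤-trans f≤g
    (≤-trans (≤-reflexive (sym (+-identityʳ (g n)))) (+-monoʳ-≤ (g n) (<⇒≤ 0<ε)))) f≤g

  ≲-trans : ∀ {f g h} → f ≲ g → g ≲ h → f ≲ h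
  ≲-trans {f} {g} {h} f≲g g≲h .below ε 0<ε = eventually₂
    (λ n p q → ≤-trans p (≤-trans (+-monoˡ-≤ (½ * ε) q)
      (≤-reflexive (trans (+-assoc (h n) (½ * ε) (½ * ε)) (cong (h n +_) (halves ε))))))
    (below f≲g _ (half-positive 0<ε)) (below g≲h _ (half-positive 0<ε))

  -- The diagonal: the number of terms grows along with the accuracy of the argument.
  exp : Seq → Seq
  exp x n = expSum (x n) n

  exp-+ : ∀ {a b} → Bounded a → Bounded b → (λ n → exp a n * exp b n) ≈ exp (λ n → a n + b n)
  exp-+ {a} {b} (M , a≤) (N , b≤) .within ε 0<ε =
    let K , small = Tail.tail-small (M ℕ.+ suc N) ε 0<ε in eventually₂
      (λ n (p , q) K≤n → ≤-trans (∣expSum-+∣ p q n)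
      (subst (λ c → expSum c (n ℕ.+ n) - expSum c n ≤ ε) (ν-+ (suc M) (suc N))
        (small n (n ℕ.+ n) K≤n (ℕ.m≤m+n n n))))
    (eventually₂ (λ n → _,_) a≤ b≤) (from K)

  exp-bounded : ∀ {a} → Bounded a → Bounded (exp a)
  exp-bounded (N , a≤) = bounded (expSum B K₀ + (term B K₀ + term B K₀)) (eventually₂
      (λ n p K₀≤n → ≤-trans (∣sumTo∣ (∣term∣ p) n) (expSum≤ ℕ.≤-refl K₀≤n))
    a≤ (from K₀))
    where open Tail N

  1≤expSum : ∀ {x} k → 0ℚ ≤ x → 1ℚ ≤ expSum x (suc k)
  1≤expSum {x} k 0≤x = +-monoʳ-≤ 1ℚ (sumTo-nonNeg (term-nonNeg 0≤x ∘ suc) k)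

  expSum-0 : ∀ k → expSum 0ℚ (suc k) ≡ 1ℚ
  expSum-0 k = cong (1ℚ +_) (sumTo-zero
    (λ i → trans (cong ((1/ suc i !) *_) (*-zeroˡ (0ℚ ↑ i))) (*-zeroʳ (1/ suc i !))) k)
    where
    sumTo-zero : ∀ {f : Seq} → (∀ i → f i ≡ 0ℚ) → ∀ k → sumTo f k ≡ 0ℚ
    sumTo-zero f≡0 zero    = refl
    sumTo-zero f≡0 (suc k) = cong₂ _+_ (f≡0 0) (sumTo-zero (f≡0 ∘ suc) k)

  exp-↑ : ∀ {a} m → Bounded a → (λ n → exp a n ↑ m) ≈ exp (λ n → ν m * a n)
  exp-↑ {a} zero a≤ = ≡⇒≈ (1 , λ { (suc n) _ → sym (trans
    (cong (λ p → expSum p (suc n)) (trans (cong (_* a (suc n)) ν-0) (*-zeroˡ (a (suc n))))) (expSum-0 n)) })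
  exp-↑ {a} (suc m) a≤ =
    ≈-trans (≈-* (exp-bounded a≤) (bounded-↑ m (exp-bounded a≤)) (≡⇒≈ {exp a} (0 , λ _ _ → refl)) (exp-↑ m a≤))
    (≈-trans (exp-+ a≤ (bounded-* (bounded-const (ν m)) a≤))
      (≡⇒≈ (0 , λ n _ → cong (λ p → expSum p n) (sym (distribute n)))))
    where
    distribute : ∀ n → ν (suc m) * a n ≡ a n + ν m * a n
    distribute n = trans (cong (_* a n) (ν-suc m))
      (trans (*-distribʳ-+ (a n) 1ℚ (ν m)) (cong (_+ ν m * a n) (*-identityˡ (a n))))

  -- Up to a vanishing error, `exp a` is the square of the exponential of half of `a`.
  exp-nonNeg : ∀ {a} → Bounded a → (λ _ → 0ℚ) ≲ exp a
  exp-nonNeg {a} a≤ = ≲-trans {g = λ n → exp h n * exp h n} (≤⇒≲ (0 , λ n _ → 0≤square (exp h n)))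
    (≈⇒≲ (≈-trans (exp-+ h≤ h≤) (≡⇒≈ (0 , λ n _ → cong (λ p → expSum p n) (halves (a n))))))
    where
    h : Seq
    h n = ½ * a n
    h≤ : Bounded h
    h≤ = bounded-* (bounded-const ½) a≤

  -- Amounts to (p + η)(q - 1) + η being nonnegative. The slack `η` is there because the partial
  -- sums in the role of `p` are nonnegative only in the limit.
  grow : ∀ p η q → 0ℚ ≤ η → 0ℚ ≤ p + η → 1ℚ ≤ q → p ≤ p * q + η * q
  grow p η q 0≤η 0≤p+η 1≤q = 0≤q-p⇒p≤q (≤-trans
    (0≤+ (0≤* 0≤p+η (p≤q⇒0≤q-p 1≤q)) 0≤η)
    (≤-reflexive (solve 3 (λ p η q →
      (p :+ η) :* (q :- con 1ℚ) :+ η := (p :* q :+ η :* q) :- p) refl p η q)))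

  -- By the addition law the right side is `exp a` times the exponential of b - a, whose partial
  -- sums are at least 1.
  exp-mono : ∀ {a b} → Bounded a → Bounded b → Eventually (λ n → a n ≤ b n) → exp a ≲ exp b
  exp-mono {a} {b} a≤ b≤ a≤b = ≲-trans increase (≈⇒≲ (≈-trans (exp-+ a≤ d≤)
      (≡⇒≈ (0 , λ n _ → cong (λ p → expSum p n)
        (solve 2 (λ a b → a :+ (b :- a) := b) refl (a n) (b n))))))
    where
    d : Seq
    d n = b n - a n
    d≤ : Bounded d
    d≤ = bounded-+ b≤ (bounded-neg a≤)
    increase : exp a ≲ (λ n → exp a n * exp d n)
    increase .below ε 0<ε =
      let N , D≤ = exp-bounded d≤
          η , 0<η , η*≡ε = fraction ε N 0<ε
      in eventually₂ (λ n (p , q) (r , s) → step N η 0<η η*≡ε n p q r s)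
      (eventually₂ (λ n → _,_) (below (exp-nonNeg a≤) η 0<η) D≤) (eventually₂ (λ n → _,_) a≤b (from 1))
      where
      step : ∀ N η → 0ℚ < η → η * ν (suc N) ≡ ε → ∀ n →
        0ℚ ≤ exp a n + η → ∣ exp d n ∣ ≤ ν (suc N) → a n ≤ b n → 1 ℕ.≤ n →
        exp a n ≤ exp a n * exp d n + ε
      step N η 0<η η*≡ε n@(suc k) 0≤a+η D≤ an≤bn _ = ≤-trans
        (grow (exp a n) η (exp d n) (<⇒≤ 0<η) 0≤a+η (1≤expSum k (p≤q⇒0≤q-p an≤bn)))
        (+-monoʳ-≤ (exp a n * exp d n) (≤-trans
          (*-monoˡ η (<⇒≤ 0<η) (≤-trans (p≤∣p∣ (exp d n)) D≤)) (≤-reflexive η*≡ε)))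

  seq-bounded : ∀ x → Bounded (seq x)
  seq-bounded x with cauchy x 1ℚ (positive⁻¹ 1ℚ)
  ... | M , close = bounded (∣ seq x M ∣ + 1ℚ) (M , λ n M≤n → ≤-trans
    (≤-reflexive (cong ∣_∣ (solve 2 (λ p q → p := q :+ (p :- q)) refl (seq x n) (seq x M))))
    (≤-trans (∣p+q∣≤∣p∣+∣q∣ (seq x M) (seq x n - seq x M))
      (+-monoʳ-≤ ∣ seq x M ∣ (<⇒≤ (close n M M≤n ℕ.≤-refl)))))

  expPartialSum≡ : ∀ x k n → seq (expPartialSum x k) n ≡ expSum (seq x n) k
  expPartialSum≡ x zero    n = refl
  expPartialSum≡ x (suc k) n = trans
    (cong₂ (λ p q → p + 1/ k ! * q) (expPartialSum≡ x k n) (seq-^ k))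
    (sym (sumTo-snoc (term (seq x n)) k))
    where
    seq-^ : ∀ k → seq (x Defs.^ k) n ≡ seq x n ↑ k
    seq-^ zero    = refl
    seq-^ (suc k) = cong (seq x n *_) (seq-^ k)

  -- The partial sums converge uniformly on bounded sets, so the limits over
  -- the number of terms and over the index of the Cauchy sequence may be
  -- taken simultaneously.
  isExp⇒≈ : ∀ {x y} → IsExp x y → exp (seq x) ≈ seq y
  isExp⇒≈ {x} {y} isExp .within ε 0<ε =
    let N , M₁ , x≤ = seq-bounded x
        M₂ , small = Tail.tail-small N (½ * ε) (half-positive 0<ε)
        M₃ , near = isExp (½ * ε) (half-positive 0<ε)
        k = M₂ ⊔ M₃
        (η , 0<η , M₄ , lower) , (η′ , 0<η′ , M₅ , upper) = near k (ℕ.m≤n⊔m M₂ M₃)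
    in eventually₂
      (λ n (p , q) (r , s) → close N k n p q (λ k≤n → small k n (ℕ.m≤m⊔n M₂ M₃) k≤n) η η′ 0<η 0<η′ r s)
      (eventually₂ (λ n → _,_) (M₁ , x≤) (from k)) (eventually₂ (λ n → _,_) (M₄ , lower) (M₅ , upper))
    where
    close : ∀ N k n → ∣ seq x n ∣ ≤ ν (suc N) → k ℕ.≤ n →
      (k ℕ.≤ n → expSum (ν (suc N)) n - expSum (ν (suc N)) k ≤ ½ * ε) →
      ∀ η η′ → 0ℚ < η → 0ℚ < η′ →
      (seq y n + - (½ * ε)) + η ≤ seq (expPartialSum x k) n →
      seq (expPartialSum x k) n + η′ ≤ seq y n + ½ * ε →
      ∣ exp (seq x) n - seq y n ∣ ≤ ε
    close N k n x≤ k≤n small η η′ 0<η 0<η′ lower upper =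
      ≤-trans (∣-∣-triangle (exp (seq x) n) (expSum (seq x n) k) (seq y n))
      (≤-trans (+-mono-≤
        (≤-trans (∣sumTo-sumTo∣ (∣term∣ x≤) k≤n) (small k≤n))
        (subst (λ s → ∣ s - seq y n ∣ ≤ ½ * ε) (expPartialSum≡ x k n) (∣p∣≤ upper′ lower′)))
        (≤-reflexive (halves ε)))
      where
      S = seq (expPartialSum x k) n
      drop : ∀ {p q r} → 0ℚ < r → p + r ≤ q → p ≤ q
      drop {p} 0<r h = ≤-trans (≤-trans (≤-reflexive (sym (+-identityʳ p))) (+-monoʳ-≤ p (<⇒≤ 0<r))) h
      negate : ∀ s y e → y + - e ≤ s → - (s - y) ≤ e
      negate s y e h = ≤-trans (≤-reflexive (solve 2 (λ s y → :- (s :- y) := y :- s) refl s y))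
        (p≤q+r⇒p-q≤r (≤-trans (≤-reflexive (solve 2 (λ y e → y := (y :- e) :+ e) refl y e))
          (+-monoˡ-≤ e h)))
      upper′ : S - seq y n ≤ ½ * ε
      upper′ = p≤q+r⇒p-q≤r {S} {seq y n} (drop 0<η′ upper)
      lower′ : - (S - seq y n) ≤ ½ * ε
      lower′ = negate S (seq y n) (½ * ε) (drop 0<η lower)

-- An upper bound for the iterated power by natural numbers.

module Growth where

  open import Defs using (ℝ; seq; cauchy; IsExp; IsLog; IsPow; fromℕ)
  import Defs
  open ExponentialTerms
  open ExponentialSequences
  open _≈_
  open _≲_
  open import Data.Integer.Base as ℤ using (ℤ)
  open import Data.Nat.Base as ℕ using (ℕ; suc)
  open import Data.Rational.Base as ℚ
    using (ℚ; 0ℚ; 1ℚ; ½; _+_; _*_; _-_; -_; _≤_; _<_; ∣_∣)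
  open import Data.Rational.Properties hiding (_≟_)
  open import Data.Rational.Solver using (module +-*-Solver)
  open +-*-Solver using (solve; _:+_; _:*_; _:-_; :-_; _:=_; con)

  0<½ : 0ℚ < ½
  0<½ = positive⁻¹ ½

  ν-suc≰ : ∀ c → ¬ ν (suc c) ≤ ν c + ½
  ν-suc≰ c h = <-irrefl refl (<-≤-trans ½<1 (≤-trans
    (≤-reflexive (solve 1 (λ n → con 1ℚ := (con 1ℚ :+ n) :- n) refl (ν c)))
    (p≤q+r⇒p-q≤r (≤-trans (≤-reflexive (sym (ν-suc c))) h))))
    where
    ½<1 : ½ < 1ℚ
    ½<1 = ℚ.*<* (ℤ.+<+ (ℕ.s≤s (ℕ.s≤s ℕ.z≤n)))

  exp-one : ℕ → ℚ
  exp-one = expSum (ν 1)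

  2≤exp-one : ∀ {n} → 2 ℕ.≤ n → ν 2 ≤ exp-one n
  2≤exp-one {n} 2≤n = ≤-trans (≤-reflexive two) (sumTo-mono (term-nonNeg (0≤ν 1)) 2≤n)
    where
    two : ν 2 ≡ exp-one 2
    two = trans (ν≡ 2) (cong (λ p → expSum p 2) (sym ν-1))

  exp-one≤4 : ∀ {n} → 2 ℕ.≤ n → exp-one n ≤ ν 4
  exp-one≤4 {n} 2≤n = ≤-trans (Tail.expSum≤ 0 ℕ.≤-refl 2≤n) (subst₂ _≤_
    (cong (λ p → expSum p 2 + (term p 2 + term p 2)) (sym ν-1)) (sym (ν≡ 4)) (≤ᵇ⇒≤ _))

  exp-ν : ∀ m → (λ n → exp-one n ↑ m) ≈ exp (λ _ → ν m)
  exp-ν m = ≈-trans (exp-↑ m (bounded-const (ν 1)))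
    (≡⇒≈ (0 , λ n _ → cong (λ p → expSum p n) (trans (cong (ν m *_) ν-1) (*-identityʳ (ν m)))))

  2^≲exp : ∀ m → (λ _ → ν (2 ℕ.^ m)) ≲ exp (λ _ → ν m)
  2^≲exp m = ≲-trans {g = λ n → exp-one n ↑ m}
    (≤⇒≲ (2 , λ n 2≤n → ≤-trans (≤-reflexive (ν-↑ 2 m)) (↑-mono m (0≤ν 2) (2≤exp-one 2≤n))))
    (≈⇒≲ (exp-ν m))

  exp≲4^ : ∀ m → exp (λ _ → ν m) ≲ (λ _ → ν (4 ℕ.^ m))
  exp≲4^ m = ≲-trans {g = λ n → exp-one n ↑ m} (≈⇒≲ (≈-sym (exp-ν m)))
    (≤⇒≲ (2 , λ n 2≤n → ≤-trans
      (↑-mono m (≤-trans (0≤ν 2) (2≤exp-one 2≤n)) (exp-one≤4 2≤n)) (≤-reflexive (sym (ν-↑ 4 m)))))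

  constant-≲ : ∀ {c d} → (λ _ → ν c) ≲ (λ _ → ν d) → ¬ d ℕ.< c
  constant-≲ {c} {d} c≲d d<c = let M , h = below c≲d ½ 0<½ in
    ν-suc≰ d (≤-trans (ν-mono-≤ d<c) (h M ℕ.≤-refl))

  -- A single approximation, within ½ of all later ones, is compared with U + ½. If it is larger,
  -- then `x` is eventually at least `U` and 2^U is at most `c`; otherwise the slack costs the step
  -- from `U` to `suc U`.
  log-bound : ∀ {x y c U} → IsExp x y → seq y ≲ (λ _ → ν c) → c ℕ.< 2 ℕ.^ U →
    Eventually (λ n → seq x n ≤ ν (suc U))
  log-bound {x} {y} {c} {U} isExp y≲c c<2^U = decide (seq x M ≤? ν U + ½)
    where
    M = proj₁ (cauchy x ½ 0<½)
    near : ∀ n → M ℕ.≤ n → ∣ seq x n - seq x M ∣ ≤ ½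
    near n M≤n = <⇒≤ (proj₂ (cauchy x ½ 0<½) n M M≤n ℕ.≤-refl)
    add-halves : ∀ p → (p + ½) + ½ ≡ 1ℚ + p
    add-halves = solve 1 (λ p → (p :+ con ½) :+ con ½ := con 1ℚ :+ p) refl
    decide : _ → Eventually (λ n → seq x n ≤ ν (suc U))
    decide (yes xM≤) = M , λ n M≤n → ≤-trans (∣p-q∣≤⇒p≤q+ (near n M≤n))
      (≤-trans (+-monoˡ-≤ ½ xM≤) (≤-reflexive (trans (add-halves (ν U)) (sym (ν-suc U)))))
    decide (no xM≰) = contradiction c<2^U (constant-≲
      (≲-trans (2^≲exp U) (≲-trans {g = exp (seq x)}
        (exp-mono (bounded-const (ν U)) (seq-bounded x) (M , U≤))
        (≲-trans (≈⇒≲ (isExp⇒≈ {x} {y} isExp)) y≲c))))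
      where
      U≤ : ∀ n → M ℕ.≤ n → ν U ≤ seq x n
      U≤ n M≤n = +-cancelʳ (≤-trans (<⇒≤ (≰⇒> xM≰)) (∣p-q∣≤⇒q≤p+ {seq x n} (near n M≤n)))
        where
        +-cancelʳ : ∀ {p q} → p + ½ ≤ q + ½ → p ≤ q
        +-cancelʳ {p} {q} h = 0≤q-p⇒p≤q (≤-trans (p≤q⇒0≤q-p h)
          (≤-reflexive (solve 3 (λ p q r → (q :+ r) :- (p :+ r) := q :- p) refl p q ½)))

  exp-limit-nonNeg : ∀ {x y} → IsExp x y → (λ _ → 0ℚ) ≲ seq y
  exp-limit-nonNeg {x} {y} isExp = ≲-trans (exp-nonNeg (seq-bounded x)) (≈⇒≲ (isExp⇒≈ {x} {y} isExp))

  -- Both sides are the exponential of k ℓ.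
  power-relation : ∀ {ℓ b L E : ℝ} {q m k} → IsExp ℓ L → IsExp (b Defs.* ℓ) E →
    (∀ n → seq b n ≡ q) → ν m * q ≡ ν k → (λ n → seq E n ↑ m) ≈ (λ n → seq L n ↑ k)
  power-relation {ℓ} {b} {L} {E} {q} {m} {k} isL isE b≡q mq≡k =
    ≈-trans (≈-sym (≈-↑ m (exp-bounded (seq-bounded (b Defs.* ℓ))) (seq-bounded E) (isExp⇒≈ {b Defs.* ℓ} {E} isE)))
    (≈-trans (exp-↑ m (seq-bounded (b Defs.* ℓ)))
    (≈-trans (≡⇒≈ (0 , λ n _ → cong (λ p → expSum p n) (scale n)))
    (≈-trans (≈-sym (exp-↑ k (seq-bounded ℓ)))
      (≈-↑ k (exp-bounded (seq-bounded ℓ)) (seq-bounded L) (isExp⇒≈ {ℓ} {L} isL)))))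
    where
    scale : ∀ n → ν m * (seq b n * seq ℓ n) ≡ ν k * seq ℓ n
    scale n = trans (sym (*-assoc (ν m) (seq b n) (seq ℓ n)))
      (cong (_* seq ℓ n) (trans (cong (ν m *_) (b≡q n)) mq≡k))

  -- Were `e` above `W`, then W^m would be at most (V + 1)^k + ½; but these powers are integers, a
  -- full unit apart.
  root-bound : ∀ {e l : Seq} {m k V W} → (λ n → e n ↑ m) ≈ (λ n → l n ↑ k) →
    (λ _ → 0ℚ) ≲ l → Eventually (λ n → l n ≤ ν (suc V)) → suc V ℕ.^ k ℕ.< W ℕ.^ m →
    Eventually (λ n → e n ≤ ν W)
  root-bound {e} {l} {m} {k} {V} {W} e≈l 0≲l l≤ V<W = eventually₂ (λ n p (q , r) → bound n p q r)
    (within e≈l ½ 0<½) (eventually₂ (λ n → _,_) (below 0≲l 1ℚ (positive⁻¹ 1ℚ)) l≤)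
    where
    open ≤-Reasoning
    bound : ∀ n → ∣ e n ↑ m - l n ↑ k ∣ ≤ ½ → 0ℚ ≤ l n + 1ℚ → l n ≤ ν (suc V) → e n ≤ ν W
    bound n close -1≤l l≤ = ≮⇒≥ λ W<e → ν-suc≰ (suc V ℕ.^ k) (begin
      ν (suc (suc V ℕ.^ k))    ≤⟨ ν-mono-≤ V<W ⟩
      ν (W ℕ.^ m)              ≡⟨ ν-↑ W m ⟩
      ν W ↑ m                  ≤⟨ ↑-mono m (0≤ν W) (<⇒≤ W<e) ⟩
      e n ↑ m                  ≤⟨ ∣p-q∣≤⇒p≤q+ close ⟩
      l n ↑ k + ½              ≤⟨ +-monoˡ-≤ ½ (p≤∣p∣ (l n ↑ k)) ⟩
      ∣ l n ↑ k ∣ + ½          ≡⟨ cong (_+ ½) (∣↑∣ (l n) k) ⟩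
      ∣ l n ∣ ↑ k + ½          ≤⟨ +-monoˡ-≤ ½ (↑-mono k (0≤∣p∣ (l n)) (∣p∣≤ l≤ -l≤)) ⟩
      ν (suc V) ↑ k + ½        ≡⟨ cong (_+ ½) (ν-↑ (suc V) k) ⟨
      ν (suc V ℕ.^ k) + ½      ∎)
      where
      -l≤ : - l n ≤ ν (suc V)
      -l≤ = ≤-trans (0≤q-p⇒p≤q (≤-trans -1≤l (≤-reflexive
        (solve 1 (λ l → l :+ con 1ℚ := con 1ℚ :- (:- l)) refl (l n)))))
        (≤-trans (≤-reflexive (sym ν-1)) (ν-mono-≤ (ℕ.s≤s ℕ.z≤n)))

  -- The approximations of `e` may be slightly negative, so `e` is raised by an `η` with η |l| at
  -- most 1; this accounts for both successors in the bound.
  product-bound : ∀ {e l : Seq} {V W} → Bounded l → (λ _ → 0ℚ) ≲ e →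
    Eventually (λ n → e n ≤ ν W) → Eventually (λ n → l n ≤ ν V) →
    Eventually (λ n → e n * l n ≤ ν (suc (suc W ℕ.* V)))
  product-bound {e} {l} {V} {W} (N , ∣l∣≤) 0≲e e≤ l≤ =
    let η , 0<η , η*≡1 = fraction 1ℚ N (positive⁻¹ 1ℚ) in
    eventually₂ (λ n (p , q) (r , s) → bound η (<⇒≤ 0<η) η*≡1 (e n) (l n) p q r s)
      (eventually₂ (λ n → _,_) ∣l∣≤ (below 0≲e η 0<η)) (eventually₂ (λ n → _,_) e≤ l≤)
    where
    open ≤-Reasoning
    bound : ∀ η → 0ℚ ≤ η → η * ν (suc N) ≡ 1ℚ → ∀ e l → ∣ l ∣ ≤ ν (suc N) → 0ℚ ≤ e + η →
      e ≤ ν W → l ≤ ν V → e * l ≤ ν (suc (suc W ℕ.* V))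
    bound η 0≤η η*≡1 e l ∣l∣≤ 0≤e+η e≤ l≤ = begin
      e * l                              ≡⟨ solve 3 (λ e l η → e :* l := (e :+ η) :* l :+ η :* (:- l)) refl e l η ⟩
      (e + η) * l + η * - l              ≤⟨ +-mono-≤ (*-mono 0≤e+η (0≤ν V) e+η≤ l≤)
                                              (*-monoˡ η 0≤η (≤-trans (-p≤∣p∣ l) ∣l∣≤)) ⟩
      ν (suc W) * ν V + η * ν (suc N)    ≡⟨ cong₂ _+_ (sym (ν-* (suc W) V)) η*≡1 ⟩
      ν (suc W ℕ.* V) + 1ℚ               ≡⟨ +-comm (ν (suc W ℕ.* V)) 1ℚ ⟩
      1ℚ + ν (suc W ℕ.* V)               ≡⟨ ν-suc (suc W ℕ.* V) ⟨
      ν (suc (suc W ℕ.* V))              ∎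
      where
      η≤1 : η ≤ 1ℚ
      η≤1 = begin
        η                ≡⟨ *-identityʳ η ⟨
        η * 1ℚ           ≤⟨ *-monoˡ η 0≤η (≤-trans (≤-reflexive (sym ν-1)) (ν-mono-≤ (ℕ.s≤s ℕ.z≤n))) ⟩
        η * ν (suc N)    ≡⟨ η*≡1 ⟩
        1ℚ               ∎
      e+η≤ : e + η ≤ ν (suc W)
      e+η≤ = begin
        e + η          ≤⟨ +-mono-≤ e≤ η≤1 ⟩
        ν W + 1ℚ       ≡⟨ +-comm (ν W) 1ℚ ⟩
        1ℚ + ν W       ≡⟨ ν-suc W ⟨
        ν (suc W)      ∎

  -- `W` bounds `E`, and `suc U` bounds the logarithm of `n` in both of its occurrences, as `L` and
  -- as the witness `ℓ₂` inside the power; e ≤ 4 then bounds `X`.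
  pow<fromℕ : ∀ {n m k U W R q} {b L E X : ℝ} → (∀ i → seq b i ≡ q) → ν m * q ≡ ν k →
    n ℕ.< 2 ℕ.^ U → suc U ℕ.^ k ℕ.< W ℕ.^ m → 4 ℕ.^ suc (suc W ℕ.* suc U) ℕ.< R →
    IsLog (fromℕ n) L → IsPow L b E → IsPow (fromℕ n) E X → X Defs.< fromℕ R
  pow<fromℕ {n} {m} {k} {U} {W} {R} {b = b} {L} {E} {X} b≡q mq≡k n< V<W 4^<R isL (ℓ , expℓ , isE) (ℓ₂ , isℓ₂ , isX) =
    ½ , 0<½ , proj₁ X≤ , λ i M≤i → ≤-trans (+-monoˡ-≤ ½ (proj₂ X≤ i M≤i))
      (≤-trans (≤-reflexive (add-halves (ν (4 ℕ.^ Y))))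
        (≤-trans (≤-reflexive (sym (ν-suc (4 ℕ.^ Y))))
          (≤-trans (ν-mono-≤ 4^<R) (≤-reflexive (ν≡ R)))))
    where
    Y = suc (suc W ℕ.* suc U)
    add-halves : ∀ p → (p + ½) + ½ ≡ 1ℚ + p
    add-halves = solve 1 (λ p → (p :+ con ½) :+ con ½ := con 1ℚ :+ p) refl
    n≲n : seq (fromℕ n) ≲ (λ _ → ν n)
    n≲n = ≤⇒≲ (0 , λ _ _ → ≤-reflexive (sym (ν≡ n)))
    E≤W : Eventually (λ i → seq E i ≤ ν W)
    E≤W = root-bound {seq E} {seq L} {m} {k} {U} {W} (power-relation {ℓ} {b} {L} {E} expℓ isE b≡q mq≡k)
      (exp-limit-nonNeg {ℓ} {L} expℓ) (log-bound {L} {fromℕ n} {n} {U} isL n≲n n<) V<W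
    Eλ≤Y : Eventually (λ i → seq E i * seq ℓ₂ i ≤ ν Y)
    Eλ≤Y = product-bound {seq E} {seq ℓ₂} (seq-bounded ℓ₂) (exp-limit-nonNeg {b Defs.* ℓ} {E} isE) E≤W
      (log-bound {ℓ₂} {fromℕ n} {n} {U} isℓ₂ n≲n n<)
    X≲4^Y : seq X ≲ (λ _ → ν (4 ℕ.^ Y))
    X≲4^Y = ≲-trans (≈⇒≲ (≈-sym (isExp⇒≈ {E Defs.* ℓ₂} {X} isX)))
      (≲-trans (exp-mono (seq-bounded (E Defs.* ℓ₂)) (bounded-const (ν Y)) Eλ≤Y) (exp≲4^ Y))
    X≤ : Eventually (λ i → seq X i ≤ ν (4 ℕ.^ Y) + ½)
    X≤ = below X≲4^Y ½ 0<½

-- The choice of q for a given n, and the inequalities between exponents.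

module Parameters where

  open StepUp
  open import Data.Nat.Base
  open import Data.Nat.DivMod using (_/_; m/n*n≤m)
  open import Data.Nat.Properties
  open import Data.Nat.Tactic.RingSolver using (solve-∀)

  module Index (f : ℕ → ℕ) (f-increasing : ∀ s → f s < f (suc s)) where

    -- The largest s with f s < n, or 0 if there is none. Raising it by at most one per step is
    -- enough because `f` grows by at least one.
    index : ℕ → ℕ
    index zero    = 0
    index (suc n) with f (suc (index n)) <? suc n
    ... | yes _ = suc (index n)
    ... | no  _ = index n

    index-upper : ∀ n → n ≤ f (suc (index n))
    index-upper zero    = z≤n
    index-upper (suc n) with f (suc (index n)) <? suc n
    ... | yes _  = ≤-trans (s≤s (index-upper n)) (f-increasing (suc (index n)))
    ... | no  ≮n = ≮⇒≥ ≮n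

    index-lower : ∀ n → 0 < index n → f (index n) < n
    index-lower (suc n) 0<i with f (suc (index n)) <? suc n
    ... | yes <n = <n
    ... | no  _  = m<n⇒m<1+n (index-lower n 0<i)

    index-large : ∀ {s n} → f s < n → s ≤ index n
    index-large {s} {n} fs<n = ≮⇒≥ λ i<s →
      <⇒≱ fs<n (≤-trans (index-upper n) (f-mono i<s))
      where
      f-mono : ∀ {i j} → i ≤ j → f i ≤ f j
      f-mono {i} {j} i≤j with ≤⇒≤′ i≤j
      ... | ≤′-refl          = ≤-refl
      ... | ≤′-step {j} i≤′j = ≤-trans (f-mono (≤′⇒≤ i≤′j)) (<⇒≤ (f-increasing j))

  -- Passing from s to suc s multiplies logThreshold by 2 ^ O(s) only, because
  -- its exponent is a square; in power-bound this loss, raised to the power t,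
  -- is outweighed by the gain of 2 ^ (3 s²) when t is at most s / 12.

  logThreshold : ℕ → ℕ
  logThreshold s = suc (s * s) * (3 * 8 ^ (s * s))

  -- Opaque, so that the huge number threshold 24 is never evaluated.
  abstract
    threshold : ℕ → ℕ
    threshold s = 2 ^ logThreshold s

    threshold≡ : ∀ s → threshold s ≡ 2 ^ logThreshold s
    threshold≡ s = refl

  threshold-increasing : ∀ s → threshold s < threshold (suc s)
  threshold-increasing s = subst₂ _<_ (sym (threshold≡ s)) (sym (threshold≡ (suc s))) (^-monoʳ-< 2 (s≤s (s≤s z≤n))
    (*-mono-< (s≤s square<) (*-monoʳ-< 3 (^-monoʳ-< 8 (s≤s (s≤s z≤n)) square<))))
    where
    square< : s * s < suc s * suc s
    square< = *-mono-< (n<1+n s) (n<1+n s)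

  -- A power of 2, so that the later estimates compare exponents only.
  side : ℕ → ℕ
  side s = 2 ^ (s * s)

  -- Lines and points together number 3 q³, and q + 1 is at most 2 q = 2^(s² + 1); `logThreshold` is
  -- the resulting binary logarithm.
  few-independent : ∀ s → let open Flags (side s) in
    suc (side s) ^ lines * suc (side s) ^ points ≤ threshold s
  few-independent s = begin
    suc q ^ lines * suc q ^ points       ≡⟨ ^-distribˡ-+-* (suc q) lines points ⟨
    suc q ^ (lines + points)             ≤⟨ ^-monoˡ-≤ (lines + points) suc-q≤ ⟩
    (2 ^ suc b) ^ (lines + points)       ≡⟨ ^-*-assoc 2 (suc b) (lines + points) ⟩
    2 ^ (suc b * (lines + points))       ≡⟨ cong (λ e → 2 ^ (suc b * e)) (trans (collect q) (cong (3 *_) cube)) ⟩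
    2 ^ (suc b * (3 * 8 ^ b))            ≡⟨ threshold≡ s ⟨
    threshold s                          ∎
    where
    open ≤-Reasoning
    open Flags (side s) using (lines; points)
    b = s * s
    q = side s
    suc-q≤ : suc q ≤ 2 ^ suc b
    suc-q≤ = ≤-trans (+-monoˡ-≤ q (m^n>0 2 b)) (≤-reflexive (cong (q +_) (sym (+-identityʳ q))))
    collect : ∀ q → q * (q * q) + q * (q * q + q * q) ≡ 3 * (q * (q * q))
    collect = solve-∀
    cube : q * (q * q) ≡ 8 ^ b
    cube = trans (cong (q *_) (sym (^-distribˡ-+-* 2 b b))) (trans (sym (^-distribˡ-+-* 2 b (b + b)))
      (trans (cong (2 ^_) (triple b)) (sym (^-*-assoc 2 3 b))))
      where
      triple : ∀ b → b + (b + b) ≡ 3 * b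
      triple = solve-∀

  size-side : ∀ s → Flags.size (side s) ≡ 2 ^ (4 * (s * s))
  size-side s = trans (cong (λ p → q * (q * p)) (sym (^-distribˡ-+-* 2 b b)))
    (trans (cong (q *_) (sym (^-distribˡ-+-* 2 b (b + b))))
      (trans (sym (^-distribˡ-+-* 2 b (b + (b + b)))) (cong (2 ^_) (quadruple b))))
    where
    b = s * s
    q = 2 ^ b
    quadruple : ∀ b → b + (b + (b + b)) ≡ 4 * b
    quadruple = solve-∀

  n<2^n : ∀ n → n < 2 ^ n
  n<2^n zero    = s≤s z≤n
  n<2^n (suc n) = ≤-trans (s≤s (n<2^n n))
    (≤-trans (+-monoˡ-≤ (2 ^ n) (m^n>0 2 n)) (≤-reflexive (cong (2 ^ n +_) (sym (+-identityʳ (2 ^ n))))))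

  -- Since `n` is bounded above only by the next threshold, `suc s` enters here.
  logBound : ℕ → ℕ
  logBound s = suc (logThreshold (suc s))

  -- 3 (s + 1)² bits for the power of 8, 2 s for the factor (s + 1)² and 3 for the constants.
  logBits : ℕ → ℕ
  logBits s = 3 * (s * s) + 8 * s + 6

  logBound< : ∀ s → suc (logBound s) ≤ 2 ^ logBits s
  logBound< s = begin
    suc (suc (suc d * (3 * 8 ^ d)))      ≤⟨ +-monoˡ-≤ (suc d * (3 * 8 ^ d)) (*-monoʳ-≤ 2 (m^n>0 8 d)) ⟩
    2 * 8 ^ d + suc d * (3 * 8 ^ d)      ≡⟨ collect d (8 ^ d) ⟩
    (5 + 3 * d) * 8 ^ d                  ≤⟨ *-monoˡ-≤ (8 ^ d) (+-mono-≤ (*-monoʳ-≤ 5 1≤p²)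
                                              (*-monoʳ-≤ 3 (*-mono-≤ (n<2^n s) (n<2^n s)))) ⟩
    (5 * (p * p) + 3 * (p * p)) * 8 ^ d  ≡⟨ cong (_* 8 ^ d) (eight (p * p)) ⟩
    8 * (p * p) * 8 ^ d                  ≡⟨ cong₂ (λ i j → 8 * i * j) (sym (^-distribˡ-+-* 2 s s)) (^-*-assoc 2 3 d) ⟩
    2 ^ 3 * 2 ^ (s + s) * 2 ^ (3 * d)    ≡⟨ cong (_* 2 ^ (3 * d)) (sym (^-distribˡ-+-* 2 3 (s + s))) ⟩
    2 ^ (3 + (s + s)) * 2 ^ (3 * d)      ≡⟨ ^-distribˡ-+-* 2 (3 + (s + s)) (3 * d) ⟨
    2 ^ (3 + (s + s) + 3 * d)            ≡⟨ cong (2 ^_) (bits s) ⟩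
    2 ^ logBits s                        ∎
    where
    open ≤-Reasoning
    d = suc s * suc s
    p = 2 ^ s
    1≤p² : 1 ≤ p * p
    1≤p² = *-mono-≤ (m^n>0 2 s) (m^n>0 2 s)
    collect : ∀ d e → 2 * e + suc d * (3 * e) ≡ (5 + 3 * d) * e
    collect = solve-∀
    eight : ∀ e → 5 * e + 3 * e ≡ 8 * e
    eight = solve-∀
    bits : ∀ s → 3 + (s + s) + 3 * (suc s * suc s) ≡ 3 * (s * s) + 8 * s + 6
    bits = solve-∀

  -- A third of `logBits` is about s². The 9 s bits given up pay, once s ≥ 9, for the excess 8 s + 6
  -- of `logBits` over 3 s² and for 3 bits of rounding.
  rootBits : ℕ → ℕ
  rootBits s = s * (s ∸ 9)

  rootBound : ℕ → ℕ
  rootBound s = 2 ^ rootBits s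

  rootBits≡ : ∀ {s} → 9 ≤ s → rootBits s + 9 * s ≡ s * s
  rootBits≡ {s} 9≤s = trans (cong (rootBits s +_) (*-comm 9 s))
    (trans (sym (*-distribˡ-+ s (s ∸ 9) 9)) (cong (s *_) (m∸n+n≡m 9≤s)))

  result-bound : ∀ {s} → 9 ≤ s →
    4 ^ suc (suc (rootBound s) * suc (logBound s)) ≤ 2 ^ Flags.size (side s)
  result-bound {s} 9≤s = begin
    4 ^ suc (suc W * suc (logBound s))   ≡⟨ ^-*-assoc 2 2 (suc (suc W * suc (logBound s))) ⟩
    2 ^ (2 * suc (suc W * suc (logBound s)))   ≤⟨ ^-monoʳ-≤ 2 doubled ⟩
    2 ^ 2 ^ (4 * (s * s))                      ≡⟨ cong (2 ^_) (size-side s) ⟨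
    2 ^ Flags.size (side s)                    ∎
    where
    open ≤-Reasoning
    W = rootBound s
    w = rootBits s
    u = logBits s
    exponents : 3 + (w + u) ≤ 4 * (s * s)
    exponents = begin
      3 + (w + (3 * (s * s) + 8 * s + 6))   ≡⟨ regroup w (s * s) s ⟩
      (w + 8 * s + 9) + 3 * (s * s)         ≤⟨ +-monoˡ-≤ (3 * (s * s)) (+-monoʳ-≤ (w + 8 * s) 9≤s) ⟩
      (w + 8 * s + s) + 3 * (s * s)         ≡⟨ regroup′ w (s * s) s ⟩
      (w + 9 * s) + 3 * (s * s)             ≡⟨ cong (_+ 3 * (s * s)) (rootBits≡ 9≤s) ⟩
      4 * (s * s)                           ∎
      where
      regroup : ∀ w d s → 3 + (w + (3 * d + 8 * s + 6)) ≡ (w + 8 * s + 9) + 3 * d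
      regroup = solve-∀
      regroup′ : ∀ w d s → (w + 8 * s + s) + 3 * d ≡ (w + 9 * s) + 3 * d
      regroup′ = solve-∀
    doubled : 2 * suc (suc W * suc (logBound s)) ≤ 2 ^ (4 * (s * s))
    doubled = begin
      2 * (1 + suc W * suc (logBound s))        ≤⟨ *-monoʳ-≤ 2 (+-mono-≤
                                                     (*-mono-≤ {1} {W + W} {1} (≤-trans (m^n>0 2 w) (m≤m+n W W)) (m^n>0 2 u))
                                                     (*-mono-≤ (+-monoˡ-≤ W (m^n>0 2 w)) (logBound< s))) ⟩
      2 * ((W + W) * 2 ^ u + (W + W) * 2 ^ u)   ≡⟨ collect W (2 ^ u) ⟩
      8 * (W * 2 ^ u)                           ≡⟨ cong (8 *_) (^-distribˡ-+-* 2 w u) ⟨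
      2 ^ 3 * 2 ^ (w + u)                       ≡⟨ ^-distribˡ-+-* 2 3 (w + u) ⟨
      2 ^ (3 + (w + u))                         ≤⟨ ^-monoʳ-≤ 2 exponents ⟩
      2 ^ (4 * (s * s))                         ∎
      where
      collect : ∀ W e → 2 * ((W + W) * e + (W + W) * e) ≡ 8 * (W * e)
      collect = solve-∀

  power-bound : ∀ {s} t → 12 * suc t ≤ s → suc (logBound s) ^ t < rootBound s ^ (3 * suc t)
  power-bound {s} t 12t≤s = begin-strict
    suc (logBound s) ^ t        ≤⟨ ^-monoˡ-≤ t (logBound< s) ⟩
    (2 ^ u) ^ t                 ≡⟨ ^-*-assoc 2 u t ⟩
    2 ^ (u * t)                 <⟨ ^-monoʳ-< 2 (s≤s (s≤s z≤n)) exponents ⟩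
    2 ^ (w * (3 * suc t))       ≡⟨ ^-*-assoc 2 w (3 * suc t) ⟨
    (2 ^ w) ^ (3 * suc t)       ∎
    where
    open ≤-Reasoning
    u = logBits s
    w = rootBits s
    12≤s : 12 ≤ s
    12≤s = ≤-trans (*-monoʳ-≤ 12 (s≤s z≤n)) 12t≤s
    9≤s : 9 ≤ s
    9≤s = ≤-trans (m≤m+n 9 3) 12≤s
    exponents : u * t < w * (3 * suc t)
    exponents = +-cancelʳ-< (27 * s * suc t) (u * t) (w * (3 * suc t)) (begin-strict
      (3 * (s * s) + 8 * s + 6) * t + 27 * s * suc t    ≡⟨ expand s t ⟩
      3 * (s * s) * t + (35 * (s * t) + 6 * t + 27 * s) <⟨ +-monoʳ-< (3 * (s * s) * t) small ⟩
      3 * (s * s) * t + 3 * (s * s)                     ≡⟨ factor (s * s) t ⟩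
      s * s * (3 * suc t)                               ≡⟨ cong (_* (3 * suc t)) (rootBits≡ 9≤s) ⟨
      (w + 9 * s) * (3 * suc t)                         ≡⟨ distribute w s t ⟩
      w * (3 * suc t) + 27 * s * suc t                  ∎)
      where
      expand : ∀ s t → (3 * (s * s) + 8 * s + 6) * t + 27 * s * suc t ≡
        3 * (s * s) * t + (35 * (s * t) + 6 * t + 27 * s)
      expand = solve-∀
      factor : ∀ d t → 3 * d * t + 3 * d ≡ d * (3 * suc t)
      factor = solve-∀
      distribute : ∀ w s t → (w + 9 * s) * (3 * suc t) ≡ w * (3 * suc t) + 27 * s * suc t
      distribute = solve-∀
      collect : ∀ s t → 35 * (s * t) + s * t + 36 * s ≡ 3 * s * (12 * suc t)
      collect = solve-∀
      -- Rounding 6 t up to s t and 27 s up to 36 s gives 36 s (t + 1), and 12 (t + 1) ≤ s.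
      small : 35 * (s * t) + 6 * t + 27 * s < 3 * (s * s)
      small = begin-strict
        35 * (s * t) + 6 * t + 27 * s    <⟨ +-mono-≤-< (+-monoʳ-≤ (35 * (s * t)) (*-monoˡ-≤ t (≤-trans (m≤m+n 6 6) 12≤s)))
                                              (*-monoˡ-< s {{>-nonZero (≤-trans (s≤s z≤n) 12≤s)}} (m≤m+n 28 8)) ⟩
        35 * (s * t) + s * t + 36 * s    ≡⟨ collect s t ⟩
        3 * s * (12 * suc t)             ≤⟨ *-monoʳ-≤ (3 * s) 12t≤s ⟩
        3 * s * s                        ≡⟨ *-assoc 3 s s ⟩
        3 * (s * s)                      ∎

  open Index threshold threshold-increasing public

  -- Division by 24 instead of 12 leaves room for the successor in 12 (t + 1) ≤ s, as soon as s ≥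
  -- 24.
  rate : ℕ → ℕ
  rate n = index n / 24

  rate-bound : ∀ {n} → threshold 24 < n → 12 * suc (rate n) ≤ index n
  rate-bound {n} large = *-cancelˡ-≤ 2 (begin
    2 * (12 * suc t)    ≡⟨ regroup t ⟩
    t * 24 + 24         ≤⟨ +-mono-≤ (m/n*n≤m (index n) 24) (index-large large) ⟩
    index n + index n   ≡⟨ cong (index n +_) (+-identityʳ (index n)) ⟨
    2 * index n         ∎)
    where
    open ≤-Reasoning
    t = rate n
    regroup : ∀ t → 2 * (12 * suc t) ≡ t * 24 + 24
    regroup = solve-∀

-- The error term and the conclusion.

open StepUp
open Embedding
open ExponentialTerms
open ExponentialSequences
open Growth
open Parameters
import Data.Integer.Base as ℤ
open import Data.Nat.Base using (suc)
open import Data.Nat.DivMod using (m*n/n≡m; /-monoˡ-≤)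
open import Data.Rational.Base as ℚ using (ℚ; 0ℚ; 1ℚ; ½)
import Data.Rational.Properties as ℚ
open import Data.Rational.Solver using (module +-*-Solver)
open +-*-Solver using (solve; _:+_; _:*_; _:-_; _:=_; con)
open import Defs
open import Data.Nat.Base as ℕ using (ℕ)

-- A multiple 3 (t + 1) of 3, so that 1/3 - δ is t / (3 (t + 1)), a fraction with the same
-- denominator.
δ⁻¹ : ℕ → ℕ
δ⁻¹ n = 3 ℕ.* suc (rate n)

δ : ℕ → ℝ
δ n = fromℚ (ℤ.+ 1 ℚ./ δ⁻¹ n)

δ⁻¹*[⅓-δ] : ∀ t → ν (3 ℕ.* suc t) ℚ.* ((ℤ.+ 1 ℚ./ 3) ℚ.- (ℤ.+ 1 ℚ./ (3 ℕ.* suc t))) ≡ ν t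
δ⁻¹*[⅓-δ] t = begin
  ν M ℚ.* (third ℚ.- r)                         ≡⟨ distribute (ν M) third r ⟩
  ν M ℚ.* third ℚ.- r ℚ.* ν M                   ≡⟨ cong (λ p → p ℚ.* third ℚ.- r ℚ.* ν M) (ν-* 3 (suc t)) ⟩
  ν 3 ℚ.* ν (suc t) ℚ.* third ℚ.- r ℚ.* ν M     ≡⟨ cong₂ ℚ._-_ (swap (ν 3) (ν (suc t)) third) (reciprocal M) ⟩
  third ℚ.* ν 3 ℚ.* ν (suc t) ℚ.- 1ℚ            ≡⟨ cong₂ (λ p q → p ℚ.* q ℚ.- 1ℚ) (reciprocal 3) (ν-suc t) ⟩
  1ℚ ℚ.* (1ℚ ℚ.+ ν t) ℚ.- 1ℚ                    ≡⟨ cancel (ν t) ⟩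
  ν t                                           ∎
  where
  open ≡-Reasoning
  M = 3 ℕ.* suc t
  third = ℤ.+ 1 ℚ./ 3
  r = ℤ.+ 1 ℚ./ M
  distribute : ∀ n p r → n ℚ.* (p ℚ.- r) ≡ n ℚ.* p ℚ.- r ℚ.* n
  distribute = solve 3 (λ n p r → n :* (p :- r) := n :* p :- r :* n) refl
  swap : ∀ a b c → a ℚ.* b ℚ.* c ≡ c ℚ.* a ℚ.* b
  swap = solve 3 (λ a b c → a :* b :* c := c :* a :* b) refl
  cancel : ∀ n → 1ℚ ℚ.* (1ℚ ℚ.+ n) ℚ.- 1ℚ ≡ n
  cancel = solve 1 (λ n → con 1ℚ :* (con 1ℚ :+ n) :- con 1ℚ := n) refl

δ→0 : ConvergesTo δ 0ℝ
δ→0 ε 0<ε = let N , 1≤ = archimedean 1ℚ (½ ℚ.* ε) (half-positive 0<ε) in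
  suc (threshold (N ℕ.* 24)) , λ n n≥ → let d≥N = rate-large N n≥ in
  -- Both inequalities are strict and need a margin: `ε` below since δ is nonnegative, half of `ε`
  -- above since δ is at most the other half.
  (ε , 0<ε , 0 , λ _ _ → ℚ.≤-trans (ℚ.≤-reflexive (lower ε)) (reciprocal-nonNeg (δ⁻¹ n))) ,
  (½ ℚ.* ε , half-positive 0<ε , 0 , λ _ _ → ℚ.≤-trans
    (ℚ.+-monoˡ-≤ (½ ℚ.* ε) (small n (ℚ.≤-trans 1≤
      (*-monoˡ (½ ℚ.* ε) (ℚ.<⇒≤ (half-positive 0<ε)) (ν-mono-≤ (ℕ.≤-trans d≥N
        (ℕ.≤-trans (ℕ.n≤1+n _) (ℕ.m≤n*m (suc (rate n)) 3))))))))
    (ℚ.≤-reflexive (trans (halves ε) (sym (ℚ.+-identityˡ ε)))))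
  where
  lower : ∀ ε → (0ℚ ℚ.- ε) ℚ.+ ε ≡ 0ℚ
  lower = solve 1 (λ ε → (con 0ℚ :- ε) :+ ε := con 0ℚ) refl

  rate-large : ∀ N {n} → threshold (N ℕ.* 24) ℕ.< n → N ℕ.≤ rate n
  rate-large N {n} large = subst (ℕ._≤ rate n) (m*n/n≡m N 24)
    (/-monoˡ-≤ 24 (index-large large))

  small : ∀ n → 1ℚ ℚ.≤ ½ ℚ.* ε ℚ.* ν (δ⁻¹ n) → (ℤ.+ 1 ℚ./ δ⁻¹ n) ℚ.≤ ½ ℚ.* ε
  small n h = ν-cancelˡ-≤ _ (ℚ.≤-trans
    (ℚ.≤-reflexive (trans (ℚ.*-comm (ν (δ⁻¹ n)) (ℤ.+ 1 ℚ./ δ⁻¹ n)) (reciprocal (δ⁻¹ n))))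
    (ℚ.≤-trans h (ℚ.≤-reflexive (ℚ.*-comm (½ ℚ.* ε) (ν (δ⁻¹ n))))))

-- A smaller `R` would itself be the number of vertices of a counterexample, built with the side
-- belonging to the last threshold below `n`.
ramsey-number-large : ∀ {n} → threshold 24 ℕ.< n → ∀ {R} → IsRamseyNumber 3 ⟨ 4 , 3 , 4 ⟩ 4 n R →
  2 ℕ.^ Flags.size (side (index n)) ℕ.< R
ramsey-number-large {n} large {R} (ramsey , _) = ℕ.≰⇒> λ R≤ →
  SemiAlgebraicity.ramsey-fails (side (index n)) R R≤
    (ℕ.≤-<-trans (few-independent (index n)) (index-lower n (ℕ.<-≤-trans (ℕ.s≤s ℕ.z≤n) (index-large large))))
    ramsey

theorem1 : ∃[ d ] ∃[ D ] ∃[ m ] 0 ℕ.< d × 0 ℕ.< D × 0 ℕ.< m ×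
    (∃[ δ ] ConvergesTo δ 0ℝ ×
    (∃[ n₀ ] (∀ (n : ℕ) → n₀ ℕ.≤ n →
    ∀ (R : ℕ) → IsRamseyNumber 3 ⟨ d , D , m ⟩ 4 n R →
    ∀ (L E X : ℝ) →
    IsLog (fromℕ n) L →
    IsPow L (⅓ - δ n) E →
    IsPow (fromℕ n) E X →
    X < fromℕ R)))
theorem1 = 4 , 3 , 4 , ℕ.s≤s ℕ.z≤n , ℕ.s≤s ℕ.z≤n , ℕ.s≤s ℕ.z≤n ,
  δ , δ→0 , suc (threshold 24) , λ n large R isR L E X isL isE isX →
    let s = index n
        12t≤s = rate-bound large
        9≤s = ℕ.≤-trans (ℕ.m≤m+n 9 15) (index-large large)
    in pow<fromℕ {n} {δ⁻¹ n} {rate n} {logBound s} {rootBound s} {R} {b = ⅓ - δ n} {L} {E} {X}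
      (λ _ → refl) (δ⁻¹*[⅓-δ] (rate n))
      (ℕ.≤-<-trans (ℕ.≤-trans (index-upper n) (ℕ.≤-reflexive (threshold≡ (suc s))))
        (ℕ.^-monoʳ-< 2 (ℕ.s≤s (ℕ.s≤s ℕ.z≤n)) (ℕ.n<1+n (logThreshold (suc s)))))
      (power-bound (rate n) 12t≤s)
      (ℕ.≤-<-trans (result-bound 9≤s) (ramsey-number-large large isR))
      isL isE isX
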